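{- The following statements are equivalent: (1) $\mathsf{FP}_{+} \circ \mathsf{\#P} \subseteq \mathsf{\#P}$. (2) $\mathsf{\#P} = \mathsf{UPSV_t}$. (3) $\mathsf{PP} = \mathsf{UP}$.
   Context: NPTM means nondeterministic polynomial-time bounded Turing machine. $\mathsf{\#P} = \{acc_M \mid M \text{ is an NPTM}\}$, where $acc_M(x)$ is the number of accepting paths of $M$ on input $x \in \Sigma^*$. $\mathsf{FP}$ is the class of polynomial-time computable functions $\Sigma^* \to \mathbb{Z}$, and $\mathsf{FP}_{+}$ is the set of non-negative valued functions in $\mathsf{FP}$. $\mathsf{FP}_{+} \circ \mathsf{\#P}$ is the class of functions $x \mapsto f(g(x))$ with $f \in \mathsf{FP}_{+}$ (univariate) and $g \in \mathsf{\#P}$, where the integer $g(x)$ is given to $f$ in binary. $\mathsf{UPSV_t}$ is the class of total functions $f$ on $\Sigma^*$ for which there is an NPTM that on every input $x \in \Sigma^*$ has exactly one accepting path and outputs $f(x)$ on that path; here $\mathsf{UPSV_t}$ is assumed to contain only non-negative integer valued functions (values written in binary). $\mathsf{UP}$ is the class of languages $L$ for which there is $f \in \mathsf{\#P}$ with $f(x)=1$ if $x \in L$ and $f(x)=0$ if $x \notin L$. $\mathsf{PP}$ is the class of languages $L$ for which there are $f \in \mathsf{\#P}$ and $g \in \mathsf{FP}$ with $x \in L \Leftrightarrow f(x) > g(x)$ for all $x \in \Sigma^*$. -}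

module Defs where

open import Level using (0ℓ) renaming (suc to lsuc)
open import Data.Bool.Base using (Bool; true; false; T)
open import Data.Fin.Base using (Fin)
open import Data.Integer.Base as ℤ using (ℤ; +_; -[1+_]; 0ℤ)
open import Data.List.Base using (List; []; _∷_; length; map; reverse)
open import Data.List.Membership.Propositional using (_∈_)
open import Data.Nat.Base using (ℕ; zero; suc; _+_; _*_; _≤_)
open import Data.Product.Base using (_×_; _,_; ∃; ∃-syntax; Σ-syntax)
open import Data.Sum.Base using (_⊎_)
open import Data.Vec.Base as Vec using (Vec; _∷_)
open import Function.Bundles using (_↔_; _⇔_)
open import Relation.Binary.Construct.Closure.ReflexiveTransitive using (Star; fold)
open import Relation.Binary.PropositionalEquality using (_≡_)
open import Relation.Unary using (Pred) renaming (_∈_ to _∈ₚ_; _∉_ to _∉ₚ_)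

-- Σ = {0,1}, with false for 0 and true for 1.
Word : Set
Word = List Bool

-- Binary numerals, most significant bit first and without leading zeros; zero
-- is written "0".  `bitsLSB` lists the bits in the opposite order.
incrementLSB : Word → Word
incrementLSB []          = true ∷ []
incrementLSB (false ∷ w) = true ∷ w
incrementLSB (true  ∷ w) = false ∷ incrementLSB w

bitsLSB : ℕ → Word
bitsLSB zero    = false ∷ []
bitsLSB (suc n) = incrementLSB (bitsLSB n)

binary : ℕ → Word
binary n = reverse (bitsLSB n)

-- Sign bit (1 for negative) followed by the binary numeral of the absolute value.
binaryℤ : ℤ → Word
binaryℤ (+ n)    = false ∷ binary n
binaryℤ -[1+ n ] = true ∷ binary (suc n)

-- Polynomials over ℕ as coefficient lists, constant coefficient first.
Polynomial : Set
Polynomial = List ℕ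

eval : Polynomial → ℕ → ℕ
eval []      n = 0
eval (a ∷ p) n = a + n * eval p n

Finite : Set → Set
Finite A = ∃[ n ] (A ↔ Fin n)

-- Tape symbols are the blank, the input symbols, and finitely many others.
data Symbol (Aux : Set) : Set where
  blank : Symbol Aux
  bit   : Bool → Symbol Aux
  aux   : Aux → Symbol Aux

data Move : Set where
  left stay right : Move

-- A two-way infinite tape: the scanned cell, and on either side of it a list of
-- cells, nearest first, beyond which every cell is blank.
record Tape (Aux : Set) : Set where
  constructor tape
  field
    leftCells  : List (Symbol Aux)
    scanned    : Symbol Aux
    rightCells : List (Symbol Aux)

module _ {Aux : Set} where

  open Tape

  move : Move → Tape Aux → Tape Aux
  move left  (tape []       s rs)       = tape [] blank (s ∷ rs)
  move left  (tape (l ∷ ls) s rs)       = tape ls l (s ∷ rs)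
  move stay  t                          = t
  move right (tape ls       s [])       = tape (s ∷ ls) blank []
  move right (tape ls       s (r ∷ rs)) = tape (s ∷ ls) r rs

  writeMove : Symbol Aux × Move → Tape Aux → Tape Aux
  writeMove (s , m) t = move m (record t { scanned = s })

  blankTape : Tape Aux
  blankTape = tape [] blank []

  inputTape : Word → Tape Aux
  inputTape []      = blankTape
  inputTape (b ∷ w) = tape [] (bit b) (map bit w)

  leadingBits : List (Symbol Aux) → Word
  leadingBits (bit b ∷ ss) = b ∷ leadingBits ss
  leadingBits _            = []

  -- The word that starts at the head and extends to the right until the first
  -- cell that does not hold a symbol of Σ.
  tapeWord : Tape Aux → Word
  tapeWord t = leadingBits (scanned t ∷ rightCells t)

-- Nondeterministic Turing machines with any positive number of tapes.  `δ q ss`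
-- lists the transitions available in state q when the heads scan ss; the entries
-- of the list are distinct nondeterministic choices.
record TM : Set₁ where
  field
    State        : Set
    state-finite : Finite State
    Aux          : Set
    aux-finite   : Finite Aux
    extraTapes   : ℕ

  tapes : ℕ
  tapes = suc extraTapes

  field
    start     : State
    accepting : State → Bool
    δ         : State → Vec (Symbol Aux) tapes →
                List (State × Vec (Symbol Aux × Move) tapes)

  record Config : Set where
    constructor config
    field
      state   : State
      content : Vec (Tape Aux) tapes

  open Config

  transitions : Config → List (State × Vec (Symbol Aux × Move) tapes)
  transitions c = δ (state c) (Vec.map Tape.scanned (content c))

  successors : Config → List Config
  successors c =
    map (λ (q , as) → config q (Vec.zipWith writeMove as (content c))) (transitions c)

  -- Membership proofs are list positions, so paths are sequences of choices
  -- rather than sequences of configurations.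
  _⟶_ : Config → Config → Set
  c ⟶ c′ = c′ ∈ successors c

  _⟶*_ : Config → Config → Set
  _⟶*_ = Star _⟶_

  steps : ∀ {c c′} → c ⟶* c′ → ℕ
  steps = fold (λ _ _ → ℕ) (λ _ n → suc n) 0

  initial : Word → Config
  initial x = config start (inputTape x ∷ Vec.replicate extraTapes blankTape)

  Halting : Config → Set
  Halting c = successors c ≡ []

  output : Config → Word
  output c = tapeWord (Vec.head (content c))

  record AcceptingPath (x : Word) : Set where
    field
      {end}   : Config
      path    : initial x ⟶* end
      halts   : Halting end
      accepts : T (accepting (state end))

  -- The bound covers every partial computation, so no computation is infinite.
  PolynomialTime : Set
  PolynomialTime =
    ∃[ p ] (∀ x {c} (π : initial x ⟶* c) → steps π ≤ eval p (length x))

  Deterministic : Set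
  Deterministic = ∀ q ss → length (δ q ss) ≤ 1

record NPTM : Set₁ where
  field
    machine        : TM
    polynomialTime : TM.PolynomialTime machine
  open TM machine public

acc_at_is_ : NPTM → Word → ℕ → Set
acc M at x is n = NPTM.AcceptingPath M x ↔ Fin n

#P : Pred (Word → ℕ) (lsuc 0ℓ)
#P f = Σ[ M ∈ NPTM ] (∀ x → acc M at x is f x)

FP : Pred (Word → ℤ) (lsuc 0ℓ)
FP f = Σ[ M ∈ NPTM ] let open NPTM M in
  Deterministic ×
  (∀ x → ∃[ c ] (initial x ⟶* c) × Halting c × output c ≡ binaryℤ (f x))

FP₊ : Pred (Word → ℤ) (lsuc 0ℓ)
FP₊ f = FP f × (∀ x → 0ℤ ℤ.≤ f x)

FP₊∘#P : Pred (Word → ℕ) (lsuc 0ℓ)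
FP₊∘#P h = Σ[ f ∈ (Word → ℤ) ] Σ[ g ∈ (Word → ℕ) ]
  FP₊ f × #P g × (∀ x → + h x ≡ f (binary (g x)))

UPSVₜ : Pred (Word → ℕ) (lsuc 0ℓ)
UPSVₜ f = Σ[ M ∈ NPTM ] let open NPTM M in
  ∀ x → acc M at x is 1 ×
        (∀ (π : AcceptingPath x) → output (AcceptingPath.end π) ≡ binary (f x))

Language : Set₁
Language = Pred Word 0ℓ

-- The value of f is given by cases on membership, so the case distinction is
-- part of the datum: two implications from x ∈ L and x ∉ L would classically
-- say the same but would not make membership decidable.
UP : Pred Language (lsuc 0ℓ)
UP L = Σ[ f ∈ (Word → ℕ) ] #P f ×
  (∀ x → (x ∈ₚ L × f x ≡ 1) ⊎ (x ∉ₚ L × f x ≡ 0))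

PP : Pred Language (lsuc 0ℓ)
PP L = Σ[ f ∈ (Word → ℕ) ] Σ[ g ∈ (Word → ℤ) ]
  #P f × FP g × (∀ x → x ∈ₚ L ⇔ (+ f x) ℤ.> g x)

{-# OPTIONS --safe #-}

-- (2) ⇒ (1): if g is computed by a machine with a unique accepting path, so is f ∘ g, and
-- UPSVₜ ⊆ #P because a path can go on to guess a number below its output.
-- (1) ⇒ (3): filling up the computation tree of a machine to a complete tree with 2^Q leaves,
-- Q polynomial, shows that 2^Q − f is in #P for f in #P. So for f in #P and g in FP the number
-- 2·2^Q + (2^Q − (f + 1)) + (g + 1) is in #P, and its second binary digit tells whether f > g.
-- (3) ⇒ (2): the conditions g(x) ≥ v and g(x) ≤ v on (v, x) are in PP, the latter again by
-- complementing, hence in UP; a machine guesses v, verifies both on unique paths and outputs v.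
--
-- The machines are composed from programs with a single exit. Polynomial clocks are words
-- 1^p(|x|) 0 x, produced by Horner's scheme from a machine that multiplies the clock by |x|.

module Submission where

open import Defs 
open import Data.Bool.Base using (Bool; true; false; T)
open import Data.Empty using (⊥; ⊥-elim)
open import Data.Fin.Base using (Fin; zero; suc)
open import Data.Fin.Patterns using (0F; 1F; 2F; 3F; 4F; 5F)
open import Data.Integer.Base as ℤ using (ℤ)
open import Data.List.Base using (List; []; _∷_; _++_; [_]; length; map; reverse; replicate; concatMap; _ʳ++_)
open import Data.Maybe.Base using (Maybe; just; nothing)
open import Data.Nat.Base using (ℕ; zero; suc; _+_; _*_; _∸_; _^_; _⊔_; _≤_; _<_; z≤n; s≤s; s≤s⁻¹)
open import Data.Product.Base using (_×_; _,_; ∃-syntax; Σ-syntax; proj₁; proj₂)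
open import Data.Sum.Base using (_⊎_; inj₁; inj₂)
open import Data.Unit.Base using (⊤; tt)
open import Data.Vec.Base as Vec using (Vec; []; _∷_)
open import Function.Base using (id; _∘_; const)
open import Function.Bundles using (_↔_; _⇔_; mk↔ₛ′; mk⇔; Inverse; Equivalence)
open import Relation.Binary.PropositionalEquality using (_≡_; refl; sym; trans; cong; cong₂; subst; subst₂; module ≡-Reasoning)
open import Relation.Nullary using (¬_; yes; no)
import Data.Fin.Permutation as Perm
import Data.Fin.Properties as Finₚ
import Data.List.Properties as Listₚ
import Data.Nat.Properties as ℕₚ
import Data.Vec.Properties as Vecₚ
open import Data.Product.Function.NonDependent.Propositional using (_×-↔_)
open import Data.Sum.Function.Propositional using (_⊎-↔_)
open import Function.Properties.Inverse using (↔-refl; ↔-sym; ↔-trans)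
open import Data.Nat.Tactic.RingSolver using (solve-∀)
open import Data.List.Relation.Unary.Any using (Any; here; there)
open import Data.List.Relation.Unary.Any.Properties using (∷↔; ⊥↔Any[])
open import Data.List.Membership.Propositional using (_∈_)
open import Data.List.Membership.Propositional.Properties.Core using (Any↔)
open import Data.List.Membership.Propositional.Properties using (∈-++⁺ˡ; ∈-++⁺ʳ; ∈-++⁻; ∈-map⁺)
open import Relation.Binary.Construct.Closure.ReflexiveTransitive using (ε; _◅_)
open import Relation.Unary using (_⊆_; _≐_)

-- Finite types

-- Sums of counts come for free from nondeterministic choice, but differences and comparisons do
-- not. Hence every comparison is rewritten as a sum of counts in which a complement relative to a
-- power of two supplies the negative term. In the sum read by the FP function, the multiple of that
-- power in front fixes the position of the leading digit, so that a carry out of the lower digits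
-- shows in one fixed place. All machine bookkeeping rests on one invariant: a run is indexed by the
-- list of the results of its accepting paths. Sequencing is then `concatMap` and choice is `++`; a
-- function in #P is the length of the list, a function in UPSVₜ is its only entry, and FP is the
-- same with a flag for determinism. Path counts, outputs and time bounds of a compiled machine are
-- all read off the same run. The inclusions UP ⊆ PP and UPSVₜ ⊆ #P hold outright, so only the
-- converse inclusions in (2) and (3) draw on a hypothesis.

finite-Fin : ∀ n → Finite (Fin n)
finite-Fin n = n , ↔-refl

finite-⊥ : Finite ⊥
finite-⊥ = 0 , ↔-sym Finₚ.0↔⊥

finite-Bool : Finite Bool
finite-Bool = 2 , ↔-sym Finₚ.2↔Bool

finite-⊎ : ∀ {A B} → Finite A → Finite B → Finite (A ⊎ B)
finite-⊎ (m , f) (n , g) = m + n , ↔-trans (f ⊎-↔ g) (↔-sym Finₚ.+↔⊎)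

finite-× : ∀ {A B} → Finite A → Finite B → Finite (A × B)
finite-× (m , f) (n , g) = m * n , ↔-trans (f ×-↔ g) (↔-sym Finₚ.*↔×)

⊎⊤↔Maybe : ∀ {A : Set} → Maybe A ↔ (⊤ ⊎ A)
⊎⊤↔Maybe = mk↔ₛ′
  (λ { nothing → inj₁ tt ; (just a) → inj₂ a }) (λ { (inj₁ tt) → nothing ; (inj₂ a) → just a })
  (λ { (inj₁ tt) → refl ; (inj₂ a) → refl }) (λ { nothing → refl ; (just a) → refl })

finite-Maybe : ∀ {A} → Finite A → Finite (Maybe A)
finite-Maybe (n , f) =
  suc n , ↔-trans ⊎⊤↔Maybe (↔-trans (↔-sym Finₚ.1↔⊤ ⊎-↔ f) (↔-sym (Finₚ.+↔⊎ {1} {n})))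

-- The consequence of finiteness that yields a uniform bound on the number of choices of a program.
-- It passes along surjections and products, so no bijection with some `Fin n` has to be built for
-- vectors of symbols.
Bounding : Set → Set
Bounding A = ∀ (f : A → ℕ) → ∃[ b ] (∀ a → f a ≤ b)

bounding-Fin : ∀ n → Bounding (Fin n)
bounding-Fin zero    f = 0 , λ ()
bounding-Fin (suc n) f with bounding-Fin n (f ∘ suc)
... | b , h = f zero ⊔ b , λ
  { zero    → ℕₚ.m≤m⊔n (f zero) b
  ; (suc i) → ℕₚ.≤-trans (h i) (ℕₚ.m≤n⊔m (f zero) b) }

bounding-surjection : ∀ {A B : Set} (g : A → B) (h : B → A) → (∀ b → g (h b) ≡ b) → Bounding A → Bounding B
bounding-surjection g h gh bA f with bA (f ∘ g)
... | n , p = n , λ b → subst (λ z → f z ≤ n) (gh b) (p (h b))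

bounding-finite : ∀ {A} → Finite A → Bounding A
bounding-finite (n , e) =
  bounding-surjection (Inverse.from e) (Inverse.to e) (λ a → Inverse.strictlyInverseʳ e a) (bounding-Fin n)

bounding-× : ∀ {A B} → Bounding A → Bounding B → Bounding (A × B)
bounding-× bA bB f with bA (λ a → proj₁ (bB (λ b → f (a , b))))
... | n , p = n , λ (a , b) → ℕₚ.≤-trans (proj₂ (bB (λ b → f (a , b))) b) (p a)

bounding-Vec : ∀ {A} → Bounding A → ∀ n → Bounding (Vec A n)
bounding-Vec bA zero    f = f [] , λ { [] → ℕₚ.≤-refl }
bounding-Vec bA (suc n) =
  bounding-surjection (λ (a , v) → a ∷ v) (λ { (a ∷ v) → a , v }) (λ { (a ∷ v) → refl })
    (bounding-× bA (bounding-Vec bA n))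

replicate-+ : ∀ {A : Set} m n (x : A) → replicate (m + n) x ≡ replicate m x ++ replicate n x
replicate-+ zero    n x = refl
replicate-+ (suc m) n x = cong (x ∷_) (replicate-+ m n x)

-- Polynomial bounds

infixl 6 _⊕_
infixl 7 _⊙_

_⊕_ : Polynomial → Polynomial → Polynomial
[]      ⊕ q       = q
(a ∷ p) ⊕ []      = a ∷ p
(a ∷ p) ⊕ (b ∷ q) = a + b ∷ p ⊕ q

eval-⊕ : ∀ p q n → eval (p ⊕ q) n ≡ eval p n + eval q n
eval-⊕ []      q       n = refl
eval-⊕ (a ∷ p) []      n = sym (ℕₚ.+-identityʳ _)
eval-⊕ (a ∷ p) (b ∷ q) n rewrite eval-⊕ p q n = lem a b n (eval p n) (eval q n)
  where
  lem : ∀ a b n x y → a + b + n * (x + y) ≡ (a + n * x) + (b + n * y)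
  lem = solve-∀

scale : ℕ → Polynomial → Polynomial
scale c = map (c *_)

eval-scale : ∀ c p n → eval (scale c p) n ≡ c * eval p n
eval-scale c []      n = sym (ℕₚ.*-zeroʳ c)
eval-scale c (a ∷ p) n rewrite eval-scale c p n = lem c a n (eval p n)
  where
  lem : ∀ c a n x → c * a + n * (c * x) ≡ c * (a + n * x)
  lem = solve-∀

_⊙_ : Polynomial → Polynomial → Polynomial
[]      ⊙ q = []
(a ∷ p) ⊙ q = scale a q ⊕ (0 ∷ p ⊙ q)

eval-⊙ : ∀ p q n → eval (p ⊙ q) n ≡ eval p n * eval q n
eval-⊙ []      q n = refl
eval-⊙ (a ∷ p) q n
  rewrite eval-⊕ (scale a q) (0 ∷ p ⊙ q) n | eval-scale a q n | eval-⊙ p q n = lem a n (eval p n) (eval q n)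
  where
  lem : ∀ a n x y → a * y + n * (x * y) ≡ (a + n * x) * y
  lem = solve-∀

substitute : Polynomial → Polynomial → Polynomial
substitute []      q = []
substitute (a ∷ p) q = (a ∷ []) ⊕ (q ⊙ substitute p q)

eval-substitute : ∀ p q n → eval (substitute p q) n ≡ eval p (eval q n)
eval-substitute []      q n = refl
eval-substitute (a ∷ p) q n
  rewrite eval-⊕ (a ∷ []) (q ⊙ substitute p q) n | eval-⊙ q (substitute p q) n | eval-substitute p q n
        | ℕₚ.*-zeroʳ n | ℕₚ.+-identityʳ a = refl

eval-mono : ∀ p {m n} → m ≤ n → eval p m ≤ eval p n
eval-mono []      m≤n = z≤n
eval-mono (a ∷ p) m≤n = ℕₚ.+-monoʳ-≤ a (ℕₚ.*-mono-≤ m≤n (eval-mono p m≤n))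

constant : ℕ → Polynomial
constant a = a ∷ []

eval-constant : ∀ a n → eval (constant a) n ≡ a
eval-constant a n rewrite ℕₚ.*-zeroʳ n = ℕₚ.+-identityʳ a

identity : Polynomial
identity = 0 ∷ 1 ∷ []

eval-identity : ∀ n → eval identity n ≡ n
eval-identity n rewrite ℕₚ.*-zeroʳ n = ℕₚ.*-identityʳ n

-- Binary numerals

bitValue : Bool → ℕ
bitValue false = 0
bitValue true  = 1

-- Horner evaluation, most significant bit first.
valueFrom : ℕ → Word → ℕ
valueFrom v []      = v
valueFrom v (b ∷ w) = valueFrom (v + v + bitValue b) w

value : Word → ℕ
value = valueFrom 0

valueFrom-shift : ∀ v w → valueFrom v w ≡ v * 2 ^ length w + value w
valueFrom-shift v []      = sym (trans (ℕₚ.+-identityʳ _) (ℕₚ.*-identityʳ v))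
valueFrom-shift v (b ∷ w)
  rewrite valueFrom-shift (v + v + bitValue b) w | valueFrom-shift (bitValue b) w =
  lem v (bitValue b) (2 ^ length w) (value w)
  where
  lem : ∀ v b e x → (v + v + b) * e + x ≡ v * (e + (e + 0)) + (b * e + x)
  lem = solve-∀

value-∷ : ∀ b w → value (b ∷ w) ≡ bitValue b * 2 ^ length w + value w
value-∷ b w = valueFrom-shift (bitValue b) w

value<2^length : ∀ w → value w < 2 ^ length w
value<2^length []      = s≤s z≤n
value<2^length (b ∷ w) rewrite value-∷ b w | ℕₚ.+-identityʳ (2 ^ length w) =
  ℕₚ.≤-trans (ℕₚ.≤-reflexive (sym (ℕₚ.+-suc (bitValue b * 2 ^ length w) (value w))))
    (ℕₚ.+-mono-≤ (bound b) (value<2^length w))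
  where
  bound : ∀ b → bitValue b * 2 ^ length w ≤ 2 ^ length w
  bound false = z≤n
  bound true  = ℕₚ.≤-reflexive (ℕₚ.*-identityˡ _)

-- Restricted to positive numbers because zero is written `0`, which doubling would turn into `00`.
bitsLSB-double : ∀ n → bitsLSB (suc n + suc n) ≡ false ∷ bitsLSB (suc n)
bitsLSB-double zero    = refl
bitsLSB-double (suc n)
  rewrite ℕₚ.+-suc n (suc n) | bitsLSB-double n = refl

binary-snoc : ∀ n b → binary (suc n + suc n + bitValue b) ≡ binary (suc n) ++ b ∷ []
binary-snoc n false
  rewrite ℕₚ.+-identityʳ (n + suc n) | bitsLSB-double n = Listₚ.unfold-reverse false (bitsLSB (suc n))
binary-snoc n true
  rewrite ℕₚ.+-comm (n + suc n) 1 | bitsLSB-double n = Listₚ.unfold-reverse true (bitsLSB (suc n))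

-- A positive start already has its leading one, so later digits are appended unchanged, zeros
-- included.
binary-valueFrom : ∀ n w → binary (valueFrom (suc n) w) ≡ binary (suc n) ++ w
binary-valueFrom n []      = sym (Listₚ.++-identityʳ _)
binary-valueFrom n (b ∷ w) = begin
  binary (valueFrom (suc (n + suc n + bitValue b)) w) ≡⟨ binary-valueFrom _ w ⟩
  binary (suc n + suc n + bitValue b) ++ w            ≡⟨ cong (_++ w) (binary-snoc n b) ⟩
  (binary (suc n) ++ b ∷ []) ++ w                     ≡⟨ Listₚ.++-assoc (binary (suc n)) (b ∷ []) w ⟩
  binary (suc n) ++ b ∷ w                             ∎
  where open ≡-Reasoning

strip : Word → Word
strip []          = false ∷ []
strip (false ∷ w) = strip w
strip (true ∷ w)  = true ∷ w

binary-value : ∀ w → binary (value w) ≡ strip w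
binary-value []          = refl
binary-value (false ∷ w) = binary-value w
binary-value (true ∷ w)  = binary-valueFrom 0 w

value-double : ∀ w b → value (w ++ b ∷ []) ≡ value w + value w + bitValue b
value-double = go 0
  where
  go : ∀ v w b → valueFrom v (w ++ b ∷ []) ≡ valueFrom v w + valueFrom v w + bitValue b
  go v []      b = refl
  go v (c ∷ w) b = go (v + v + bitValue c) w b

value-binary : ∀ n → value (binary n) ≡ n
value-binary m = trans (value-reverse (bitsLSB m)) (valueLSB-bitsLSB m)
  where
  valueLSB : Word → ℕ
  valueLSB []      = 0
  valueLSB (b ∷ w) = valueLSB w + valueLSB w + bitValue b

  valueLSB-increment : ∀ w → valueLSB (incrementLSB w) ≡ suc (valueLSB w)
  valueLSB-increment []          = refl
  valueLSB-increment (false ∷ w) = ℕₚ.+-suc _ 0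
  valueLSB-increment (true ∷ w) rewrite valueLSB-increment w = lem (valueLSB w)
    where
    lem : ∀ x → suc x + suc x + 0 ≡ suc (x + x + 1)
    lem = solve-∀

  valueLSB-bitsLSB : ∀ n → valueLSB (bitsLSB n) ≡ n
  valueLSB-bitsLSB zero    = refl
  valueLSB-bitsLSB (suc n) = trans (valueLSB-increment (bitsLSB n)) (cong suc (valueLSB-bitsLSB n))

  value-reverse : ∀ w → value (reverse w) ≡ valueLSB w
  value-reverse []      = refl
  value-reverse (b ∷ w) rewrite Listₚ.unfold-reverse b w | value-double (reverse w) b | value-reverse w = refl

-- Tape layouts

infixr 5 _⊗_

-- Layouts are trees, so that machines can be put side by side and their tapes addressed without
-- arithmetic on vector indices. `V n` accommodates an imported machine, whose number of tapes is a
-- variable.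
data Shape : Set where
  ●   : Shape
  V   : ℕ → Shape
  _⊗_ : Shape → Shape → Shape

⟦_⟧ : Shape → Set → Set
⟦ ● ⟧     X = X
⟦ V n ⟧   X = Vec X n
⟦ σ ⊗ τ ⟧ X = ⟦ σ ⟧ X × ⟦ τ ⟧ X

mapS : ∀ σ {X Y : Set} → (X → Y) → ⟦ σ ⟧ X → ⟦ σ ⟧ Y
mapS ●       f x       = f x
mapS (V n)   f v       = Vec.map f v
mapS (σ ⊗ τ) f (x , y) = mapS σ f x , mapS τ f y

zipS : ∀ σ {X Y Z : Set} → (X → Y → Z) → ⟦ σ ⟧ X → ⟦ σ ⟧ Y → ⟦ σ ⟧ Z
zipS ●       f x       y       = f x y
zipS (V n)   f v       w       = Vec.zipWith f v w
zipS (σ ⊗ τ) f (x , y) (z , w) = zipS σ f x z , zipS τ f y w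

pureS : ∀ σ {X : Set} → X → ⟦ σ ⟧ X
pureS ●       x = x
pureS (V n)   x = Vec.replicate n x
pureS (σ ⊗ τ) x = pureS σ x , pureS τ x

mapS-∘ : ∀ σ {X Y Z : Set} (g : Y → Z) (f : X → Y) m → mapS σ g (mapS σ f m) ≡ mapS σ (g ∘ f) m
mapS-∘ ●       g f x       = refl
mapS-∘ (V n)   g f v       = sym (Vecₚ.map-∘ g f v)
mapS-∘ (σ ⊗ τ) g f (x , y) = cong₂ _,_ (mapS-∘ σ g f x) (mapS-∘ τ g f y)

mapS-id : ∀ σ {X : Set} (f : X → X) → (∀ x → f x ≡ x) → ∀ m → mapS σ f m ≡ m
mapS-id ●       f h x       = h x
mapS-id (V n)   f h v       = trans (Vecₚ.map-cong h v) (Vecₚ.map-id v)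
mapS-id (σ ⊗ τ) f h (x , y) = cong₂ _,_ (mapS-id σ f h x) (mapS-id τ f h y)

mapS-pureS : ∀ σ {X Y : Set} (f : X → Y) x → mapS σ f (pureS σ x) ≡ pureS σ (f x)
mapS-pureS ●       f x = refl
mapS-pureS (V n)   f x = Vecₚ.map-replicate f x n
mapS-pureS (σ ⊗ τ) f x = cong₂ _,_ (mapS-pureS σ f x) (mapS-pureS τ f x)

Heads Action : Set → Shape → Set
Heads A σ  = ⟦ σ ⟧ (Symbol A)
Action A σ = ⟦ σ ⟧ (Symbol A × Move)

Memory : Set → Shape → Set
Memory A σ = ⟦ σ ⟧ (Tape A)

scan : ∀ {A} σ → Memory A σ → Heads A σ
scan σ = mapS σ Tape.scanned

act : ∀ {A} σ → Action A σ → Memory A σ → Memory A σ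
act σ = zipS σ writeMove

keep : ∀ {A} σ → Heads A σ → Action A σ
keep σ = mapS σ (_, stay)

act-keep : ∀ {A} σ (m : Memory A σ) → act σ (keep σ (scan σ m)) m ≡ m
act-keep ●       t       = refl
act-keep (V _)   []      = refl
act-keep (V _)   (t ∷ v) = cong (t ∷_) (act-keep (V _) v)
act-keep (σ ⊗ τ) (x , y) = cong₂ _,_ (act-keep σ x) (act-keep τ y)

-- `get` and `put` are polymorphic in the contents because the same rearrangement acts on tapes, on
-- scanned symbols and on actions. The two laws are what a simulation step needs: the part sees its
-- own symbols, and its action, completed by `keep` elsewhere, changes the part alone.
record Lens (σ τ : Shape) : Set₁ where
  field
    get : ∀ {X} → ⟦ τ ⟧ X → ⟦ σ ⟧ X
    put : ∀ {X} → ⟦ σ ⟧ X → ⟦ τ ⟧ X → ⟦ τ ⟧ X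
    get-scan-put : ∀ {A} (m : Memory A σ) n → get (scan τ (put m n)) ≡ scan σ m
    act-put : ∀ {A} (a : Action A σ) m n →
              act τ (put a (keep τ (scan τ (put m n)))) (put m n) ≡ put (act σ a m) n

idL : ∀ {σ} → Lens σ σ
idL = record { get = id ; put = const ; get-scan-put = λ _ _ → refl ; act-put = λ _ _ _ → refl }

fstL : ∀ {σ τ} → Lens σ (σ ⊗ τ)
fstL {σ} {τ} = record
  { get = proj₁ ; put = λ x (_ , y) → x , y
  ; get-scan-put = λ _ _ → refl ; act-put = λ a m (_ , y) → cong (act σ a m ,_) (act-keep τ y) }

sndL : ∀ {σ τ} → Lens τ (σ ⊗ τ)
sndL {σ} {τ} = record
  { get = proj₂ ; put = λ y (x , _) → x , y
  ; get-scan-put = λ _ _ → refl ; act-put = λ a m (x , _) → cong (_, act τ a m) (act-keep σ x) }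

infixr 5 _×L_

_×L_ : ∀ {σ σ′ τ τ′} → Lens σ σ′ → Lens τ τ′ → Lens (σ ⊗ τ) (σ′ ⊗ τ′)
k ×L l = record
  { get = λ (x , y) → K.get x , L.get y ; put = λ (x , y) (x′ , y′) → K.put x x′ , L.put y y′
  ; get-scan-put = λ (m , m′) (n , n′) → cong₂ _,_ (K.get-scan-put m n) (L.get-scan-put m′ n′)
  ; act-put = λ (a , a′) (m , m′) (n , n′) → cong₂ _,_ (K.act-put a m n) (L.act-put a′ m′ n′) }
  where
  module K = Lens k
  module L = Lens l

swapL : ∀ {σ τ} → Lens (σ ⊗ τ) (τ ⊗ σ)
swapL = record
  { get = λ (x , y) → y , x ; put = λ (x , y) _ → y , x
  ; get-scan-put = λ _ _ → refl ; act-put = λ _ _ _ → refl }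

assocL : ∀ {ρ σ τ} → Lens ((ρ ⊗ σ) ⊗ τ) (ρ ⊗ σ ⊗ τ)
assocL = record
  { get = λ (x , y , z) → (x , y) , z ; put = λ ((x , y) , z) _ → x , y , z
  ; get-scan-put = λ _ _ → refl ; act-put = λ _ _ _ → refl }

-- Programs

-- A nondeterministic program on tapes of layout σ.  A transition into `nothing`
-- leaves the program successfully; a state without transitions rejects.
record Program (A : Set) (σ : Shape) : Set₁ where
  field
    State        : Set
    state-finite : Finite State
    start        : State
    δ            : State → Heads A σ → List (Maybe State × Action A σ)

open Program public

-- `Run P K q m rs t`: when P runs from state q on m and every exit continues as
-- described by K (memory, results, time), the results of all branches are rs,
-- in order, and every branch takes time at most t.
module _ {A σ} (P : Program A σ) {R : Set} (K : Memory A σ → List R → ℕ → Set) where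

  data Run   : State P → Memory A σ → List R → ℕ → Set
  data Next  : Maybe (State P) → Memory A σ → List R → ℕ → Set
  data Nexts : List (Maybe (State P) × Action A σ) → Memory A σ → List R → ℕ → Set

  data Run where
    step : ∀ {q m rs t} → Nexts (δ P q (scan σ m)) m rs t → Run q m rs (suc t)

  data Next where
    exit : ∀ {m rs t} → K m rs t → Next nothing m rs t
    goto : ∀ {q m rs t} → Run q m rs t → Next (just q) m rs t

  data Nexts where
    []  : ∀ {m t} → Nexts [] m [] t
    _∷_ : ∀ {x a as m rs rs′ t} →
          Next x (act σ a m) rs t → Nexts as m rs′ t → Nexts ((x , a) ∷ as) m (rs ++ rs′) t

Deterministic-program : ∀ {A σ} → Program A σ → Set
Deterministic-program P = ∀ q ss → length (δ P q ss) ≤ 1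

one : ∀ {A σ} {P : Program A σ} {R : Set} {K : Memory A σ → List R → ℕ → Set} {q m x a m′ rs t} →
      δ P q (scan σ m) ≡ (x , a) ∷ [] → act σ a m ≡ m′ → Next P K x m′ rs t → Run P K q m rs (suc t)
one {P = P} {K = K} {q} {m} {rs = rs} {t} e refl r =
  step (subst₂ (λ as z → Nexts P K as m z t) (sym e) (Listₚ.++-identityʳ rs) (r ∷ []))

-- The common induction behind lifting, sequencing, choice, recoding and equality up to blanks.
-- Steps correspond one to one, choice by choice; `x` is where an exit of `P` leads in `Q`, `h`
-- expands each result into the results of whatever follows the exit, and `d` is the time allowed
-- for that.
module Simulation {A B σ τ} {P : Program A σ} {Q : Program B τ}
  (φ : State P → State Q) (x : Maybe (State Q)) (_~_ : Memory A σ → Memory B τ → Set) where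

  target : Maybe (State P) → Maybe (State Q)
  target nothing  = x
  target (just q) = just (φ q)

  Steps : Set
  Steps = ∀ q {m n} → m ~ n → Σ[ ψ ∈ (Action A σ → Action B τ) ]
    (δ Q (φ q) (scan τ n) ≡ map (λ (r , a) → target r , ψ a) (δ P q (scan σ m))) ×
    (∀ a → act σ a m ~ act τ (ψ a) n)

  module _ {R S : Set} {K : Memory A σ → List R → ℕ → Set} {L : Memory B τ → List S → ℕ → Set}
    (h : R → List S) (d : ℕ) (steps : Steps)
    (leaf : ∀ {m n rs t} → m ~ n → K m rs t → Next Q L x n (concatMap h rs) (t + d)) where

    simulate  : ∀ {q m n rs t} → m ~ n → Run P K q m rs t → Run Q L (φ q) n (concatMap h rs) (t + d)
    simulate′ : ∀ {r m n rs t} → m ~ n → Next P K r m rs t → Next Q L (target r) n (concatMap h rs) (t + d)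
    simulates : ∀ {as m n rs t} (ψ : Action A σ → Action B τ) → (∀ a → act σ a m ~ act τ (ψ a) n) →
                Nexts P K as m rs t →
                Nexts Q L (map (λ (r , a) → target r , ψ a) as) n (concatMap h rs) (t + d)

    simulate {q} {m} {n} m~n (step r) with steps q m~n
    ... | ψ , e , rel = step (subst (λ as → Nexts Q L as n _ _) (sym e) (simulates ψ rel r))

    simulate′ m~n (exit k) = leaf m~n k
    simulate′ m~n (goto r) = goto (simulate m~n r)

    simulates ψ rel []                                = []
    simulates ψ rel (_∷_ {a = a} {rs = rs} {rs′ = rs′} r r′) =
      subst (λ z → Nexts Q L _ _ z _) (sym (Listₚ.concatMap-++ h rs rs′))
        (simulate′ (rel a) r ∷ simulates ψ rel r′)

open Simulation using (simulate)

module _ {A σ} {P : Program A σ} {R : Set} {K : Memory A σ → List R → ℕ → Set} where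

  -- The program stays the same and only the description of its exits changes: this is bind in the
  -- list monad, and composed machines get their list of results from it.
  Run-bind : ∀ {S : Set} {L : Memory A σ → List S → ℕ → Set} (h : R → List S) d →
             (∀ {m rs t} → K m rs t → L m (concatMap h rs) (t + d)) →
             ∀ {q m rs t} → Run P K q m rs t → Run P L q m (concatMap h rs) (t + d)
  Run-bind h d leaf = simulate (λ q → q) nothing _≡_ h d
    (λ { q refl → id , sym (trans (Listₚ.map-cong (λ { (nothing , a) → refl ; (just q , a) → refl }) _) (Listₚ.map-id _)) , λ a → refl })
    (λ { refl k → exit (leaf k) }) refl

  Run-map : ∀ {L : Memory A σ → List R → ℕ → Set} d →
            (∀ {m rs t} → K m rs t → L m rs (t + d)) →
            ∀ {q m rs t} → Run P K q m rs t → Run P L q m rs (t + d)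
  Run-map {L} d leaf {rs = rs} r =
    subst (λ z → Run P L _ _ z _) (Listₚ.concatMap-pure rs)
      (Run-bind [_] d (λ {m} {rs} k → subst (λ z → L m z _) (sym (Listₚ.concatMap-pure rs)) (leaf k)) r)

lift : ∀ {A σ τ} → Lens σ τ → Program A σ → Program A τ
lift {A} {σ} {τ} l P = record
  { State = State P ; state-finite = state-finite P ; start = start P
  ; δ = λ q ss → map (λ (x , a) → x , put a (keep τ ss)) (δ P q (get ss)) }
  where open Lens l

lift-deterministic : ∀ {A σ τ} (l : Lens σ τ) (P : Program A σ) →
                     Deterministic-program P → Deterministic-program (lift l P)
lift-deterministic l P det q ss =
  ℕₚ.≤-trans (ℕₚ.≤-reflexive (Listₚ.length-map _ (δ P q (Lens.get l ss)))) (det q _)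

Run-weaken : ∀ {A σ} {P : Program A σ} {R : Set} {K : Memory A σ → List R → ℕ → Set} →
             (∀ {m rs t} d → K m rs t → K m rs (t + d)) →
             ∀ {q m rs t t′} → t ≤ t′ → Run P K q m rs t → Run P K q m rs t′
Run-weaken up {t = t} {t′} t≤t′ r =
  subst (Run _ _ _ _ _) (ℕₚ.m+[n∸m]≡n t≤t′) (Run-map (t′ ∸ t) (up (t′ ∸ t)) r)

-- A simulation that leaves the results alone has `h = [_]` and `d = 0`; these two conversions
-- remove and insert the `concatMap [_]` and `+ 0` that this produces.
pure-results : ∀ {R : Set} (Z : List R → ℕ → Set) {rs t} → Z (concatMap [_] rs) (t + 0) → Z rs t
pure-results Z {rs} {t} = subst₂ Z (Listₚ.concatMap-pure rs) (ℕₚ.+-identityʳ t)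

pure-results⁻ : ∀ {R : Set} (Z : List R → ℕ → Set) {rs t} → Z rs t → Z (concatMap [_] rs) (t + 0)
pure-results⁻ Z {rs} {t} = subst₂ Z (sym (Listₚ.concatMap-pure rs)) (sym (ℕₚ.+-identityʳ t))

Run-lift : ∀ {A σ τ} (l : Lens σ τ) {P : Program A σ} {R : Set} {K : Memory A τ → List R → ℕ → Set} →
           let open Lens l in
           ∀ {q m n rs t} → Run P (λ m → K (put m n)) q m rs t → Run (lift l P) K q (put m n) rs t
Run-lift {τ = τ} l {P} {K = K} {n = n} r = pure-results (Run (lift l P) K _ _)
  (simulate {P = P} {Q = lift l P} id nothing (λ m m′ → m′ ≡ put m n) [_] 0
    (λ { q {m} refl → (λ a → put a (keep τ (scan τ (put m n)))) ,
         trans (cong (map _ ∘ δ P q) (get-scan-put m n)) (Listₚ.map-cong (λ { (nothing , a) → refl ; (just _ , a) → refl }) _) ,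
         λ a → act-put a m n })
    (λ { refl k → exit (pure-results⁻ (K _) k) }) refl r)
  where open Lens l

infixr 4 _⨾_

_⨾_ : ∀ {A σ} → Program A σ → Program A σ → Program A σ
P ⨾ Q = record
  { State = State P ⊎ State Q ; state-finite = finite-⊎ (state-finite P) (state-finite Q)
  ; start = inj₁ (start P)
  ; δ = λ { (inj₁ p) ss → map (λ { (nothing , a) → just (inj₂ (start Q)) , a ; (just p′ , a) → just (inj₁ p′) , a }) (δ P p ss)
          ; (inj₂ q) ss → map (λ { (nothing , a) → nothing , a ; (just q′ , a) → just (inj₂ q′) , a }) (δ Q q ss) } }

⨾-deterministic : ∀ {A σ} (P Q : Program A σ) →
                  Deterministic-program P → Deterministic-program Q → Deterministic-program (P ⨾ Q)
⨾-deterministic P Q p q (inj₁ s) ss = ℕₚ.≤-trans (ℕₚ.≤-reflexive (Listₚ.length-map _ (δ P s ss))) (p s ss)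
⨾-deterministic P Q p q (inj₂ s) ss = ℕₚ.≤-trans (ℕₚ.≤-reflexive (Listₚ.length-map _ (δ Q s ss))) (q s ss)

-- The exits of `P` are described by runs of `Q` from the memory found there, which is why `Run`
-- takes an arbitrary continuation. The time index at an exit is the time still left, so no sum of
-- running times appears.
Run-⨾ : ∀ {A σ} {P Q : Program A σ} {R : Set} {K : Memory A σ → List R → ℕ → Set} {m rs t} →
        Run P (Run Q K (start Q)) (start P) m rs t → Run (P ⨾ Q) K (start (P ⨾ Q)) m rs t
Run-⨾ {P = P} {Q} {K = K} r = pure-results (Run (P ⨾ Q) K _ _)
  (simulate {P = P} {Q = P ⨾ Q} inj₁ (just (inj₂ (start Q))) _≡_ [_] 0
    (λ { q refl → id , Listₚ.map-cong (λ { (nothing , a) → refl ; (just _ , a) → refl }) _ , λ a → refl })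
    (λ { refl r′ → goto
      (simulate {P = Q} {Q = P ⨾ Q} inj₂ nothing _≡_ [_] 0
        (λ { q refl → id , Listₚ.map-cong (λ { (nothing , a) → refl ; (just _ , a) → refl }) _ , λ a → refl })
        (λ { refl k → exit (pure-results⁻ (K _) k) }) refl r′) })
    refl r)

-- Tapes up to trailing blanks

-- A head that has visited the end of the written cells, or erased some, leaves explicit blanks
-- behind. As lists such tapes differ from the fresh ones on which the behaviour of a machine is
-- specified.
data _≋_ {A : Set} : List (Symbol A) → List (Symbol A) → Set where
  []     : [] ≋ []
  _∷_    : ∀ s {xs ys} → xs ≋ ys → (s ∷ xs) ≋ (s ∷ ys)
  blankˡ : ∀ {xs} → xs ≋ [] → (blank ∷ xs) ≋ []
  blankʳ : ∀ {ys} → [] ≋ ys → [] ≋ (blank ∷ ys)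

≋-refl : ∀ {A} (xs : List (Symbol A)) → xs ≋ xs
≋-refl []       = []
≋-refl (x ∷ xs) = x ∷ ≋-refl xs

leadingBits-≋ : ∀ {A} {xs ys : List (Symbol A)} → xs ≋ ys → leadingBits xs ≡ leadingBits ys
leadingBits-≋ []                = refl
leadingBits-≋ (blank ∷ e)       = refl
leadingBits-≋ (bit b ∷ e)       = cong (b ∷_) (leadingBits-≋ e)
leadingBits-≋ (aux _ ∷ e)       = refl
leadingBits-≋ (blankˡ e)        = refl
leadingBits-≋ (blankʳ e)        = refl

record _≈_ {A : Set} (t u : Tape A) : Set where
  constructor tape≈
  field
    left≋    : Tape.leftCells t ≋ Tape.leftCells u
    scanned≡ : Tape.scanned t ≡ Tape.scanned u
    right≋   : Tape.rightCells t ≋ Tape.rightCells u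

≈-refl : ∀ {A} (t : Tape A) → t ≈ t
≈-refl (tape l s r) = tape≈ (≋-refl l) refl (≋-refl r)

writeMove-≈ : ∀ {A} (a : Symbol A × Move) {t u} → t ≈ u → writeMove a t ≈ writeMove a u
writeMove-≈ (s , stay)  (tape≈ l _ r)            = tape≈ l refl r
writeMove-≈ (s , left)  (tape≈ [] _ r)           = tape≈ [] refl (s ∷ r)
writeMove-≈ (s , left)  (tape≈ (_ ∷ l) _ r)      = tape≈ l refl (s ∷ r)
writeMove-≈ (s , left)  (tape≈ (blankˡ l) _ r)   = tape≈ l refl (s ∷ r)
writeMove-≈ (s , left)  (tape≈ (blankʳ l) _ r)   = tape≈ l refl (s ∷ r)
writeMove-≈ (s , right) (tape≈ l _ [])           = tape≈ (s ∷ l) refl []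
writeMove-≈ (s , right) (tape≈ l _ (_ ∷ r))      = tape≈ (s ∷ l) refl r
writeMove-≈ (s , right) (tape≈ l _ (blankˡ r))   = tape≈ (s ∷ l) refl r
writeMove-≈ (s , right) (tape≈ l _ (blankʳ r))   = tape≈ (s ∷ l) refl r

tapeWord-≈ : ∀ {A} {t u : Tape A} → t ≈ u → tapeWord t ≡ tapeWord u
tapeWord-≈ (tape≈ _ refl r) = leadingBits-≋ (_ ∷ r)

Vec≈ : ∀ {A n} → Vec (Tape A) n → Vec (Tape A) n → Set
Vec≈ []      []      = ⊤
Vec≈ (t ∷ v) (u ∷ w) = t ≈ u × Vec≈ v w

Memory≈ : ∀ {A} σ → Memory A σ → Memory A σ → Set
Memory≈ ●       t       u         = t ≈ u
Memory≈ (V n)   v       w         = Vec≈ v w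
Memory≈ (σ ⊗ τ) (x , y) (x′ , y′) = Memory≈ σ x x′ × Memory≈ τ y y′

Memory≈-refl : ∀ {A} σ (m : Memory A σ) → Memory≈ σ m m
Memory≈-refl ●       t       = ≈-refl t
Memory≈-refl (V n)   []      = tt
Memory≈-refl (V n)   (t ∷ v) = ≈-refl t , Memory≈-refl (V _) v
Memory≈-refl (σ ⊗ τ) (x , y) = Memory≈-refl σ x , Memory≈-refl τ y

scan-≈ : ∀ {A} σ {m n : Memory A σ} → Memory≈ σ m n → scan σ m ≡ scan σ n
scan-≈ ●       e                                 = _≈_.scanned≡ e
scan-≈ (V n)   {[]}    {[]}    e                 = refl
scan-≈ (V _)   {_ ∷ _} {_ ∷ _} (e , e′)          = cong₂ _∷_ (_≈_.scanned≡ e) (scan-≈ (V _) e′)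
scan-≈ (σ ⊗ τ) (e , e′)                          = cong₂ _,_ (scan-≈ σ e) (scan-≈ τ e′)

act-≈ : ∀ {A} σ (a : Action A σ) {m n} → Memory≈ σ m n → Memory≈ σ (act σ a m) (act σ a n)
act-≈ ●       a        e                        = writeMove-≈ a e
act-≈ (V n)   []       {[]}    {[]}    e        = tt
act-≈ (V n)   (a ∷ as) {_ ∷ _} {_ ∷ _} (e , e′) = writeMove-≈ a e , act-≈ (V _) as e′
act-≈ (σ ⊗ τ) (a , b)  (e , e′)                 = act-≈ σ a e , act-≈ τ b e′

Run-≈ : ∀ {A σ} {P : Program A σ} {R : Set} {K L : Memory A σ → List R → ℕ → Set} →
        (∀ {m n rs t} → Memory≈ σ m n → K m rs t → L n rs t) →
        ∀ {q m n rs t} → Memory≈ σ m n → Run P K q m rs t → Run P L q n rs t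
Run-≈ {σ = σ} {P} {L = L} leaf m≈n r = pure-results (Run P L _ _)
  (simulate {P = P} {Q = P} id nothing (Memory≈ σ) [_] 0
    (λ q {m} m≈n → id ,
       trans (cong (δ P q) (sym (scan-≈ σ m≈n)))
         (sym (trans (Listₚ.map-cong (λ { (nothing , a) → refl ; (just q , a) → refl }) _) (Listₚ.map-id _))) ,
       λ a → act-≈ σ a m≈n)
    (λ m≈n k → exit (pure-results⁻ (L _) (leaf m≈n k))) m≈n r)

-- Change of alphabet

mapSymbol : ∀ {A B : Set} → (A → B) → Symbol A → Symbol B
mapSymbol f blank   = blank
mapSymbol f (bit b) = bit b
mapSymbol f (aux a) = aux (f a)

mapTape : ∀ {A B : Set} → (A → B) → Tape A → Tape B
mapTape f (tape l s r) = tape (map (mapSymbol f) l) (mapSymbol f s) (map (mapSymbol f) r)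

-- Symbols foreign to the smaller alphabet are read as blanks. By `unmap-map` this default is never
-- met on tapes that come from the smaller alphabet.
unmapSymbol : ∀ {A B : Set} → (B → Maybe A) → Symbol B → Symbol A
unmapSymbol g blank   = blank
unmapSymbol g (bit b) = bit b
unmapSymbol g (aux b) with g b
... | just a  = aux a
... | nothing = blank

unmap-map : ∀ {A B : Set} (f : A → B) (g : B → Maybe A) → (∀ a → g (f a) ≡ just a) →
            ∀ s → unmapSymbol g (mapSymbol f s) ≡ s
unmap-map f g e blank   = refl
unmap-map f g e (bit b) = refl
unmap-map f g e (aux a) rewrite e a = refl

writeMove-map : ∀ {A B : Set} (f : A → B) s d t →
                mapTape f (writeMove (s , d) t) ≡ writeMove (mapSymbol f s , d) (mapTape f t)
writeMove-map f s left  (tape []      _ r)       = refl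
writeMove-map f s left  (tape (_ ∷ _) _ r)       = refl
writeMove-map f s stay  t                        = refl
writeMove-map f s right (tape l       _ [])      = refl
writeMove-map f s right (tape l       _ (_ ∷ _)) = refl

act-map : ∀ {A B : Set} σ (f : A → B) (a : Action A σ) m →
          mapS σ (mapTape f) (act σ a m) ≡ act σ (mapS σ (λ (s , d) → mapSymbol f s , d) a) (mapS σ (mapTape f) m)
act-map ●       f (s , d)        t       = writeMove-map f s d t
act-map (V n)   f []             []      = refl
act-map (V _)   f ((s , d) ∷ as) (t ∷ v) = cong₂ _∷_ (writeMove-map f s d t) (act-map (V _) f as v)
act-map (σ ⊗ τ) f (a , b)        (x , y) = cong₂ _,_ (act-map σ f a x) (act-map τ f b y)

leadingBits-map : ∀ {A B : Set} (f : A → B) ss → leadingBits (map (mapSymbol f) ss) ≡ leadingBits ss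
leadingBits-map f []           = refl
leadingBits-map f (blank ∷ ss) = refl
leadingBits-map f (bit b ∷ ss) = cong (b ∷_) (leadingBits-map f ss)
leadingBits-map f (aux _ ∷ ss) = refl

tapeWord-map : ∀ {A B : Set} (f : A → B) t → tapeWord (mapTape f t) ≡ tapeWord t
tapeWord-map f (tape l s r) = leadingBits-map f (s ∷ r)

inputTape-map : ∀ {A B : Set} (f : A → B) w → mapTape f (inputTape w) ≡ inputTape w
inputTape-map f []      = refl
inputTape-map f (b ∷ w) = cong (tape [] (bit b)) (sym (Listₚ.map-∘ w))

recode : ∀ {A B σ} → (A → B) → (B → Maybe A) → Program A σ → Program B σ
recode {σ = σ} f g P = record
  { State = State P ; state-finite = state-finite P ; start = start P
  ; δ = λ q ss → map (λ (x , a) → x , mapS σ (λ (s , d) → mapSymbol f s , d) a)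
                     (δ P q (mapS σ (unmapSymbol g) ss)) }

recode-deterministic : ∀ {A B σ} (f : A → B) (g : B → Maybe A) (P : Program A σ) →
                       Deterministic-program P → Deterministic-program (recode f g P)
recode-deterministic f g P det q ss = ℕₚ.≤-trans (ℕₚ.≤-reflexive (Listₚ.length-map _ (δ P q _))) (det q _)

Run-recode : ∀ {A B σ} (f : A → B) (g : B → Maybe A) → (∀ a → g (f a) ≡ just a) →
             {P : Program A σ} {R : Set} {K : Memory A σ → List R → ℕ → Set} {L : Memory B σ → List R → ℕ → Set} →
             (∀ {m rs t} → K m rs t → L (mapS σ (mapTape f) m) rs t) →
             ∀ {q m rs t} → Run P K q m rs t → Run (recode f g P) L q (mapS σ (mapTape f) m) rs t
Run-recode {σ = σ} f g e {P} {L = L} leaf r = pure-results (Run (recode f g P) L _ _)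
  (simulate {P = P} {Q = recode f g P} id nothing (λ m n → n ≡ mapS σ (mapTape f) m) [_] 0
    (λ { q {m} refl → mapS σ (λ (s , d) → mapSymbol f s , d) ,
         trans (Listₚ.map-cong (λ { (nothing , a) → refl ; (just _ , a) → refl }) _) (cong (map _ ∘ δ P q) (heads m)) ,
         λ a → sym (act-map σ f a m) })
    (λ { refl k → exit (pure-results⁻ (L _) (leaf k)) }) refl r)
  where
  heads : ∀ m → mapS σ (unmapSymbol g) (scan σ (mapS σ (mapTape f) m)) ≡ scan σ m
  heads m = begin
    mapS σ (unmapSymbol g) (scan σ (mapS σ (mapTape f) m))    ≡⟨ cong (mapS σ (unmapSymbol g)) (mapS-∘ σ Tape.scanned (mapTape f) m) ⟩
    mapS σ (unmapSymbol g) (mapS σ (mapSymbol f ∘ Tape.scanned) m) ≡⟨ cong (mapS σ (unmapSymbol g)) (sym (mapS-∘ σ (mapSymbol f) Tape.scanned m)) ⟩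
    mapS σ (unmapSymbol g) (mapS σ (mapSymbol f) (scan σ m))  ≡⟨ mapS-∘ σ (unmapSymbol g) (mapSymbol f) (scan σ m) ⟩
    mapS σ (unmapSymbol g ∘ mapSymbol f) (scan σ m)           ≡⟨ mapS-id σ _ (unmap-map f g e) (scan σ m) ⟩
    scan σ m                                                  ∎
    where open ≡-Reasoning

-- Output length

width : ∀ {A} → Tape A → ℕ
width = length ∘ Tape.rightCells

length-leadingBits : ∀ {A} (ss : List (Symbol A)) → length (leadingBits ss) ≤ length ss
length-leadingBits []           = z≤n
length-leadingBits (blank ∷ ss) = z≤n
length-leadingBits (bit b ∷ ss) = s≤s (length-leadingBits ss)
length-leadingBits (aux _ ∷ ss) = z≤n

length-tapeWord : ∀ {A} (t : Tape A) → length (tapeWord t) ≤ suc (width t)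
length-tapeWord (tape l s r) = length-leadingBits (s ∷ r)

width-writeMove : ∀ {A} (a : Symbol A × Move) t → width (writeMove a t) ≤ suc (width t)
width-writeMove (s , left)  (tape []      _ r)       = ℕₚ.≤-refl
width-writeMove (s , left)  (tape (_ ∷ _) _ r)       = ℕₚ.≤-refl
width-writeMove (s , stay)  t                        = ℕₚ.n≤1+n _
width-writeMove (s , right) (tape l       _ [])      = z≤n
width-writeMove (s , right) (tape l       _ (_ ∷ r)) = ℕₚ.m≤n⇒m≤1+n (ℕₚ.n≤1+n _)

-- Each step adds at most one cell to the right of the head and uses up one unit of time, so `width`
-- plus the remaining time never grows. As output is read from the head to the right, this bounds
-- its length.
Within : ∀ {A σ} {R : Set} → (Memory A (● ⊗ σ) → List R → ℕ → Set) → ℕ → Memory A (● ⊗ σ) → List R → ℕ → Set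
Within K W m rs t = K m rs t × width (proj₁ m) + t ≤ W

module _ {A σ} {P : Program A (● ⊗ σ)} {R : Set} {K : Memory A (● ⊗ σ) → List R → ℕ → Set} (W : ℕ) where

  Run-width  : ∀ {q m rs t} → width (proj₁ m) + t ≤ W → Run P K q m rs t → Run P (Within K W) q m rs t
  Next-width : ∀ {x m rs t} → width (proj₁ m) + t ≤ W → Next P K x m rs t → Next P (Within K W) x m rs t
  Nexts-width : ∀ {as m rs t} → width (proj₁ m) + suc t ≤ W → Nexts P K as m rs t → Nexts P (Within K W) as m rs t

  Run-width h (step r) = step (Nexts-width h r)

  Next-width h (exit k) = exit (k , h)
  Next-width h (goto r) = goto (Run-width h r)

  Nexts-width h []      = []
  Nexts-width h (_∷_ {a = a , _} {m = m , _} {t = t} r r′) =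
    Next-width (ℕₚ.≤-trans (ℕₚ.+-monoˡ-≤ t (width-writeMove a m))
                 (ℕₚ.≤-trans (ℕₚ.≤-reflexive (sym (ℕₚ.+-suc (width m) t))) h)) r
    ∷ Nexts-width h r′

-- Accepting paths of machines

module _ (M : TM) where

  open TM M

  -- `AcceptingPath` starts at initial configurations only, while counting by recursion on the
  -- computation tree needs every starting point.
  record AcceptingFrom (c : Config) : Set where
    constructor accepting-from
    field
      {end}   : Config
      path    : c ⟶* end
      halts   : Halting end
      accepts : T (accepting (Config.state end))

  acceptingPath↔ : ∀ x → AcceptingPath x ↔ AcceptingFrom (initial x)
  acceptingPath↔ x = mk↔ₛ′
    (λ π → let open AcceptingPath π in accepting-from path halts accepts)
    (λ π → let open AcceptingFrom π in record { path = path ; halts = halts ; accepts = accepts })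
    (λ _ → refl) (λ _ → refl)

  -- With the empty path excluded, a path consists of a position in the list of successors and a
  -- path from there. Equal successors at different positions remain different choices.
  acceptingFrom↔ : ∀ c → ¬ (Halting c × T (accepting (Config.state c))) →
                   AcceptingFrom c ↔ Any AcceptingFrom (successors c)
  acceptingFrom↔ c continues = ↔-trans (mk↔ₛ′ to from to∘from from∘to) Any↔
    where
    to : AcceptingFrom c → ∃[ c′ ] c′ ∈ successors c × AcceptingFrom c′
    to (accepting-from ε h a)       = ⊥-elim (continues (h , a))
    to (accepting-from (s ◅ π) h a) = _ , s , accepting-from π h a

    from : (∃[ c′ ] c′ ∈ successors c × AcceptingFrom c′) → AcceptingFrom c
    from (_ , s , accepting-from π h a) = accepting-from (s ◅ π) h a

    to∘from : ∀ x → to (from x) ≡ x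
    to∘from (_ , s , accepting-from π h a) = refl

    from∘to : ∀ x → from (to x) ≡ x
    from∘to (accepting-from ε h a)       = ⊥-elim (continues (h , a))
    from∘to (accepting-from (s ◅ π) h a) = refl

  no-successor : ∀ {c c′} → Halting c → ¬ (c ⟶ c′)
  no-successor h s with subst (_ ∈_) h s
  ... | ()

  -- A path is a record that contains proofs, so a count of one also requires the proofs of halting
  -- and of acceptance to be unique.
  halted↔ : ∀ c → Halting c → T (accepting (Config.state c)) → AcceptingFrom c ↔ Fin 1
  halted↔ c h a = ↔-trans (mk↔ₛ′ (λ _ → tt) (λ _ → accepting-from ε h a) (λ _ → refl) unique) (↔-sym Finₚ.1↔⊤)
    where
    T-irrelevant : ∀ {b} (x y : T b) → x ≡ y
    T-irrelevant {true} _ _ = refl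

    []-irrelevant : ∀ {X : Set} {xs : List X} (x y : xs ≡ []) → x ≡ y
    []-irrelevant refl refl = refl

    unique : ∀ (π : AcceptingFrom c) → accepting-from ε h a ≡ π
    unique (accepting-from ε h′ a′)     = cong₂ (accepting-from ε) ([]-irrelevant h h′) (T-irrelevant a a′)
    unique (accepting-from (s ◅ _) _ _) = ⊥-elim (no-successor h s)

  rejected↔ : ∀ c → Halting c → ¬ T (accepting (Config.state c)) → AcceptingFrom c ↔ Fin 0
  rejected↔ c h ¬a = ↔-trans (acceptingFrom↔ c (¬a ∘ proj₂))
    (↔-trans (subst (λ cs → Any AcceptingFrom cs ↔ ⊥) (sym h) (↔-sym ⊥↔Any[])) (↔-sym Finₚ.0↔⊥))

-- Programs as machines

size : Shape → ℕ
size ●       = 1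
size (V n)   = n
size (σ ⊗ τ) = size σ + size τ

flat : ∀ σ {X : Set} → ⟦ σ ⟧ X → Vec X (size σ)
flat ●       x       = x ∷ []
flat (V n)   v       = v
flat (σ ⊗ τ) (x , y) = flat σ x Vec.++ flat τ y

unflat : ∀ σ {X : Set} → Vec X (size σ) → ⟦ σ ⟧ X
unflat ●       v = Vec.head v
unflat (V n)   v = v
unflat (σ ⊗ τ) v = unflat σ (Vec.take (size σ) v) , unflat τ (Vec.drop (size σ) v)

unflat-flat : ∀ σ {X : Set} (m : ⟦ σ ⟧ X) → unflat σ (flat σ m) ≡ m
unflat-flat ●       x       = refl
unflat-flat (V n)   v       = refl
unflat-flat (σ ⊗ τ) (x , y) = cong₂ _,_
  (trans (cong (unflat σ) (take-++ (flat σ x) (flat τ y))) (unflat-flat σ x))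
  (trans (cong (unflat τ) (drop-++ (flat σ x) (flat τ y))) (unflat-flat τ y))
  where
  take-++ : ∀ {X : Set} {m n} (v : Vec X m) (w : Vec X n) → Vec.take m (v Vec.++ w) ≡ v
  take-++ []      w = refl
  take-++ (x ∷ v) w = cong (x ∷_) (take-++ v w)

  drop-++ : ∀ {X : Set} {m n} (v : Vec X m) (w : Vec X n) → Vec.drop m (v Vec.++ w) ≡ w
  drop-++ []      w = refl
  drop-++ (x ∷ v) w = drop-++ v w

flat-map : ∀ σ {X Y : Set} (f : X → Y) m → Vec.map f (flat σ m) ≡ flat σ (mapS σ f m)
flat-map ●       f x       = refl
flat-map (V n)   f v       = refl
flat-map (σ ⊗ τ) f (x , y) = trans (Vecₚ.map-++ f (flat σ x) (flat τ y)) (cong₂ Vec._++_ (flat-map σ f x) (flat-map τ f y))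

flat-zip : ∀ σ {X Y Z : Set} (f : X → Y → Z) m n → Vec.zipWith f (flat σ m) (flat σ n) ≡ flat σ (zipS σ f m n)
flat-zip ●       f x       y         = refl
flat-zip (V n)   f v       w         = refl
flat-zip (σ ⊗ τ) f (x , y) (x′ , y′) = trans (zip-++ (flat σ x) (flat σ x′)) (cong₂ Vec._++_ (flat-zip σ f x x′) (flat-zip τ f y y′))
  where
  zip-++ : ∀ {m} (v : Vec _ m) (v′ : Vec _ m) → Vec.zipWith f (v Vec.++ flat τ y) (v′ Vec.++ flat τ y′) ≡
                                              Vec.zipWith f v v′ Vec.++ Vec.zipWith f (flat τ y) (flat τ y′)
  zip-++ []      []       = refl
  zip-++ (x ∷ v) (y ∷ v′) = cong (f x y ∷_) (zip-++ v v′)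

flat-pure : ∀ σ {X : Set} (x : X) → flat σ (pureS σ x) ≡ Vec.replicate (size σ) x
flat-pure ●       x = refl
flat-pure (V n)   x = refl
flat-pure (σ ⊗ τ) x = trans (cong₂ Vec._++_ (flat-pure σ x) (flat-pure τ x)) (replicate-++ (size σ))
  where
  replicate-++ : ∀ m → Vec.replicate m x Vec.++ Vec.replicate (size τ) x ≡ Vec.replicate (m + size τ) x
  replicate-++ zero    = refl
  replicate-++ (suc m) = cong (x ∷_) (replicate-++ m)

initialMemory : ∀ {A} σ → Word → Memory A (● ⊗ σ)
initialMemory σ w = inputTape w , pureS σ blankTape

-- The exit becomes the only accepting state and has no transitions; a program state without
-- transitions halts in a state that is not accepting, and so rejects.
module Compile {A σ} (finite-A : Finite A) (P : Program A (● ⊗ σ)) where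

  compiledδ : Maybe (State P) → Vec (Symbol A) (suc (size σ)) → List (Maybe (State P) × Vec (Symbol A × Move) (suc (size σ)))
  compiledδ nothing  ss = []
  compiledδ (just q) ss = map (λ (x , a) → x , flat (● ⊗ σ) a) (δ P q (unflat (● ⊗ σ) ss))

  accepts : Maybe (State P) → Bool
  accepts nothing  = true
  accepts (just q) = false

  compiled : TM
  compiled = record
    { State = Maybe (State P) ; state-finite = finite-Maybe (state-finite P)
    ; Aux = A ; aux-finite = finite-A ; extraTapes = size σ
    ; start = just (start P) ; accepting = accepts ; δ = compiledδ }

  open TM compiled hiding (State; start; δ)

  ⌞_,_⌟ : Maybe (State P) → Memory A (● ⊗ σ) → Config
  ⌞ x , m ⌟ = config x (flat (● ⊗ σ) m)

  targets : List (Maybe (State P) × Action A (● ⊗ σ)) → Memory A (● ⊗ σ) → List Config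
  targets as m = map (λ (x , a) → ⌞ x , act (● ⊗ σ) a m ⌟) as

  successors-⌞⌟ : ∀ q m → successors ⌞ just q , m ⌟ ≡ targets (δ P q (scan (● ⊗ σ) m)) m
  successors-⌞⌟ q m = begin
    map f (map g (δ P q (unflat (● ⊗ σ) (Vec.map Tape.scanned (flat (● ⊗ σ) m)))))
      ≡⟨ cong (λ ss → map f (map g (δ P q ss))) (trans (cong (unflat (● ⊗ σ)) (flat-map (● ⊗ σ) Tape.scanned m)) (unflat-flat (● ⊗ σ) _)) ⟩
    map f (map g (δ P q (scan (● ⊗ σ) m)))
      ≡⟨ sym (Listₚ.map-∘ (δ P q (scan (● ⊗ σ) m))) ⟩
    map (f ∘ g) (δ P q (scan (● ⊗ σ) m))
      ≡⟨ Listₚ.map-cong (λ (x , a) → cong (config x) (flat-zip (● ⊗ σ) writeMove a m)) _ ⟩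
    targets (δ P q (scan (● ⊗ σ) m)) m ∎
    where
    open ≡-Reasoning
    f : Maybe (State P) × Vec (Symbol A × Move) (suc (size σ)) → Config
    f (x , as) = config x (Vec.zipWith writeMove as (flat (● ⊗ σ) m))
    g : Maybe (State P) × Action A (● ⊗ σ) → Maybe (State P) × Vec (Symbol A × Move) (suc (size σ))
    g (x , a) = x , flat (● ⊗ σ) a

  initial-⌞⌟ : ∀ w → initial w ≡ ⌞ just (start P) , initialMemory σ w ⌟
  initial-⌞⌟ w = cong (config _ ∘ (inputTape w ∷_)) (sym (flat-pure σ blankTape))

  module _ {R : Set} {K : Memory A (● ⊗ σ) → List R → ℕ → Set} where

    steps-Run   : ∀ {q m rs t} → Run P K q m rs t → ∀ {c} (π : ⌞ just q , m ⌟ ⟶* c) → steps π ≤ t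
    steps-Next  : ∀ {x m rs t} → Next P K x m rs t → ∀ {c} (π : ⌞ x , m ⌟ ⟶* c) → steps π ≤ t
    steps-Nexts : ∀ {as m rs t} → Nexts P K as m rs t → ∀ {c c′} → c′ ∈ targets as m → (π : c′ ⟶* c) → steps π ≤ t

    steps-Run (step r)                   ε       = z≤n
    steps-Run (step {q = q} {m = m} r)   (s ◅ π) = s≤s (steps-Nexts r (subst (_ ∈_) (successors-⌞⌟ q m) s) π)

    steps-Next (exit k) ε        = z≤n
    steps-Next (exit k) (() ◅ π)
    steps-Next (goto r) π        = steps-Run r π

    steps-Nexts (r ∷ _) (here refl) π = steps-Next r π
    steps-Nexts (_ ∷ r) (there s)   π = steps-Nexts r s π

    -- Each exit is one accepting path and has to carry one result; the lengths then add up along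
    -- `++` like the numbers of paths.
    module _ (single : ∀ {m rs t} → K m rs t → length rs ≡ 1) where

      count-Run   : ∀ {q m rs t} → Run P K q m rs t → AcceptingFrom compiled ⌞ just q , m ⌟ ↔ Fin (length rs)
      count-Next  : ∀ {x m rs t} → Next P K x m rs t → AcceptingFrom compiled ⌞ x , m ⌟ ↔ Fin (length rs)
      count-Nexts : ∀ {as m rs t} → Nexts P K as m rs t → Any (AcceptingFrom compiled) (targets as m) ↔ Fin (length rs)

      count-Run (step {q = q} {m = m} r) = ↔-trans (acceptingFrom↔ compiled ⌞ just q , m ⌟ proj₂)
        (subst (λ cs → Any (AcceptingFrom compiled) cs ↔ _) (sym (successors-⌞⌟ q m)) (count-Nexts r))

      count-Next {m = m} (exit k) = subst (λ n → AcceptingFrom compiled ⌞ nothing , m ⌟ ↔ Fin n) (sym (single k))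
        (halted↔ compiled ⌞ nothing , m ⌟ refl tt)
      count-Next (goto r) = count-Run r

      count-Nexts []                      = ↔-trans (↔-sym ⊥↔Any[]) (↔-sym Finₚ.0↔⊥)
      count-Nexts (_∷_ {rs = rs} {rs′} r r′) = ↔-trans (↔-sym (∷↔ (AcceptingFrom compiled)))
        (↔-trans (count-Next r ⊎-↔ count-Nexts r′)
          (↔-trans (↔-sym Finₚ.+↔⊎) (subst (λ n → Fin n ↔ Fin (length (rs ++ rs′))) (Listₚ.length-++ rs) ↔-refl)))

    module _ {Q : R → Word → Set} (result : ∀ {m rs t} → K m rs t → ∃[ r ] r ∈ rs × Q r (tapeWord (proj₁ m))) where

      Output∈ : List R → Config → Set
      Output∈ rs c = ∃[ r ] r ∈ rs × Q r (output c)

      output-Run   : ∀ {q m rs t} → Run P K q m rs t → ∀ (π : AcceptingFrom compiled ⌞ just q , m ⌟) → Output∈ rs (AcceptingFrom.end π)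
      output-Next  : ∀ {x m rs t} → Next P K x m rs t → ∀ (π : AcceptingFrom compiled ⌞ x , m ⌟) → Output∈ rs (AcceptingFrom.end π)
      output-Nexts : ∀ {as m rs t} → Nexts P K as m rs t → ∀ {c} → c ∈ targets as m →
                     ∀ (π : AcceptingFrom compiled c) → Output∈ rs (AcceptingFrom.end π)

      output-Run (step r)                 (accepting-from ε h ())
      output-Run (step {q = q} {m = m} r) (accepting-from (s ◅ π) h a) =
        output-Nexts r (subst (_ ∈_) (successors-⌞⌟ q m) s) (accepting-from π h a)

      output-Next (exit k) (accepting-from ε h a) = result k
      output-Next (exit k) (accepting-from (() ◅ π) h a)
      output-Next (goto r) π = output-Run r π

      output-Nexts (_∷_ {rs = rs} r _) (here refl) π with output-Next r π
      ... | x , x∈ , e = x , ∈-++⁺ˡ x∈ , e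
      output-Nexts (_∷_ {rs = rs} _ r) (there s)   π with output-Nexts r s π
      ... | x , x∈ , e = x , ∈-++⁺ʳ rs x∈ , e

-- Copying a word between tapes

-- With `leftOf`, the two positions of a head at a boundary between cells: on the nearest cell to
-- its right or to its left. A move to the right always ends in the form `at`, a move to the left in
-- the form `leftOf`.
at : ∀ {A} → List (Symbol A) → List (Symbol A) → Tape A
at ls []       = tape ls blank []
at ls (s ∷ rs) = tape ls s rs

leftOf : ∀ {A} → List (Symbol A) → List (Symbol A) → Tape A
leftOf []       rs = tape [] blank rs
leftOf (l ∷ ls) rs = tape ls l rs

move-right : ∀ {A} ls (s : Symbol A) rs → move right (tape ls s rs) ≡ at (s ∷ ls) rs
move-right ls s []       = refl
move-right ls s (r ∷ rs) = refl

move-left : ∀ {A} ls (s : Symbol A) rs → move left (tape ls s rs) ≡ leftOf ls (s ∷ rs)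
move-left []       s rs = refl
move-left (l ∷ ls) s rs = refl

inputTape≡at : ∀ {A} w → inputTape {A} w ≡ at [] (map bit w)
inputTape≡at []      = refl
inputTape≡at (b ∷ w) = refl

tapeWord-at : ∀ {A} ls (rs : List (Symbol A)) → tapeWord (at ls rs) ≡ leadingBits rs
tapeWord-at ls []       = refl
tapeWord-at ls (s ∷ rs) = refl

leadingBits-word : ∀ {A} w (ss : List (Symbol A)) → leadingBits (map bit w ++ blank ∷ ss) ≡ w
leadingBits-word []      ss = refl
leadingBits-word (b ∷ w) ss = cong (b ∷_) (leadingBits-word w ss)

leadingBits-bits : ∀ {A} w → leadingBits (map (bit {A}) w) ≡ w
leadingBits-bits []      = refl
leadingBits-bits (b ∷ w) = cong (b ∷_) (leadingBits-bits w)

-- The left side after the head has stepped onto it and come back: if it was empty, the visited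
-- blank is now an explicit cell.
pad : ∀ {A} → List (Symbol A) → List (Symbol A)
pad []       = blank ∷ []
pad (l ∷ ls) = l ∷ ls

leftOf-right : ∀ {A} ls (rs : List (Symbol A)) →
               writeMove (Tape.scanned (leftOf ls rs) , right) (leftOf ls rs) ≡ at (pad ls) rs
leftOf-right []       rs = move-right [] blank rs
leftOf-right (l ∷ ls) rs = move-right ls l rs

afterBits : ∀ {A} → List (Symbol A) → List (Symbol A)
afterBits []           = blank ∷ []
afterBits (bit b ∷ rs) = afterBits rs
afterBits (s ∷ rs)     = s ∷ rs

module Copy {A : Set} (f : Bool → Symbol A) where

  -- The way back is measured on the second tape, because the first may have been erased by
  -- `f = const blank` and may hold other symbols further left.
  copyδ : Fin 2 → Symbol A × Symbol A → Maybe (Fin 2) × Action A (● ⊗ ●)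
  copyδ 0F (bit b , d)     = just 0F , (f b , right) , (bit b , right)
  copyδ 0F (s , d)         = just 1F , (s , left) , (d , left)
  copyδ 1F (s , bit b)     = just 1F , (s , left) , (bit b , left)
  copyδ 1F (s , d)         = nothing , (s , right) , (d , right)

  -- Copies the word under the first head to the second tape, replacing its bits by f,
  -- and rewinds both heads.
  copy : Program A (● ⊗ ●)
  copy = record { State = Fin 2 ; state-finite = finite-Fin 2 ; start = 0F ; δ = λ q ss → copyδ q ss ∷ [] }

  copyTime : ℕ → ℕ → ℕ → ℕ
  copyTime zero    d t = suc (d + suc t)
  copyTime (suc n) d t = suc (copyTime n (suc d) t)

  copyTime≡ : ∀ n d t → copyTime n d t ≡ 2 + 2 * n + d + t
  copyTime≡ zero    d t = cong suc (ℕₚ.+-suc d t)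
  copyTime≡ (suc n) d t = trans (cong suc (copyTime≡ n (suc d) t)) (lem n d t)
    where
    lem : ∀ n d t → suc (2 + 2 * n + suc d + t) ≡ 2 + 2 * suc n + d + t
    lem = solve-∀

  module _ {R : Set} {K : Memory A (● ⊗ ●) → List R → ℕ → Set} {ls : List (Symbol A)} {results : List R} {t : ℕ} where

    back-run : ∀ us ds {sr dr} → length us ≡ length ds →
               K (at (pad ls) (us ʳ++ sr) , at (blank ∷ []) (map bit ds ʳ++ dr)) results t →
               Run copy K 1F (leftOf (us ++ ls) sr , leftOf (map bit ds) dr) results (length ds + suc t)
    back-run [] [] {sr} {dr} e k =
      one refl (cong₂ _,_ (leftOf-right ls sr) (leftOf-right [] dr)) (exit k)
    back-run (u ∷ us) (b ∷ ds) {sr} {dr} e k =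
      one refl (cong₂ _,_ (move-left (us ++ ls) u sr) (move-left (map bit ds) (bit b) dr))
        (goto (back-run us ds (ℕₚ.suc-injective e) k))

    forward-run : ∀ us ds rs → length us ≡ length ds →
      K (at (pad ls) (us ʳ++ (map f (leadingBits rs) ++ afterBits rs)) ,
         at (blank ∷ []) (map bit ds ʳ++ (map bit (leadingBits rs) ++ blank ∷ []))) results t →
      Run copy K 0F (at (us ++ ls) rs , at (map bit ds) []) results (copyTime (length (leadingBits rs)) (length ds) t)
    forward-run us ds [] e k =
      one refl (cong₂ _,_ (move-left (us ++ ls) blank []) (move-left (map bit ds) blank [])) (goto (back-run us ds e k))
    forward-run us ds (blank ∷ rs) e k =
      one refl (cong₂ _,_ (move-left (us ++ ls) blank rs) (move-left (map bit ds) blank [])) (goto (back-run us ds e k))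
    forward-run us ds (aux a ∷ rs) e k =
      one refl (cong₂ _,_ (move-left (us ++ ls) (aux a) rs) (move-left (map bit ds) blank [])) (goto (back-run us ds e k))
    forward-run us ds (bit b ∷ rs) e k =
      one refl (cong₂ _,_ (move-right (us ++ ls) (f b) rs) refl) (goto (forward-run (f b ∷ us) (b ∷ ds) rs (cong suc e) k))

    copy-run : ∀ rs → K (at (pad ls) (map f (leadingBits rs) ++ afterBits rs) ,
                         at (blank ∷ []) (map bit (leadingBits rs) ++ blank ∷ [])) results t →
               Run copy K 0F (at ls rs , blankTape) results (2 + 2 * length (leadingBits rs) + t)
    copy-run rs k = subst (Run copy K 0F _ results)
      (trans (copyTime≡ (length (leadingBits rs)) 0 t) (cong (_+ t) (ℕₚ.+-identityʳ _)))
      (forward-run [] [] rs refl k)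

open Copy using (copy; copy-run)

copy-deterministic : ∀ {A} (f : Bool → Symbol A) → Deterministic-program (copy f)
copy-deterministic f q ss = ℕₚ.≤-refl

input≈copied : ∀ {A} w → inputTape {A} w ≈ at (blank ∷ []) (map bit w ++ blank ∷ [])
input≈copied []          = tape≈ (blankʳ []) refl []
input≈copied {A} (b ∷ w) = tape≈ (blankʳ []) refl (bits w)
  where
  bits : ∀ w → map (bit {A}) w ≋ (map bit w ++ blank ∷ [])
  bits []      = blankʳ []
  bits (b ∷ w) = bit b ∷ bits w

blank≈erased : ∀ {A} (w : Word) → blankTape {A} ≈ at (blank ∷ []) (map (const blank) w ++ blank ∷ [])
blank≈erased []          = tape≈ (blankʳ []) refl []
blank≈erased {A} (b ∷ w) = tape≈ (blankʳ []) refl (blanks w)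
  where
  blanks : ∀ w → [] ≋ (map (const (blank {A})) w ++ blank ∷ [])
  blanks []      = blankʳ []
  blanks (_ ∷ w) = blankʳ (blanks w)

afterBits-bits : ∀ {A} w → afterBits {A} (map bit w) ≡ blank ∷ []
afterBits-bits []      = refl
afterBits-bits (b ∷ w) = afterBits-bits w

-- Nondeterministic polynomial-time transductions

-- A relation rather than a function, so that `anyWord` can leave the output of a purely counting
-- machine unspecified.
Encoding : Set → Set₁
Encoding X = X → Word → Set

⟪_⟫ : ∀ {X} → (X → Word) → Encoding X
⟪ e ⟫ x w = w ≡ e x

anyWord : ∀ {X} → Encoding X
anyWord _ _ = ⊤

Final : ∀ {A σ J} → Encoding J → Memory A (● ⊗ σ) → List J → ℕ → Set
Final Out m rs t = ∃[ r ] rs ≡ r ∷ [] × Out r (tapeWord (proj₁ m))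

-- F i lists the results of the accepting paths on every word that encodes i;
-- with d = true the machine is deterministic.
record NT (d : Bool) {I J : Set} (In : Encoding I) (Out : Encoding J) (F : I → List J) : Set₁ where
  field
    {Alphabet}      : Set
    finite-alphabet : Finite Alphabet
    {layout}        : Shape
    program         : Program Alphabet (● ⊗ layout)
    deterministic   : T d → Deterministic-program program
    time            : Polynomial
    run             : ∀ {i w} → In i w → Run program (Final Out) (start program) (initialMemory layout w) (F i) (eval time (length w))

weaken-NT : ∀ {d I J} {In : Encoding I} {Out Out′ : Encoding J} {F G : I → List J} →
            (∀ {r w} → Out r w → Out′ r w) → (∀ i → F i ≡ G i) → NT d In Out F → NT d In Out′ G
weaken-NT sub e M = record
  { finite-alphabet = finite-alphabet ; program = program ; deterministic = deterministic ; time = time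
  ; run = λ {i} h → subst (λ rs → Run program _ _ _ rs _) (e i)
      (pure-results (Run program _ _ _) (Run-bind [_] 0
        (λ {m} {rs} (r , e , o) → r , trans (Listₚ.concatMap-pure rs) e , sub o) (run h))) }
  where open NT M

nondeterministic : ∀ {d I J} {In : Encoding I} {Out : Encoding J} {F : I → List J} → NT d In Out F → NT false In Out F
nondeterministic M = record
  { finite-alphabet = finite-alphabet ; program = program ; deterministic = λ () ; time = time ; run = run }
  where open NT M

map-results : ∀ {d I J L} {In : Encoding I} {Out : Encoding J} {Out′ : Encoding L} {F : I → List J} (f : J → L) →
              (∀ {r w} → Out r w → Out′ (f r) w) → NT d In Out F → NT d In Out′ (map f ∘ F)
map-results {F = F} f sub M = record
  { finite-alphabet = finite-alphabet ; program = program ; deterministic = deterministic ; time = time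
  ; run = λ {i} h → subst₂ (Run program _ _ _) (sym (map≡ (F i))) (ℕₚ.+-identityʳ _)
      (Run-bind ([_] ∘ f) 0 (λ { {rs = rs} (r , refl , o) → f r , refl , sub o }) (run h)) }
  where
  open NT M
  map≡ : ∀ xs → map f xs ≡ concatMap ([_] ∘ f) xs
  map≡ xs = sym (trans (sym (Listₚ.concatMap-map [_] f xs)) (Listₚ.concatMap-pure (map f xs)))

reindex : ∀ {d I I′ J} {In : Encoding I} {In′ : Encoding I′} {Out : Encoding J} {F : I → List J} (f : I′ → I) →
          (∀ {i w} → In′ i w → In (f i) w) → NT d In Out F → NT d In′ Out (F ∘ f)
reindex f sub M = record
  { finite-alphabet = finite-alphabet ; program = program ; deterministic = deterministic ; time = time
  ; run = λ h → run (sub h) }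
  where open NT M

mapS-initial : ∀ {A B : Set} σ (f : A → B) w → mapS (● ⊗ σ) (mapTape f) (initialMemory σ w) ≡ initialMemory σ w
mapS-initial σ f w = cong₂ _,_ (inputTape-map f w) (mapS-pureS σ (mapTape f) blankTape)

Run-recode-initial : ∀ {A B σ J} (f : A → B) (g : B → Maybe A) → (∀ a → g (f a) ≡ just a) →
  {P : Program A (● ⊗ σ)} {Out : Encoding J} → ∀ {w rs t} →
  Run P (Final Out) (start P) (initialMemory σ w) rs t →
  Run (recode f g P) (Final Out) (start P) (initialMemory σ w) rs t
Run-recode-initial {σ = σ} f g e {P} {Out} {w} r =
  subst (λ m → Run (recode f g P) (Final Out) (start P) m _ _) (mapS-initial σ f w)
    (Run-recode f g e (λ {m} (r , e , o) → r , e , subst (Out r) (sym (tapeWord-map f (proj₁ m))) o) r)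

fromInj₁ : ∀ {A B : Set} → A ⊎ B → Maybe A
fromInj₁ (inj₁ a) = just a
fromInj₁ (inj₂ b) = nothing

fromInj₂ : ∀ {A B : Set} → A ⊎ B → Maybe B
fromInj₂ (inj₁ a) = nothing
fromInj₂ (inj₂ b) = just b

copyPoly : Polynomial
copyPoly = constant 2 ⊕ scale 2 identity

eval-copyPoly : ∀ n → eval copyPoly n ≡ 2 + 2 * n
eval-copyPoly n = trans (eval-⊕ (constant 2) (scale 2 identity) n)
  (cong₂ _+_ (eval-constant 2 n) (trans (eval-scale 2 identity n) (cong (2 *_) (eval-identity n))))

width-inputTape : ∀ {A} w → width (inputTape {A} w) ≤ length w
width-inputTape []      = z≤n
width-inputTape (b ∷ w) = ℕₚ.m≤n⇒m≤1+n (ℕₚ.≤-reflexive (Listₚ.length-map bit w))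


copy-run-input : ∀ {A} (f : Bool → Symbol A) {R : Set} {K : Memory A (● ⊗ ●) → List R → ℕ → Set} {rs t} w →
                 K (at (blank ∷ []) (map f w ++ blank ∷ []) , at (blank ∷ []) (map bit w ++ blank ∷ [])) rs t →
                 Run (copy f) K 0F (inputTape w , blankTape) rs (2 + 2 * length w + t)
copy-run-input f {K = K} {rs} {t} w k =
  subst₂ (λ u x → Run (copy f) K 0F (u , blankTape) rs (2 + 2 * length x + t)) (sym (inputTape≡at w)) (leadingBits-bits w)
    (copy-run f (map bit w) (subst₂ (λ x y → K (at (blank ∷ []) (map f x ++ y) , at (blank ∷ []) (map bit x ++ blank ∷ [])) rs t)
      (sym (leadingBits-bits w)) (sym (afterBits-bits w)) k))

-- The second machine comes first in the layout, so that its output tape is the output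
-- tape of the composite; the input is moved away from that tape at the beginning.
module Compose {d I J L} {In : Encoding I} {Mid : Encoding J} {Out : Encoding L} {F : I → List J} {G : J → List L}
               (M : NT d In Mid F) (N : NT d Mid Out G) where

  module M = NT M
  module N = NT N

  A : Set
  A = M.Alphabet ⊎ N.Alphabet

  P : Program A (● ⊗ M.layout)
  P = recode inj₁ fromInj₁ M.program

  Q : Program A (● ⊗ N.layout)
  Q = recode inj₂ fromInj₂ N.program

  moveWord : ∀ {σ τ} → Program A ((● ⊗ σ) ⊗ (● ⊗ τ))
  moveWord = lift (fstL ×L fstL) (copy (const blank))

  second : Program A ((● ⊗ N.layout) ⊗ (● ⊗ M.layout))
  second = lift swapL moveWord ⨾ lift fstL Q

  composite : Program A (● ⊗ N.layout ⊗ ● ⊗ M.layout)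
  composite = lift assocL (moveWord ⨾ lift sndL P ⨾ second)

  -- `sizePoly` bounds the intermediate word, by the cells of the input plus one cell for each step
  -- of `M`; the time of the second phase is then a polynomial in a polynomial.
  secondPoly sizePoly totalPoly : Polynomial
  secondPoly = copyPoly ⊕ N.time
  sizePoly   = constant 1 ⊕ (identity ⊕ M.time)
  totalPoly  = copyPoly ⊕ (M.time ⊕ substitute secondPoly sizePoly)

  Done : Memory A ((● ⊗ N.layout) ⊗ (● ⊗ M.layout)) → List L → ℕ → Set
  Done m = Final Out (proj₁ m)

  Done-≈ : ∀ {m n rs t} → Memory≈ ((● ⊗ N.layout) ⊗ (● ⊗ M.layout)) m n → Done m rs t → Done n rs t
  Done-≈ ((e , _) , _) (r , e′ , o) = r , e′ , subst (Out r) (tapeWord-≈ e) o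

  blanks : ∀ {σ} → Memory A σ
  blanks {σ} = pureS σ blankTape

  last-run : ∀ {j w t₀ m} → Mid j w → inputTape w ≈ t₀ →
             Run (lift fstL Q) Done (start Q) ((t₀ , blanks) , m) (G j) (eval N.time (length w))
  last-run {w = w} {m = m} h e =
    Run-≈ {K = Done} {L = Done} (λ {m n rs t} → Done-≈ {m} {n} {rs} {t}) ((e , Memory≈-refl N.layout blanks) , Memory≈-refl (● ⊗ M.layout) m)
      (Run-lift fstL {K = Done} {n = (blankTape , blanks) , m} (Run-recode-initial inj₂ fromInj₂ (λ _ → refl) {Out = Out} (N.run h)))

  -- `M` may leave anything on its own tapes: only the word under its output head is carried over,
  -- and the tapes of `N` are still blank.
  second-run : ∀ {j w} ls rs {v} → Mid j w → leadingBits rs ≡ w →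
               Run second Done (start second) ((blankTape , blanks) , (at ls rs , v)) (G j) (2 + 2 * length w + eval N.time (length w))
  second-run ls rs {v} h refl =
    Run-⨾ (Run-lift swapL {n = (blankTape , blanks) , (at ls rs , v)}
      (Run-lift (fstL ×L fstL) {n = (at ls rs , v) , (blankTape , blanks)}
        (copy-run (const blank) rs (last-run h (input≈copied (leadingBits rs))))))

  eval-secondPoly : ∀ n → eval secondPoly n ≡ 2 + 2 * n + eval N.time n
  eval-secondPoly n = trans (eval-⊕ copyPoly N.time n) (cong (_+ eval N.time n) (eval-copyPoly n))

  eval-sizePoly : ∀ n → eval sizePoly n ≡ suc (n + eval M.time n)
  eval-sizePoly n = trans (eval-⊕ (constant 1) (identity ⊕ M.time) n)
    (cong₂ _+_ (eval-constant 1 n) (trans (eval-⊕ identity M.time n) (cong (_+ eval M.time n) (eval-identity n))))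

  eval-totalPoly : ∀ n → eval totalPoly n ≡ 2 + 2 * n + (eval M.time n + eval secondPoly (eval sizePoly n))
  eval-totalPoly n = trans (eval-⊕ copyPoly (M.time ⊕ substitute secondPoly sizePoly) n)
    (cong₂ _+_ (eval-copyPoly n) (trans (eval-⊕ M.time (substitute secondPoly sizePoly) n)
      (cong (eval M.time n +_) (eval-substitute secondPoly sizePoly n))))

  after-first : ∀ n {m rs t} → Within (Final Mid) (n + eval M.time n) m rs t →
                Run second Done (start second) ((blankTape , blanks) , m) (concatMap G rs) (t + eval secondPoly (eval sizePoly n))
  after-first n {m = tape l s r , v} {t = t} ((j , refl , h) , bound) =
    subst (λ z → Run second Done _ _ z _) (sym (Listₚ.++-identityʳ (G j)))
      (Run-weaken (λ _ k → k) long (second-run l (s ∷ r) h refl))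
    where
    w = tapeWord (tape l s r)
    short : length w ≤ eval sizePoly n
    short = begin
      length w                    ≤⟨ length-tapeWord (tape l s r) ⟩
      suc (length r)              ≤⟨ s≤s (ℕₚ.≤-trans (ℕₚ.m≤m+n _ t) bound) ⟩
      suc (n + eval M.time n)     ≡⟨ sym (eval-sizePoly n) ⟩
      eval sizePoly n             ∎
      where open ℕₚ.≤-Reasoning
    long : 2 + 2 * length w + eval N.time (length w) ≤ t + eval secondPoly (eval sizePoly n)
    long = begin
      2 + 2 * length w + eval N.time (length w)     ≡⟨ sym (eval-secondPoly (length w)) ⟩
      eval secondPoly (length w)                    ≤⟨ eval-mono secondPoly short ⟩
      eval secondPoly (eval sizePoly n)             ≤⟨ ℕₚ.m≤n+m _ t ⟩
      t + eval secondPoly (eval sizePoly n)         ∎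
      where open ℕₚ.≤-Reasoning

  first-run : ∀ {i w t₀ u} → In i w → blankTape ≈ t₀ → inputTape w ≈ u → let n = length w in
              Run (lift sndL P ⨾ second) Done (start (lift {τ = (● ⊗ N.layout) ⊗ (● ⊗ M.layout)} sndL P ⨾ second))
                ((t₀ , blanks) , (u , blanks)) (concatMap G (F i)) (eval M.time n + eval secondPoly (eval sizePoly n))
  first-run {w = w} h e e′ =
    Run-≈ {K = Done} {L = Done} (λ {m n rs t} → Done-≈ {m} {n} {rs} {t}) ((e , Memory≈-refl N.layout blanks) , (e′ , Memory≈-refl M.layout blanks))
      (Run-⨾ {Q = second} (Run-lift sndL {K = Run second Done (start second)} {n = (blankTape , blanks) , (blankTape , blanks)}
        (Run-bind G (eval secondPoly (eval sizePoly n)) (after-first n)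
          (Run-width (n + eval M.time n) (ℕₚ.+-monoˡ-≤ (eval M.time n) (width-inputTape w))
            (Run-recode-initial inj₁ fromInj₁ (λ _ → refl) {Out = Mid} (M.run h))))))
    where n = length w

  composite-run : ∀ {i w} → In i w →
    Run composite (Final Out) (start composite) (initialMemory _ w) (concatMap G (F i)) (eval totalPoly (length w))
  composite-run {i} {w} h = subst (Run composite (Final Out) _ _ _) (sym (eval-totalPoly (length w)))
    (Run-lift assocL {n = initialMemory _ w}
      (Run-⨾ (Run-lift (fstL ×L fstL) {n = (inputTape w , blanks) , (blankTape , blanks)}
        (copy-run-input (const blank) w (first-run h (blank≈erased w) (input≈copied w))))))

  compose : NT d In Out (concatMap G ∘ F)
  compose = record
    { finite-alphabet = finite-⊎ M.finite-alphabet N.finite-alphabet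
    ; program = composite
    ; deterministic = λ h → lift-deterministic assocL (moveWord ⨾ lift sndL P ⨾ second)
        (⨾-deterministic moveWord (lift sndL P ⨾ second) moveWord-deterministic
          (⨾-deterministic (lift sndL P) second
            (lift-deterministic sndL P (recode-deterministic inj₁ fromInj₁ M.program (M.deterministic h)))
            (⨾-deterministic (lift swapL moveWord) (lift fstL Q)
              (lift-deterministic swapL moveWord moveWord-deterministic)
              (lift-deterministic fstL Q (recode-deterministic inj₂ fromInj₂ N.program (N.deterministic h))))))
    ; time = totalPoly
    ; run = composite-run }
    where
    moveWord-deterministic : ∀ {σ τ} → Deterministic-program (moveWord {σ} {τ})
    moveWord-deterministic = lift-deterministic (fstL ×L fstL) (copy (const blank)) (copy-deterministic (const blank))

open Compose using (compose)

-- The machine runs on a copy of its input, and the input itself becomes the output.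
module Guard {d I J} {In : Encoding I} {Out : Encoding J} {F : I → List J} (M : NT d In Out F) where

  open NT M

  saveInput : Program Alphabet (● ⊗ ● ⊗ layout)
  saveInput = lift (idL ×L fstL) (copy bit)

  guardPoly : Polynomial
  guardPoly = copyPoly ⊕ time

  inner-run : ∀ {i w u v} → In i w → inputTape w ≈ u → inputTape w ≈ v →
              Run (lift sndL program) (Final In) (start program) (u , (v , pureS layout blankTape)) (map (const i) (F i)) (eval time (length w))
  inner-run {i} {w} {u} h e e′ =
    Run-≈ {K = Final In} {L = Final In} (λ { (d , _) (r , e , o) → r , e , subst (In r) (tapeWord-≈ d) o })
      (e , (e′ , Memory≈-refl layout (pureS layout blankTape)))
      (subst₂ (Run (lift sndL program) (Final In) _ _) (Listₚ.concatMap-pure (map (const i) (F i))) (ℕₚ.+-identityʳ _)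
        (subst (λ z → Run (lift sndL program) (Final In) _ _ z _) (sym (Listₚ.concatMap-map [_] (const i) (F i)))
        (Run-lift sndL {K = Final In} {n = (inputTape w , initialMemory layout w)}
        (Run-bind (λ _ → i ∷ []) 0 (λ { (r , refl , o) → i , refl , subst (In i) (sym tapeWord-input) h }) (run h)))))
    where
    tapeWord-input : tapeWord (inputTape {Alphabet} w) ≡ w
    tapeWord-input = trans (cong tapeWord (inputTape≡at w)) (trans (tapeWord-at [] (map bit w)) (leadingBits-bits w))

  -- Every accepting path hands the input on, so a machine with one accepting path or none acts as a
  -- test in front of the next machine.
  guard : NT d In In (λ i → map (const i) (F i))
  guard = record
    { finite-alphabet = finite-alphabet
    ; program = saveInput ⨾ lift sndL program
    ; deterministic = λ h → ⨾-deterministic saveInput (lift sndL program)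
        (lift-deterministic (idL ×L fstL) (copy bit) (copy-deterministic bit)) (lift-deterministic sndL program (deterministic h))
    ; time = guardPoly
    ; run = λ {i} {w} h →
        subst (Run (saveInput ⨾ lift sndL program) (Final In) _ _ _)
          (sym (trans (eval-⊕ copyPoly time (length w)) (cong (_+ eval time (length w)) (eval-copyPoly (length w)))))
          (Run-⨾ (Run-lift (idL ×L fstL) {n = initialMemory _ w}
            (copy-run-input bit w (inner-run h (input≈copied w) (input≈copied w))))) }

open Guard using (guard)

choose : ∀ {A σ} → Program A σ → Program A σ → Program A σ
choose {σ = σ} P Q = record
  { State = Maybe (State P ⊎ State Q)
  ; state-finite = finite-Maybe (finite-⊎ (state-finite P) (state-finite Q))
  ; start = nothing
  ; δ = λ { nothing ss → (just (just (inj₁ (start P))) , keep σ ss) ∷ (just (just (inj₂ (start Q))) , keep σ ss) ∷ []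
          ; (just (inj₁ p)) ss → map (λ { (nothing , a) → nothing , a ; (just q , a) → just (just (inj₁ q)) , a }) (δ P p ss)
          ; (just (inj₂ p)) ss → map (λ { (nothing , a) → nothing , a ; (just q , a) → just (just (inj₂ q)) , a }) (δ Q p ss) } }

Run-choose : ∀ {A σ} {P Q : Program A σ} {R : Set} {K : Memory A σ → List R → ℕ → Set} {m rs rs′ t} →
             Run P K (start P) m rs t → Run Q K (start Q) m rs′ t → Run (choose P Q) K nothing m (rs ++ rs′) (suc t)
Run-choose {σ = σ} {P} {Q} {K = K} {m} {rs} {rs′} {t} r r′ =
  step (goto (subst (λ n → Run (choose P Q) K _ n rs t) (sym (act-keep σ m)) (left-run r)) ∷
    subst (λ z → Nexts (choose P Q) K _ m z t) (Listₚ.++-identityʳ rs′)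
      (goto (subst (λ n → Run (choose P Q) K _ n rs′ t) (sym (act-keep σ m)) (right-run r′)) ∷ []))
  where
  left-run : Run P K (start P) m rs t → Run (choose P Q) K (just (inj₁ (start P))) m rs t
  left-run r = pure-results (Run (choose P Q) K _ _)
    (simulate {P = P} {Q = choose P Q} (just ∘ inj₁) nothing _≡_ [_] 0
      (λ { q refl → id , Listₚ.map-cong (λ { (nothing , a) → refl ; (just _ , a) → refl }) _ , λ a → refl })
      (λ { refl k → exit (pure-results⁻ (K _) k) }) refl r)

  right-run : Run Q K (start Q) m rs′ t → Run (choose P Q) K (just (inj₂ (start Q))) m rs′ t
  right-run r = pure-results (Run (choose P Q) K _ _)
    (simulate {P = Q} {Q = choose P Q} (just ∘ inj₂) nothing _≡_ [_] 0
      (λ { q refl → id , Listₚ.map-cong (λ { (nothing , a) → refl ; (just _ , a) → refl }) _ , λ a → refl })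
      (λ { refl k → exit (pure-results⁻ (K _) k) }) refl r)

sum : ∀ {I J} {In : Encoding I} {Out : Encoding J} {F G : I → List J} →
      NT false In Out F → NT false In Out G → NT false In Out (λ i → F i ++ G i)
sum {In = In} {Out} {F} {G} M N = record
  { finite-alphabet = finite-⊎ M.finite-alphabet N.finite-alphabet
  ; program = choose P Q
  ; deterministic = λ ()
  ; time = constant 1 ⊕ (M.time ⊕ N.time)
  ; run = λ {i} {w} h → let n = length w in
      subst (Run (choose P Q) (Final Out) _ _ _) (sym (time≡ n))
        (Run-choose
          (Run-weaken (λ _ k → k) (ℕₚ.m≤m+n _ (eval N.time n))
            (Run-lift (idL ×L fstL) {n = initialMemory _ w} (Run-recode-initial inj₁ fromInj₁ (λ _ → refl) {Out = Out} (M.run h))))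
          (Run-weaken (λ _ k → k) (ℕₚ.m≤n+m _ (eval M.time n))
            (Run-lift (idL ×L sndL) {n = initialMemory _ w} (Run-recode-initial inj₂ fromInj₂ (λ _ → refl) {Out = Out} (N.run h))))) }
  where
  module M = NT M
  module N = NT N
  A : Set
  A = M.Alphabet ⊎ N.Alphabet
  P Q : Program A (● ⊗ M.layout ⊗ N.layout)
  P = lift (idL ×L fstL) (recode inj₁ fromInj₁ M.program)
  Q = lift (idL ×L sndL) (recode inj₂ fromInj₂ N.program)
  time≡ : ∀ n → eval (constant 1 ⊕ (M.time ⊕ N.time)) n ≡ suc (eval M.time n + eval N.time n)
  time≡ n = trans (eval-⊕ (constant 1) (M.time ⊕ N.time) n) (cong₂ _+_ (eval-constant 1 n) (eval-⊕ M.time N.time n))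

-- Machines as programs

-- The parameter `accept` stands in for acceptance by `N`: FP asks only for halting, and there it is
-- constantly true.
module Import (N : TM) (accept : TM.State N → Bool) where

  open TM N renaming (State to Q; state-finite to Q-finite; start to q₀; δ to δN) hiding (accepting)

  Transition : Set
  Transition = Q × Vec (Symbol Aux × Move) tapes

  translate : Transition → Maybe Q × Action Aux (● ⊗ V extraTapes)
  translate (q , a ∷ as) = just q , (a , as)

  -- In a program the lack of transitions means rejection, so an accepting halt takes one more step,
  -- into the exit. This is the `suc` in the time bounds below.
  halting-exit : Bool → Heads Aux (● ⊗ V extraTapes) → List Transition → List (Maybe Q × Action Aux (● ⊗ V extraTapes))
  halting-exit true  ss []      = (nothing , keep (● ⊗ V extraTapes) ss) ∷ []
  halting-exit false ss []      = []
  halting-exit b     ss (r ∷ l) = map translate (r ∷ l)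

  imported : Program Aux (● ⊗ V extraTapes)
  imported = record
    { State = Q ; state-finite = Q-finite ; start = q₀
    ; δ = λ q ss → halting-exit (accept q) ss (δN q (proj₁ ss ∷ proj₂ ss)) }

  imported-deterministic : Deterministic → Deterministic-program imported
  imported-deterministic det q (s , ss) with accept q | δN q (s ∷ ss) | det q (s ∷ ss)
  ... | true  | []    | _ = ℕₚ.≤-refl
  ... | false | []    | _ = z≤n
  ... | true  | r ∷ l | h = ℕₚ.≤-trans (ℕₚ.≤-reflexive (Listₚ.length-map translate (r ∷ l))) h
  ... | false | r ∷ l | h = ℕₚ.≤-trans (ℕₚ.≤-reflexive (Listₚ.length-map translate (r ∷ l))) h

  memory : Vec (Tape Aux) tapes → Memory Aux (● ⊗ V extraTapes)
  memory (t ∷ v) = t , v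

  target : Vec (Tape Aux) tapes → Transition → Config
  target v (q , as) = config q (Vec.zipWith writeMove as v)

  module _ {J : Set} (Out : Encoding J) where

    exit-run : ∀ {r} q v → transitions (config q v) ≡ [] → accept q ≡ true → Out r (output (config q v)) →
               ∀ {t} → Run imported (Final Out) q (memory v) (r ∷ []) (suc t)
    exit-run {r} q (t ∷ v) e a o = one (exits e a) (act-keep (● ⊗ V extraTapes) (t , v)) (exit (r , refl , o))
      where
      exits : ∀ {l b ss} → l ≡ [] → b ≡ true → halting-exit b ss l ≡ (nothing , keep (● ⊗ V extraTapes) ss) ∷ []
      exits refl refl = refl

    reject-run : ∀ q v → transitions (config q v) ≡ [] → accept q ≡ false →
                 ∀ {t} → Run imported (Final Out) q (memory v) [] (suc t)
    reject-run q (t ∷ v) e a = step (subst (λ as → Nexts imported (Final Out) as (t , v) [] _) (sym (rejects e a)) [])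
      where
      rejects : ∀ {l b ss} → l ≡ [] → b ≡ false → halting-exit b ss l ≡ []
      rejects refl refl = refl

    node-run : ∀ q v {x l rs t} → transitions (config q v) ≡ x ∷ l →
               Nexts imported (Final Out) (map translate (x ∷ l)) (memory v) rs t →
               Run imported (Final Out) q (memory v) rs (suc t)
    node-run q (t ∷ v) {x} {l} e r = step (subst (λ as → Nexts imported (Final Out) as (t , v) _ _) (sym (continues (accept q) e)) r)
      where
      continues : ∀ {l′} b {ss} → l′ ≡ x ∷ l → halting-exit b ss l′ ≡ map translate (x ∷ l)
      continues true  refl = refl
      continues false refl = refl

    next-run : ∀ q as v {rs t} → Run imported (Final Out) q (memory (Vec.zipWith writeMove as v)) rs t →
               Next imported (Final Out) (proj₁ (translate (q , as))) (act (● ⊗ V extraTapes) (proj₂ (translate (q , as))) (memory v)) rs t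
    next-run q (a ∷ as) (t ∷ v) r = goto r

    path-run : ∀ {r} → Deterministic → (∀ q → accept q ≡ true) → ∀ {c c′} (π : c ⟶* c′) → Halting c′ → Out r (output c′) →
               Run imported (Final Out) (Config.state c) (memory (Config.content c)) (r ∷ []) (suc (steps π))
    path-run det all {config q v} ε h o = exit-run q v (map-[] h) (all q) o
      where
      map-[] : ∀ {X Y : Set} {f : X → Y} {xs : List X} → map f xs ≡ [] → xs ≡ []
      map-[] {xs = []} e = refl
    path-run det all {config q v} (_◅_ {j = c″} s π) h o with transitions (config q v) in e | s | det q (Vec.map Tape.scanned v)
    ... | (q′ , as) ∷ []    | here refl | _ =
      node-run q v e (next-run q′ as v (path-run det all π h o) ∷ [])
    ... | x ∷ y ∷ l         | _         | s≤s ()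

  module _ {J : Set} (Out : Encoding J) (r : J) (accept≡ : ∀ q → accept q ≡ TM.accepting N q) where

    outputs-r : Config → Set
    outputs-r c = ∀ (π : AcceptingFrom N c) → Out r (output (AcceptingFrom.end π))

    bounded : ℕ → Config → Set
    bounded t c = ∀ {c′} (π : c ⟶* c′) → steps π ≤ t

    Counted : ℕ → Config → Set
    Counted t c = ∃[ n ] Run imported (Final Out) (Config.state c) (memory (Config.content c)) (replicate n r) (suc t) ×
                         (AcceptingFrom N c ↔ Fin n)

    nexts-run : ∀ v l {t} → (∀ {x} → x ∈ l → Counted t (target v x)) →
                ∃[ n ] Nexts imported (Final Out) (map translate l) (memory v) (replicate n r) (suc t) ×
                       (Any (AcceptingFrom N) (map (target v) l) ↔ Fin n)
    nexts-run v []             h = 0 , [] , ↔-trans (↔-sym ⊥↔Any[]) (↔-sym Finₚ.0↔⊥)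
    nexts-run v ((q , as) ∷ l) h with h (here refl) | nexts-run v l (h ∘ there)
    ... | m , run₁ , e₁ | n , run₂ , e₂ =
      m + n ,
      subst (λ z → Nexts imported (Final Out) _ _ z _) (sym (replicate-+ m n r)) (next-run Out q as v run₁ ∷ run₂) ,
      ↔-trans (↔-sym (∷↔ (AcceptingFrom N))) (↔-trans (e₁ ⊎-↔ e₂) (↔-sym Finₚ.+↔⊎))

    -- The computation tree is not given as inductive data; recursion on the bound for the remaining
    -- paths supplies it. At bound zero a single transition would already be a path that is too
    -- long.
    counted-run : ∀ t c → bounded t c → outputs-r c → Counted t c
    counted-run t (config q v) b o with transitions (config q v) in e
    counted-run t (config q v) b o | [] with accept q in a
    ... | true  = 1 , exit-run Out q v e a (o (accepting-from ε (cong (map (target v)) e) accepted)) ,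
                  halted↔ N (config q v) (cong (map (target v)) e) accepted
      where
      accepted : T (TM.accepting N q)
      accepted = subst T (trans (sym a) (accept≡ q)) tt
    ... | false = 0 , reject-run Out q v e a ,
                  rejected↔ N (config q v) (cong (map (target v)) e) (subst T (trans (sym (accept≡ q)) a))
    counted-run zero (config q v) b o | x ∷ l
      with b (subst (target v x ∈_) (cong (map (target v)) (sym e)) (here refl) ◅ ε)
    ... | ()
    counted-run (suc t) (config q v) b o | x ∷ l with nexts-run v (x ∷ l) child
      where
      edge : ∀ {y} → y ∈ x ∷ l → config q v ⟶ target v y
      edge {y} y∈ = subst (target v y ∈_) (cong (map (target v)) (sym e)) (∈-map⁺ (target v) y∈)

      child : ∀ {y} → y ∈ x ∷ l → Counted t (target v y)
      child {y} y∈ = counted-run t (target v y) (λ π → s≤s⁻¹ (b (edge y∈ ◅ π)))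
                       (λ { (accepting-from π h a) → o (accepting-from (edge y∈ ◅ π) h a) })
    ... | n , run , e′ = n , node-run Out q v e run ,
      ↔-trans (acceptingFrom↔ N (config q v) (λ { (h , _) → nonempty (trans (sym (cong (map (target v)) e)) h) }))
        (subst (λ l′ → Any (AcceptingFrom N) l′ ↔ Fin n) (sym (cong (map (target v)) e)) e′)
      where
      nonempty : ¬ (target v x ∷ map (target v) l ≡ [])
      nonempty ()

-- The classes in terms of transductions

#P⇒NT : ∀ {f} → #P f → NT false ⟪ id ⟫ anyWord (λ x → replicate (f x) tt)
#P⇒NT {f} (M , count) = record
  { finite-alphabet = aux-finite ; program = imported ; deterministic = λ ()
  ; time = constant 1 ⊕ p
  ; run = λ { {x} refl → run x } }
  where
  open NPTM M hiding (State; start; δ)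
  open Import machine accepting
  p = proj₁ polynomialTime
  run : ∀ x → Run imported (Final anyWord) (start imported) (initialMemory (V extraTapes) x) (replicate (f x) tt) (eval (constant 1 ⊕ p) (length x))
  run x with counted-run anyWord tt (λ _ → refl) (eval p (length x)) (initial x) (proj₂ polynomialTime x) (λ _ → tt)
  ... | n , r , e = subst₂ (λ k t → Run imported (Final anyWord) (start imported) (initialMemory (V extraTapes) x) (replicate k tt) t)
    -- The number found by `counted-run` and `f x` count the same paths, and `Fin n ↔ Fin (f x)`
    -- forces them to be equal.
    (Perm.↔⇒≡ (↔-trans (↔-sym e) (↔-trans (↔-sym (acceptingPath↔ machine x)) (count x))))
    (sym (trans (eval-⊕ (constant 1) p (length x)) (cong (_+ eval p (length x)) (eval-constant 1 (length x))))) r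

UPSV⇒NT : ∀ {f} → UPSVₜ f → NT false ⟪ id ⟫ ⟪ binary ⟫ (λ x → f x ∷ [])
UPSV⇒NT {f} (M , single) = record
  { finite-alphabet = aux-finite ; program = imported ; deterministic = λ ()
  ; time = constant 1 ⊕ p
  ; run = λ { {x} refl → run x } }
  where
  open NPTM M hiding (State; start; δ)
  open Import machine accepting
  p = proj₁ polynomialTime
  run : ∀ x → Run imported (Final ⟪ binary ⟫) (start imported) (initialMemory (V extraTapes) x) (f x ∷ []) (eval (constant 1 ⊕ p) (length x))
  run x with counted-run ⟪ binary ⟫ (f x) (λ _ → refl) (eval p (length x)) (initial x) (proj₂ polynomialTime x)
               (λ π → proj₂ (single x) (Inverse.from (acceptingPath↔ machine x) π))
  ... | n , r , e = subst₂ (λ k t → Run imported (Final ⟪ binary ⟫) (start imported) (initialMemory (V extraTapes) x) (replicate k (f x)) t)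
    (Perm.↔⇒≡ (↔-trans (↔-sym e) (↔-trans (↔-sym (acceptingPath↔ machine x)) (proj₁ (single x)))))
    (sym (trans (eval-⊕ (constant 1) p (length x)) (cong (_+ eval p (length x)) (eval-constant 1 (length x))))) r

FP⇒NT : ∀ {f} → FP f → NT true ⟪ id ⟫ ⟪ binaryℤ ⟫ (λ x → f x ∷ [])
FP⇒NT {f} (M , det , computes) = record
  { finite-alphabet = aux-finite ; program = imported ; deterministic = λ _ → imported-deterministic det
  ; time = constant 1 ⊕ p
  ; run = λ { {x} refl → run x } }
  where
  open NPTM M hiding (State; start; δ)
  open Import machine (const true)
  p = proj₁ polynomialTime
  run : ∀ x → Run imported (Final ⟪ binaryℤ ⟫) (start imported) (initialMemory (V extraTapes) x) (f x ∷ []) (eval (constant 1 ⊕ p) (length x))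
  run x with computes x
  ... | c , π , halts , o = Run-weaken (λ _ k → k)
    (ℕₚ.≤-trans (s≤s (proj₂ polynomialTime x π))
      (ℕₚ.≤-reflexive (sym (trans (eval-⊕ (constant 1) p (length x)) (cong (_+ eval p (length x)) (eval-constant 1 (length x)))))))
    (path-run ⟪ binaryℤ ⟫ det (λ _ → refl) π halts o)

module Export {d J} {Out : Encoding J} {F : Word → List J} (M : NT d ⟪ id ⟫ Out F) where

  open NT M
  open Compile finite-alphabet program

  compiled-run : ∀ x → Run program (Final Out) (start program) (initialMemory layout x) (F x) (eval time (length x))
  compiled-run x = run refl

  compiled-NPTM : NPTM
  compiled-NPTM = record
    { machine = compiled
    ; polynomialTime = time , λ x π → bound x (initial-⌞⌟ x) π }
    where
    open TM compiled using (Config; _⟶*_; steps)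
    bound : ∀ x {c₀ c} → c₀ ≡ ⌞ just (start program) , initialMemory layout x ⌟ → (π : c₀ ⟶* c) → steps π ≤ eval time (length x)
    bound x refl π = steps-Run (compiled-run x) π

  accepting↔ : ∀ x → acc compiled-NPTM at x is length (F x)
  accepting↔ x = ↔-trans (acceptingPath↔ compiled x)
    (subst (λ c → AcceptingFrom compiled c ↔ Fin (length (F x))) (sym (initial-⌞⌟ x))
      (count-Run (λ { (r , refl , _) → refl }) (compiled-run x)))

  output∈ : ∀ x (π : AcceptingFrom compiled (TM.initial compiled x)) →
            ∃[ r ] r ∈ F x × Out r (TM.output compiled (AcceptingFrom.end π))
  output∈ x = from-initial (initial-⌞⌟ x)
    where
    from-initial : ∀ {c} → c ≡ ⌞ just (start program) , initialMemory layout x ⌟ → (π : AcceptingFrom compiled c) →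
                   ∃[ r ] r ∈ F x × Out r (TM.output compiled (AcceptingFrom.end π))
    from-initial refl = output-Run {Q = Out} (λ { (r , refl , o) → r , here refl , o }) (compiled-run x)

  compiled-deterministic : T d → NPTM.Deterministic compiled-NPTM
  compiled-deterministic h nothing  ss = z≤n
  compiled-deterministic h (just q) ss = ℕₚ.≤-trans (ℕₚ.≤-reflexive (Listₚ.length-map _ (δ program q _))) (deterministic h q _)

NT⇒#P : ∀ {d J f} {Out : Encoding J} {F : Word → List J} → NT d ⟪ id ⟫ Out F → (∀ x → length (F x) ≡ f x) → #P f
NT⇒#P M e = compiled-NPTM , λ x → subst (acc compiled-NPTM at x is_) (e x) (accepting↔ x)
  where open Export M

NT⇒UPSV : ∀ {d f} → NT d ⟪ id ⟫ ⟪ binary ⟫ (λ x → f x ∷ []) → UPSVₜ f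
NT⇒UPSV {f = f} M = compiled-NPTM , λ x → accepting↔ x , λ π → unique x (output∈ x (Inverse.to (acceptingPath↔ (NPTM.machine compiled-NPTM) x) π))
  where
  open Export M
  unique : ∀ x {w} → ∃[ r ] r ∈ f x ∷ [] × w ≡ binary r → w ≡ binary (f x)
  unique x (_ , here refl , e) = e

NT⇒FP : ∀ {f} → NT true ⟪ id ⟫ ⟪ binaryℤ ⟫ (λ x → f x ∷ []) → FP f
NT⇒FP {f} M = compiled-NPTM , compiled-deterministic tt , λ x →
  -- The list of results has length one, so the count itself provides the halting computation that
  -- FP asks for.
  let π = Inverse.from (accepting↔ x) 0F
  in AcceptingPath.end π , AcceptingPath.path π , AcceptingPath.halts π , unique x (output∈ x (Inverse.to (acceptingPath↔ (NPTM.machine compiled-NPTM) x) π))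
  where
  open Export M
  open NPTM compiled-NPTM using (module AcceptingPath)
  unique : ∀ x {w} → ∃[ r ] r ∈ f x ∷ [] × w ≡ binaryℤ r → w ≡ binaryℤ (f x)
  unique x (_ , here refl , e) = e

-- Elementary transductions

recast : ∀ {A σ} {P : Program A σ} {R : Set} {K : Memory A σ → List R → ℕ → Set} {q m m′ rs rs′ t t′} →
         m ≡ m′ → rs ≡ rs′ → t ≡ t′ → Run P K q m rs t → Run P K q m′ rs′ t′
recast refl refl refl r = r

recasts : ∀ {A σ} {P : Program A σ} {R : Set} {K : Memory A σ → List R → ℕ → Set} {as m rs rs′ t} →
          rs ≡ rs′ → Nexts P K as m rs t → Nexts P K as m rs′ t
recasts refl r = r

Final₁ : ∀ {A J} → Encoding J → Tape A → List J → ℕ → Set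
Final₁ Out t rs _ = ∃[ r ] rs ≡ r ∷ [] × Out r (tapeWord t)

one-tape : ∀ {d I J} {In : Encoding I} {Out : Encoding J} {F : I → List J} (P : Program ⊥ ●) →
           (T d → Deterministic-program P) → (p : Polynomial) →
           (∀ {i w} → In i w → Run P (Final₁ Out) (start P) (inputTape w) (F i) (eval p (length w))) → NT d In Out F
one-tape P det p r = record
  { finite-alphabet = finite-⊥ ; layout = V 0 ; program = lift fstL P
  ; deterministic = λ h → lift-deterministic fstL P (det h) ; time = p
  ; run = λ {i} {w} h → Run-lift fstL {n = initialMemory (V 0) w} (r h) }

single : ∀ {A σ k} → (Fin (suc k) → Heads A σ → Maybe (Fin (suc k)) × Action A σ) → Program A σ
single {k = k} f = record { State = Fin (suc k) ; state-finite = finite-Fin (suc k) ; start = zero ; δ = λ q ss → f q ss ∷ [] }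

prependδ : Bool → Fin 2 → Symbol ⊥ → Maybe (Fin 2) × (Symbol ⊥ × Move)
prependδ b 0F s = just 1F , s , left
prependδ b 1F s = nothing , bit b , stay

prepend : ∀ {I} (e : I → Word) b → NT true ⟪ e ⟫ ⟪ (λ i → b ∷ e i) ⟫ (λ i → i ∷ [])
prepend e b = one-tape (single (prependδ b)) (λ _ _ _ → ℕₚ.≤-refl) (constant 2) λ { {i} refl → prepend-run i (e i) refl }
  where
  prepend-run : ∀ i w → w ≡ e i → Run (single (prependδ b)) (Final₁ ⟪ (λ i → b ∷ e i) ⟫) 0F (inputTape w) (i ∷ []) (eval (constant 2) (length w))
  prepend-run i []      h rewrite eval-constant 2 0 = one refl refl (goto (one refl refl (exit (i , refl , cong (b ∷_) h))))
  prepend-run i (c ∷ w) h rewrite eval-constant 2 (length (c ∷ w)) =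
    one refl refl (goto (one refl refl (exit (i , refl , cong (b ∷_) (trans (cong (c ∷_) (leadingBits-bits w)) h)))))

dropFirst : ∀ {I} (b : I → Bool) (e : I → Word) → NT true ⟪ (λ i → b i ∷ e i) ⟫ ⟪ e ⟫ (λ i → i ∷ [])
dropFirst b e = one-tape (single {k = 0} λ _ s → nothing , s , right) (λ _ _ _ → ℕₚ.≤-refl) (constant 1)
  λ { {i} refl → recast refl refl (sym (eval-constant 1 (length (b i ∷ e i))))
        (one refl (move-right [] (bit (b i)) (map bit (e i)))
          (exit (i , refl , trans (tapeWord-at _ (map bit (e i))) (leadingBits-bits (e i))))) }

unit : ∀ {I} {In : Encoding I} → NT false In anyWord (λ i → tt ∷ [])
unit = one-tape (single {k = 0} λ _ s → nothing , s , stay) (λ ()) (constant 1)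
  λ { {i} {w} h → recast refl refl (sym (eval-constant 1 (length w))) (one refl refl (exit (tt , refl , tt))) }

units : ∀ {rs rs′ : List ⊤} → length rs ≡ length rs′ → rs ≡ rs′
units {[]}     {[]}     e = refl
units {_ ∷ rs} {_ ∷ rs′} e = cong (tt ∷_) (units (ℕₚ.suc-injective e))

-- A path guesses a word below the given one, bit by bit: state 0 while the two
-- agree, state 1 once the guess is smaller.
belowδ : Fin 3 → Symbol ⊥ → List (Maybe (Fin 3) × (Symbol ⊥ × Move))
belowδ 0F (bit true)  = (just 1F , bit true , right) ∷ (just 0F , bit true , right) ∷ []
belowδ 0F (bit false) = (just 0F , bit false , right) ∷ []
belowδ 0F _           = []
belowδ 1F (bit b)     = (just 1F , bit b , right) ∷ (just 1F , bit b , right) ∷ []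
belowδ 1F s           = (nothing , s , stay) ∷ []
belowδ 2F (bit false) = (nothing , bit false , stay) ∷ (just 0F , bit false , right) ∷ []
belowδ 2F _           = []

below : Fin 3 → Program ⊥ ●
below q = record { State = Fin 3 ; state-finite = finite-Fin 3 ; start = q ; δ = belowδ }

module _ {q₀ : Fin 3} where

  free-run : ∀ ls w → Run (below q₀) (Final₁ anyWord) 1F (at ls (map bit w)) (replicate (2 ^ length w) tt) (suc (length w))
  free-run ls []      = one refl refl (exit (tt , refl , tt))
  free-run ls (b ∷ w) = step (recasts (units len) (goto next ∷ goto next ∷ []))
    where
    next = recast (sym (move-right ls (bit b) (map bit w))) refl refl (free-run (bit b ∷ ls) w)
    n = 2 ^ length w
    len : length (replicate n tt ++ replicate n tt ++ []) ≡ length (replicate (n + (n + 0)) tt)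
    len rewrite Listₚ.length-++ (replicate n tt) {replicate n tt ++ []} | Listₚ.length-++ (replicate n tt) {[]}
              | Listₚ.length-replicate n {tt} | Listₚ.length-replicate (n + (n + 0)) {tt} = refl

  -- At a one, guessing zero frees all remaining bits and contributes `2 ^ length w` paths. A guess
  -- that agrees up to the end is not smaller and dies there.
  tight-run : ∀ ls w → Run (below q₀) (Final₁ anyWord) 0F (at ls (map bit w)) (replicate (value w) tt) (suc (length w))
  tight-run ls []          = step []
  tight-run ls (false ∷ w) = one refl (move-right ls (bit false) (map bit w)) (goto (tight-run (bit false ∷ ls) w))
  tight-run ls (true ∷ w)  = step (recasts (units len)
    (goto (recast (sym (move-right ls (bit true) (map bit w))) refl refl (free-run (bit true ∷ ls) w)) ∷
     goto (recast (sym (move-right ls (bit true) (map bit w))) refl refl (tight-run (bit true ∷ ls) w)) ∷ []))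
    where
    n = 2 ^ length w
    len : length (replicate n tt ++ replicate (value w) tt ++ []) ≡ length (replicate (value (true ∷ w)) tt)
    len rewrite value-∷ true w
              | Listₚ.length-++ (replicate n tt) {replicate (value w) tt ++ []} | Listₚ.length-++ (replicate (value w) tt) {[]}
              | Listₚ.length-replicate n {tt} | Listₚ.length-replicate (value w) {tt}
              | Listₚ.length-replicate (n + 0 + value w) {tt} | ℕₚ.+-identityʳ (value w) | ℕₚ.+-identityʳ n = refl

eval-suc : ∀ n → eval (constant 1 ⊕ identity) n ≡ suc n
eval-suc n = trans (eval-⊕ (constant 1) identity n) (cong₂ _+_ (eval-constant 1 n) (eval-identity n))

countBelow : NT false ⟪ binary ⟫ anyWord (λ n → replicate n tt)
countBelow = one-tape (below 0F) (λ ()) (constant 1 ⊕ identity) λ { {n} refl →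
  recast (sym (inputTape≡at (binary n))) (cong (λ k → replicate k tt) (value-binary n)) (sym (eval-suc (length (binary n))))
    (tight-run [] (binary n)) }

-- This is max(z + 1, 0): it turns the condition m > z over ℤ, for natural m, into
-- `successor⁺ z ≤ m` over ℕ.
successor⁺ : ℤ → ℕ
successor⁺ (ℤ.+ n)    = suc n
successor⁺ ℤ.-[1+ n ] = 0

-- State 2 reads the sign. A negative number has no path; otherwise one path stops at once, for the
-- added 1, and the other goes on to count the numbers below.
countBelowℤ : NT false ⟪ binaryℤ ⟫ anyWord (λ z → replicate (successor⁺ z) tt)
countBelowℤ = one-tape (below 2F) (λ ()) (constant 1 ⊕ identity) λ { {z} refl →
  recast (sym (inputTape≡at (binaryℤ z))) refl (sym (eval-suc (length (binaryℤ z)))) (sign-run z) }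
  where
  sign-run : ∀ z → Run (below 2F) (Final₁ anyWord) 2F (at [] (map bit (binaryℤ z))) (replicate (successor⁺ z) tt) (suc (length (binaryℤ z)))
  sign-run ℤ.-[1+ n ] = step []
  sign-run (ℤ.+ n)    = step (exit (tt , refl , tt) ∷ recasts (Listₚ.++-identityʳ _)
    (goto (recast (sym (move-right [] (bit false) (map bit (binary n)))) (cong (λ k → replicate k tt) (value-binary n)) refl (tight-run (bit false ∷ []) (binary n))) ∷ []))

secondSymbol : Word → Symbol ⊥
secondSymbol (a ∷ b ∷ w) = bit b
secondSymbol _           = blank

-- The answer, a sign and one bit, is written from the second cell on, and a blank behind it ends
-- the output word. Therefore five steps suffice for every input.
inspectδ : (Symbol ⊥ → Bool) → Fin 5 × Bool → Symbol ⊥ → Maybe (Fin 5 × Bool) × (Symbol ⊥ × Move)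
inspectδ d (0F , b) s = just (1F , b) , s , right
inspectδ d (1F , b) s = just (2F , d s) , bit false , right
inspectδ d (2F , b) s = just (3F , b) , bit b , right
inspectδ d (3F , b) s = just (4F , b) , blank , left
inspectδ d (4F , b) s = nothing , s , left

inspectSecond : (d : Symbol ⊥ → Bool) → NT true ⟪ id ⟫ ⟪ binaryℤ ⟫ (λ w → ℤ.+ bitValue (d (secondSymbol w)) ∷ [])
inspectSecond d = one-tape P (λ _ _ _ → ℕₚ.≤-refl) (constant 5)
  λ { {w} refl → recast refl refl (sym (eval-constant 5 (length w))) (inspect-run w) }
  where
  P : Program ⊥ ●
  P = record { State = Fin 5 × Bool ; state-finite = finite-× (finite-Fin 5) finite-Bool ; start = 0F , false
             ; δ = λ q s → inspectδ d q s ∷ [] }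

  written : ∀ b → false ∷ b ∷ [] ≡ binaryℤ (ℤ.+ bitValue b)
  written false = refl
  written true  = refl

  inspect-run : ∀ w → Run P (Final₁ ⟪ binaryℤ ⟫) (start P) (inputTape w) (ℤ.+ bitValue (d (secondSymbol w)) ∷ []) 5
  inspect-run []                  = one refl refl (goto (one refl refl (goto (one refl refl (goto (one refl refl (goto (one refl refl (exit (_ , refl , written _))))))))))
  inspect-run (_ ∷ [])            = one refl refl (goto (one refl refl (goto (one refl refl (goto (one refl refl (goto (one refl refl (exit (_ , refl , written _))))))))))
  inspect-run (_ ∷ _ ∷ [])        = one refl refl (goto (one refl refl (goto (one refl refl (goto (one refl refl (goto (one refl refl (exit (_ , refl , written _))))))))))
  inspect-run (_ ∷ _ ∷ _ ∷ [])    = one refl refl (goto (one refl refl (goto (one refl refl (goto (one refl refl (goto (one refl refl (exit (_ , refl , written _))))))))))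
  inspect-run (_ ∷ _ ∷ _ ∷ _ ∷ w) = one refl refl (goto (one refl refl (goto (one refl refl (goto (one refl refl (goto (one refl refl (exit (_ , refl , written _))))))))))

-- A self-delimiting code: a 1 announces each bit of the first word and a 0 ends it. A clock with an
-- even number of ones already has this form, so guessing the first word needs no cells to be moved.
flagged : Word → Word
flagged []      = []
flagged (b ∷ u) = true ∷ b ∷ flagged u

pair : Word × Word → Word
pair (u , x) = flagged u ++ false ∷ x

-- Total, because the languages in PP to be formed later have to be defined on all words; on words
-- that encode no pair the values follow what the machines do there.
unpair₁ : Word → Word
unpair₁ (true ∷ b ∷ w) = b ∷ unpair₁ w
unpair₁ _              = []

unpair₂ : Word → Word
unpair₂ (true ∷ b ∷ w) = unpair₂ w
unpair₂ (false ∷ x)    = x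
unpair₂ _              = []

unpair₁-pair : ∀ u x → unpair₁ (pair (u , x)) ≡ u
unpair₁-pair []      x = refl
unpair₁-pair (b ∷ u) x = cong (b ∷_) (unpair₁-pair u x)

unpair₂-pair : ∀ u x → unpair₂ (pair (u , x)) ≡ x
unpair₂-pair []      x = refl
unpair₂-pair (b ∷ u) x = unpair₂-pair u x

secondδ : Fin 2 → Symbol ⊥ → Maybe (Fin 2) × (Symbol ⊥ × Move)
secondδ 0F (bit true)  = just 1F , bit true , right
secondδ 0F (bit false) = nothing , bit false , right
secondδ 0F s           = nothing , s , stay
secondδ 1F (bit b)     = just 0F , bit b , right
secondδ 1F s           = nothing , s , stay

secondWord : NT true ⟪ id ⟫ ⟪ id ⟫ (λ y → unpair₂ y ∷ [])
secondWord = one-tape (single secondδ) (λ _ _ _ → ℕₚ.≤-refl) (constant 1 ⊕ identity)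
  λ { {y} refl → recast (sym (inputTape≡at y)) refl (sym (eval-suc (length y))) (second-word-run [] y) }
  where
  second-word-run : ∀ ls y → Run (single secondδ) (Final₁ ⟪ id ⟫) 0F (at ls (map bit y)) (unpair₂ y ∷ []) (suc (length y))
  second-word-run ls []             = one refl refl (exit ([] , refl , refl))
  second-word-run ls (false ∷ x)    = one refl (move-right ls (bit false) (map bit x)) (exit (x , refl , trans (tapeWord-at _ (map bit x)) (leadingBits-bits x)))
  second-word-run ls (true ∷ [])    = one refl refl (goto (one refl refl (exit ([] , refl , refl))))
  second-word-run ls (true ∷ b ∷ y) = one refl refl (goto (one refl (move-right _ (bit b) (map bit y)) (goto (second-word-run _ y))))

leftOf-left : ∀ {A} (s : Symbol A) ls rs → ∃[ ls′ ] writeMove (s , left) (leftOf ls rs) ≡ leftOf ls′ (s ∷ rs)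
leftOf-left s []       rs = [] , refl
leftOf-left s (l ∷ ls) rs = ls , move-left ls s rs

-- The number after the flags, without leading zeros, is collected on the second tape
-- and then copied back leftwards, which needs no rewinding.
firstδ : Fin 3 × Bool → Symbol ⊥ × Symbol ⊥ → Maybe (Fin 3 × Bool) × Action ⊥ (● ⊗ ●)
firstδ (0F , seen)  (bit true , y) = just (1F , seen) , (bit true , right) , (y , stay)
firstδ (0F , true)  (x , y)        = just (2F , true) , (blank , left) , (y , left)
firstδ (0F , false) (x , y)        = just (2F , true) , (blank , left) , (bit false , stay)
firstδ (1F , true)  (bit b , y)    = just (0F , true) , (bit b , right) , (bit b , right)
firstδ (1F , false) (bit true , y) = just (0F , true) , (bit true , right) , (bit true , right)
firstδ (1F , false) (bit false , y) = just (0F , false) , (bit false , right) , (y , stay)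
firstδ (1F , true)  (x , y)        = just (2F , true) , (blank , left) , (y , left)
firstδ (1F , false) (x , y)        = just (2F , true) , (blank , left) , (bit false , stay)
firstδ (2F , _)     (x , bit b)    = just (2F , true) , (bit b , left) , (bit b , left)
firstδ (2F , _)     (x , y)        = nothing , (bit false , stay) , (y , stay)

firstValue : NT true ⟪ id ⟫ ⟪ binaryℤ ⟫ (λ y → ℤ.+ value (unpair₁ y) ∷ [])
firstValue = record
  { finite-alphabet = finite-⊥ ; layout = ● ; program = P
  ; deterministic = λ _ _ _ → ℕₚ.≤-refl
  ; time = constant 3 ⊕ scale 2 identity
  ; run = λ { {y} refl → recast (cong (_, blankTape) (sym (inputTape≡at y))) refl (sym (time≡ (length y)))
      (unseen-run [] y (cong (false ∷_) (binary-value (unpair₁ y))) ℕₚ.≤-refl) } }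
  where
  P : Program ⊥ (● ⊗ ●)
  P = record { State = Fin 3 × Bool ; state-finite = finite-× (finite-Fin 3) finite-Bool ; start = 0F , false
             ; δ = λ q ss → firstδ q ss ∷ [] }

  time≡ : ∀ n → eval (constant 3 ⊕ scale 2 identity) n ≡ 3 + 2 * n
  time≡ n = trans (eval-⊕ (constant 3) (scale 2 identity) n)
    (cong₂ _+_ (eval-constant 3 n) (trans (eval-scale 2 identity n) (cong (2 *_) (eval-identity n))))

  module _ {r : ℤ} where

    K : Memory ⊥ (● ⊗ ●) → List ℤ → ℕ → Set
    K = Final ⟪ binaryℤ ⟫

    -- `acc` holds the bits still to be copied, last one first, and `out` those already written in
    -- front of the blank that ends the output; the last step adds the sign.
    back-run : ∀ ls acc out junk r₁ {t} → binaryℤ r ≡ false ∷ (acc ʳ++ out) → length acc < t →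
               Run P K (2F , true) (leftOf ls (map bit out ++ blank ∷ junk) , leftOf (map bit acc) r₁) (r ∷ []) t
    back-run [] [] out junk r₁ e (s≤s h)       = one refl refl (exit (r , refl , trans (cong (false ∷_) (leadingBits-word out junk)) (sym e)))
    back-run (_ ∷ ls) [] out junk r₁ e (s≤s h) = one refl refl (exit (r , refl , trans (cong (false ∷_) (leadingBits-word out junk)) (sym e)))
    back-run ls (b ∷ acc) out junk r₁ e (s≤s h) with leftOf-left (bit b) ls (map bit out ++ blank ∷ junk)
    ... | ls′ , e′ = one refl (cong₂ _,_ e′ (move-left (map bit acc) (bit b) r₁)) (goto (back-run ls′ acc (b ∷ out) junk _ e h))

    end-write : ∀ ls (rs : List (Symbol ⊥)) → ∃[ junk ] writeMove (blank , left) (at ls rs) ≡ leftOf ls (blank ∷ junk)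
    end-write ls []       = [] , move-left ls blank []
    end-write ls (s ∷ rs) = rs , move-left ls blank rs

    finish-seen : ∀ q ls rs acc {t} → firstδ (q , true) (Tape.scanned (at ls rs) , blank) ≡ (just (2F , true) , (blank , left) , (blank , left)) →
                  binaryℤ r ≡ false ∷ (acc ʳ++ []) → suc (length acc) < t →
                  Run P K (q , true) (at ls rs , at (map bit acc) []) (r ∷ []) t
    finish-seen q ls rs acc δ≡ e (s≤s h) with end-write ls rs
    ... | junk , e′ = one (cong (_∷ []) δ≡) (cong₂ _,_ e′ (move-left (map bit acc) blank [])) (goto (back-run ls acc [] junk _ e h))

    -- Without a single one the value is zero, whose numeral is `0` and not the empty word, so a
    -- digit is placed on the second tape first.
    finish-unseen : ∀ q ls rs {t} → firstδ (q , false) (Tape.scanned (at ls rs) , blank) ≡ (just (2F , true) , (blank , left) , (bit false , stay)) →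
                  binaryℤ r ≡ false ∷ false ∷ [] → 2 < t →
                  Run P K (q , false) (at ls rs , blankTape) (r ∷ []) t
    finish-unseen q ls rs δ≡ e (s≤s h) with end-write ls rs
    ... | junk , e′ = one (cong (_∷ []) δ≡) (cong (_, _) e′) (goto (back-run ls (false ∷ []) [] junk [] e h))

    seen-run : ∀ ls y acc {t} → binaryℤ r ≡ false ∷ (acc ʳ++ unpair₁ y) → length acc + 2 * length y < t →
               Run P K (0F , true) (at ls (map bit y) , at (map bit acc) []) (r ∷ []) (suc t)
    seen-run ls [] acc e h = finish-seen 0F ls [] acc refl e (s≤s (subst (_< _) (ℕₚ.+-identityʳ _) h))
    seen-run ls (false ∷ y) acc e h =
      finish-seen 0F ls (bit false ∷ map bit y) acc refl e (s≤s (ℕₚ.≤-trans (s≤s (ℕₚ.m≤m+n _ _)) h))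
    seen-run ls (true ∷ []) acc e h =
      one refl refl (goto (finish-seen 1F (bit true ∷ ls) [] acc refl e (ℕₚ.≤-trans (ℕₚ.≤-reflexive (lem (length acc))) (ℕₚ.≤-trans (ℕₚ.n≤1+n _) h))))
      where
      lem : ∀ a → suc (suc a) ≡ a + 2
      lem = solve-∀
    seen-run ls (true ∷ b ∷ y) acc e h with ℕₚ.≤-trans (ℕₚ.≤-reflexive (lem (length acc) (length y))) h
      where
      lem : ∀ a n → 2 + (3 + (a + 2 * n)) ≡ suc (a + 2 * (2 + n))
      lem = solve-∀
    ... | s≤s (s≤s h′) =
      one refl refl (goto (one refl (cong (_, _) (move-right (bit true ∷ ls) (bit b) (map bit y)))
        (goto (seen-run (bit b ∷ bit true ∷ ls) y (b ∷ acc) e (ℕₚ.≤-trans (ℕₚ.n≤1+n _) h′)))))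

    unseen-run : ∀ ls y {t} → binaryℤ r ≡ false ∷ strip (unpair₁ y) → 3 + 2 * length y ≤ t →
                 Run P K (0F , false) (at ls (map bit y) , blankTape) (r ∷ []) t
    unseen-run ls [] e h              = finish-unseen 0F ls [] refl e h
    unseen-run ls (false ∷ y) e h     = finish-unseen 0F ls (bit false ∷ map bit y) refl e (ℕₚ.≤-trans (ℕₚ.m≤m+n 3 _) h)
    unseen-run ls (true ∷ []) e (s≤s h) =
      one refl refl (goto (finish-unseen 1F (bit true ∷ ls) [] refl e (ℕₚ.≤-trans (ℕₚ.n≤1+n 3) h)))
    unseen-run ls (true ∷ b ∷ y) e h with ℕₚ.≤-trans (ℕₚ.≤-reflexive (lem (length y))) h
      where
      lem : ∀ n → 3 + (4 + 2 * n) ≡ 3 + 2 * (2 + n)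
      lem = solve-∀
    unseen-run ls (true ∷ true ∷ y) e h | s≤s (s≤s (s≤s h′)) =
      one refl refl (goto (one refl (cong (_, _) (move-right (bit true ∷ ls) (bit true) (map bit y)))
        (goto (seen-run (bit true ∷ bit true ∷ ls) y (true ∷ []) e (ℕₚ.≤-trans (ℕₚ.m≤n+m _ 2) h′)))))
    unseen-run ls (true ∷ false ∷ y) e h | s≤s (s≤s h′) =
      one refl refl (goto (one refl (cong (_, _) (move-right (bit true ∷ ls) (bit false) (map bit y)))
        (goto (unseen-run (bit false ∷ bit true ∷ ls) y e (ℕₚ.≤-trans (s≤s (s≤s (s≤s (ℕₚ.m≤n+m _ 2)))) h′)))))

-- Unary clocks

trues : ℕ → Word
trues n = replicate n true

clockWord : Polynomial → Word → Word
clockWord p x = trues (eval p (length x)) ++ false ∷ x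

length-clockWord : ∀ p x → length (clockWord p x) ≡ eval p (length x) + suc (length x)
length-clockWord p x = trans (Listₚ.length-++ (trues (eval p (length x)))) (cong (_+ suc (length x)) (Listₚ.length-replicate _))

clock≤length : ∀ p x → eval p (length x) ≤ length (clockWord p x)
clock≤length p x = ℕₚ.≤-trans (ℕₚ.m≤m+n _ (suc (length x))) (ℕₚ.≤-reflexive (sym (length-clockWord p x)))

words : ℕ → List Word
words zero    = [] ∷ []
words (suc k) = map (false ∷_) (words k) ++ map (true ∷_) (words k)

guessδ : Fin 3 → Symbol ⊥ → List (Maybe (Fin 3) × (Symbol ⊥ × Move))
guessδ 0F (bit true) = (just 1F , bit true , right) ∷ []
guessδ 0F s          = (just 2F , s , left) ∷ []
guessδ 1F s          = (just 0F , bit false , right) ∷ (just 0F , bit true , right) ∷ []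
guessδ 2F (bit b)    = (just 2F , bit b , left) ∷ []
guessδ 2F s          = (nothing , s , right) ∷ []

-- Every second bit of the clock is replaced by a guess.
guessWord : ∀ p → NT false ⟪ clockWord (scale 2 p) ⟫ ⟪ pair ⟫ (λ x → map (_, x) (words (eval p (length x))))
guessWord p = one-tape P (λ ()) copyPoly λ { {x} refl → let k = eval p (length x) in
    recast (sym (trans (inputTape≡at _) (cong (at [] ∘ map bit) (clock≡ x)))) refl (sym (eval-copyPoly (length (clockWord (scale 2 p) x))))
      (Run-weaken (λ _ k → k) (time≤ x) (guess-run x k [] [] (λ _ → refl))) }
  where
  P : Program ⊥ ●
  P = record { State = Fin 3 ; state-finite = finite-Fin 3 ; start = 0F ; δ = guessδ }

  double : ℕ → ℕ
  double zero    = zero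
  double (suc k) = suc (suc (double k))

  double≡ : ∀ k → 2 * k ≡ double k
  double≡ zero    = refl
  double≡ (suc k) = cong suc (trans (ℕₚ.+-suc k (k + 0)) (cong suc (double≡ k)))

  clock≡ : ∀ x → clockWord (scale 2 p) x ≡ trues (double (eval p (length x))) ++ false ∷ x
  clock≡ x = cong (λ n → trues n ++ false ∷ x) (trans (eval-scale 2 p (length x)) (double≡ (eval p (length x))))

  guessTime : ℕ → ℕ → ℕ
  guessTime zero    d = suc (suc d)
  guessTime (suc k) d = suc (suc (guessTime k (suc (suc d))))

  time≤ : ∀ x → guessTime (eval p (length x)) 0 ≤ 2 + 2 * length (clockWord (scale 2 p) x)
  time≤ x = ℕₚ.≤-trans (ℕₚ.≤-reflexive (guessTime≡ (eval p (length x)) 0))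
    (s≤s (s≤s (ℕₚ.≤-trans (ℕₚ.≤-reflexive (ℕₚ.+-identityʳ _))
      (ℕₚ.*-monoʳ-≤ 2 (ℕₚ.≤-trans (ℕₚ.≤-reflexive (sym (eval-scale 2 p (length x)))) (clock≤length (scale 2 p) x))))))
    where
    guessTime≡ : ∀ k d → guessTime k d ≡ 2 + (2 * (2 * k) + d)
    guessTime≡ zero    d = refl
    guessTime≡ (suc k) d rewrite guessTime≡ k (suc (suc d)) = lem k d
      where
      lem : ∀ k d → 4 + (2 * (2 * k) + (2 + d)) ≡ 2 + (2 * (2 * suc k) + d)
      lem = solve-∀

  flagged-snoc : ∀ u b z → flagged (u ++ b ∷ []) ++ z ≡ flagged u ++ true ∷ b ∷ z
  flagged-snoc []      b z = refl
  flagged-snoc (c ∷ u) b z = cong (λ v → true ∷ c ∷ v) (flagged-snoc u b z)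

  K : Tape ⊥ → List (Word × Word) → ℕ → Set
  K = Final₁ ⟪ pair ⟫

  rewind-run : ∀ acc z {r t} → pair r ≡ acc ʳ++ z →
               Run P K 2F (leftOf (map bit acc) (map bit z)) (r ∷ []) (suc (length acc + t))
  rewind-run []        z {r} e = one refl (leftOf-right [] (map bit z))
    (exit (r , refl , trans (tapeWord-at (blank ∷ []) (map bit z)) (trans (leadingBits-bits z) (sym e))))
  rewind-run (b ∷ acc) z e = one refl (move-left (map bit acc) (bit b) (map bit z)) (goto (rewind-run acc (b ∷ z) e))

  guess-run : ∀ x k (acc u : Word) → (∀ z → acc ʳ++ z ≡ flagged u ++ z) →
              Run P K 0F (at (map bit acc) (map bit (trues (double k) ++ false ∷ x)))
                (map (λ v → u ++ v , x) (words k)) (guessTime k (length acc))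
  guess-run x zero acc u inv =
    one refl (move-left (map bit acc) (bit false) (map bit x))
      (goto (recast refl (cong (λ v → (v , x) ∷ []) (sym (Listₚ.++-identityʳ u))) (cong suc (ℕₚ.+-identityʳ _))
        (rewind-run acc (false ∷ x) {t = 0} (sym (inv (false ∷ x))))))
  guess-run x (suc k) acc u inv =
    one refl refl (goto (step (recasts results≡ (branch false ∷ branch true ∷ []))))
    where
    branch : ∀ b → Next P K (just 0F) (act ● (bit b , right) (tape (bit true ∷ map bit acc) (bit true) (map bit (trues (double k) ++ false ∷ x))))
                     (map (λ v → (u ++ b ∷ []) ++ v , x) (words k)) _
    branch b = goto (recast (sym (move-right (bit true ∷ map bit acc) (bit b) (map bit (trues (double k) ++ false ∷ x)))) refl refl
      (guess-run x k (b ∷ true ∷ acc) (u ++ b ∷ [])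
        (λ z → trans (inv (true ∷ b ∷ z)) (sym (flagged-snoc u b z)))))

    prefixed : ∀ b → map (λ v → (u ++ b ∷ []) ++ v , x) (words k) ≡ map (λ v → u ++ v , x) (map (b ∷_) (words k))
    prefixed b = trans (Listₚ.map-cong (λ v → cong (_, x) (Listₚ.++-assoc u (b ∷ []) v)) (words k)) (Listₚ.map-∘ (words k))

    results≡ : map (λ v → (u ++ false ∷ []) ++ v , x) (words k) ++ map (λ v → (u ++ true ∷ []) ++ v , x) (words k) ++ [] ≡
               map (λ v → u ++ v , x) (words (suc k))
    results≡ = trans (cong₂ _++_ (prefixed false) (trans (Listₚ.++-identityʳ _) (prefixed true)))
                 (sym (Listₚ.map-++ (λ v → u ++ v , x) (map (false ∷_) (words k)) (map (true ∷_) (words k))))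

onesδ : Fin 2 → Symbol ⊥ → Maybe (Fin 2) × (Symbol ⊥ × Move)
onesδ 0F (bit true) = just 0F , bit true , right
onesδ 0F s          = just 1F , blank , left
onesδ 1F (bit b)    = just 1F , bit b , left
onesδ 1F s          = nothing , bit false , stay

-- The ones of a clock word are the binary numeral of 2^T - 1.
clockValue : ∀ p → (∀ n → 1 ≤ eval p n) → NT true ⟪ clockWord p ⟫ ⟪ binaryℤ ⟫ (λ x → ℤ.+ value (trues (eval p (length x))) ∷ [])
clockValue p p≥1 = one-tape (single onesδ) (λ _ _ _ → ℕₚ.≤-refl) copyPoly λ { {x} refl →
    recast (sym (inputTape≡at _)) refl (sym (eval-copyPoly (length (clockWord p x))))
      (Run-weaken (λ _ k → k) (time≤ x) (forward-run x (eval p (length x)) 0 (sym (trans (word≡ x) (cong (λ k → false ∷ trues k) (sym (ℕₚ.+-identityʳ _))))))) }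
  where
  K : Tape ⊥ → List ℤ → ℕ → Set
  K = Final₁ ⟪ binaryℤ ⟫

  -- With no ones at all the empty word would stand where the numeral `0` is due; hence the
  -- hypothesis `p≥1`.
  strip-trues : ∀ n → 1 ≤ n → strip (trues n) ≡ trues n
  strip-trues (suc n) _ = refl

  word≡ : ∀ x → binaryℤ (ℤ.+ value (trues (eval p (length x)))) ≡ false ∷ trues (eval p (length x))
  word≡ x = cong (false ∷_) (trans (binary-value (trues (eval p (length x)))) (strip-trues _ (p≥1 (length x))))

  back-run : ∀ m k rs {r t} → false ∷ trues (m + k) ≡ binaryℤ r →
             Run (single onesδ) K 1F (leftOf (map bit (trues m)) (map bit (trues k) ++ blank ∷ rs)) (r ∷ []) (suc (m + t))
  back-run zero    k rs {r} e = one refl refl (exit (r , refl , trans (cong (false ∷_) (leadingBits-word (trues k) rs)) e))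
  back-run (suc m) k rs     e = one refl (move-left (map bit (trues m)) (bit true) _)
    (goto (back-run m (suc k) rs (trans (cong (λ n → false ∷ trues n) (ℕₚ.+-suc m k)) e)))

  forward-run : ∀ x n m {r} → false ∷ trues (n + m) ≡ binaryℤ r →
                Run (single onesδ) K 0F (at (map bit (trues m)) (map bit (trues n ++ false ∷ x))) (r ∷ []) (suc (suc (n + n + m)))
  forward-run x zero    m e = one refl (move-left (map bit (trues m)) blank (map bit x))
    (goto (recast refl refl (cong suc (ℕₚ.+-identityʳ m)) (back-run m 0 (map bit x) {t = 0} (trans (cong (λ k → false ∷ trues k) (ℕₚ.+-identityʳ m)) e))))
  forward-run x (suc n) m e = one refl (move-right (map bit (trues m)) (bit true) (map bit (trues n ++ false ∷ x)))
    (goto (recast refl refl (cong (2 +_) (lem n m)) (forward-run x n (suc m) (trans (cong (λ k → false ∷ trues k) (ℕₚ.+-suc n m)) e))))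
    where
    lem : ∀ n m → n + n + suc m ≡ n + suc n + m
    lem = solve-∀

  time≤ : ∀ x → suc (suc (eval p (length x) + eval p (length x) + 0)) ≤ 2 + 2 * length (clockWord p x)
  time≤ x = s≤s (s≤s (ℕₚ.≤-trans (ℕₚ.≤-reflexive (lem (eval p (length x))))
    (ℕₚ.*-monoʳ-≤ 2 (clock≤length p x))))
    where
    lem : ∀ n → n + n + 0 ≡ 2 * n
    lem = solve-∀

-- The tapes hold 1^T 0 x (to be overwritten from the 0 leftwards), a copy of 1^T and a
-- copy of x; x is swept once for each 1 of the second tape.
multiplyδ : Fin 6 → Symbol ⊥ × Symbol ⊥ × Symbol ⊥ → Maybe (Fin 6) × Action ⊥ (● ⊗ ● ⊗ ●)
multiplyδ 0F (bit true , s , x) = just 0F , (bit true , right) , (bit true , right) , (x , stay)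
multiplyδ 0F (i , s , x)        = just 1F , (i , right) , (s , stay) , (x , stay)
multiplyδ 1F (bit b , s , x)    = just 1F , (bit b , right) , (s , stay) , (bit b , right)
multiplyδ 1F (i , s , x)        = just 2F , (i , left) , (s , stay) , (x , left)
multiplyδ 2F (i , s , bit b)    = just 2F , (i , left) , (s , stay) , (bit b , left)
multiplyδ 2F (i , s , x)        = just 3F , (i , left) , (s , left) , (x , right)
multiplyδ 3F (i , bit b , x)    = just 4F , (i , stay) , (bit b , stay) , (x , stay)
multiplyδ 3F (i , s , x)        = nothing , (i , right) , (s , stay) , (x , stay)
multiplyδ 4F (i , s , bit b)    = just 4F , (bit true , left) , (s , stay) , (bit b , right)
multiplyδ 4F (i , s , x)        = just 5F , (i , stay) , (s , left) , (x , left)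
multiplyδ 5F (i , s , bit b)    = just 5F , (i , stay) , (s , stay) , (bit b , left)
multiplyδ 5F (i , s , x)        = just 3F , (i , stay) , (s , stay) , (x , right)

multiply : ∀ p → NT true ⟪ clockWord p ⟫ ⟪ clockWord (0 ∷ p) ⟫ (λ x → x ∷ [])
multiply p = record
  { finite-alphabet = finite-⊥ ; program = P ; deterministic = λ _ _ _ → ℕₚ.≤-refl
  ; time = copyPoly ⊕ identity ⊙ (constant 3 ⊕ scale 2 identity)
  ; run = λ { {x} refl → recast (cong (_, blankTape , blankTape) (sym (inputTape≡at _))) refl refl
      (Run-weaken (λ _ k → k) (time≤ x) (count-run x 0 (eval p (length x)) refl)) } }
  where
  P : Program ⊥ (● ⊗ ● ⊗ ●)
  P = single multiplyδ

  module _ (x : Word) where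

    n : ℕ
    n = length x

    K : Memory ⊥ (● ⊗ ● ⊗ ●) → List Word → ℕ → Set
    K = Final ⟪ clockWord (0 ∷ p) ⟫

    output : ℕ → List (Symbol ⊥)
    output m = map bit (trues m ++ false ∷ x) ++ blank ∷ []

    xTape : Tape ⊥
    xTape = at (blank ∷ []) (map bit x ++ blank ∷ [])

    rewind-run : ∀ {i s} ds {rs t} → Run P K 3F (i , s , at (blank ∷ []) (map bit ds ʳ++ rs)) (x ∷ []) t →
                 Run P K 5F (i , s , leftOf (map bit ds ++ blank ∷ []) rs) (x ∷ []) (suc (length ds + t))
    rewind-run []       {rs} r = one refl (cong (λ u → _ , _ , u) (move-right [] blank rs)) (goto r)
    rewind-run (b ∷ ds) {rs} r = one refl (cong (λ u → _ , _ , u) (move-left (map bit ds ++ blank ∷ []) (bit b) rs)) (goto (rewind-run ds r))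

    sweep-run : ∀ ys ds junk m {ls rs t} →
      (∀ junk′ → Run P K 3F (leftOf junk′ (output (length ys + m)) , leftOf ls (bit true ∷ rs) , at (blank ∷ []) (map bit ds ʳ++ (map bit ys ++ blank ∷ []))) (x ∷ []) t) →
      Run P K 4F (leftOf junk (output m) , tape ls (bit true) rs , at (map bit ds ++ blank ∷ []) (map bit ys ++ blank ∷ [])) (x ∷ [])
        (length ys + suc (suc (length ys + length ds + t)))
    sweep-run [] ds junk m {ls} {rs} r =
      one refl (cong₂ (λ u v → _ , u , v) (move-left ls (bit true) rs) (move-left (map bit ds ++ blank ∷ []) blank [])) (goto (rewind-run ds (r junk)))
    sweep-run (y ∷ ys) ds junk m {ls} {rs} {t} r with leftOf-left (bit true) junk (output m)
    ... | junk′ , e = one refl (cong₂ (λ u v → u , _ , v) e (move-right (map bit ds ++ blank ∷ []) (bit y) (map bit ys ++ blank ∷ [])))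
      (goto (recast refl refl (cong (λ k → length ys + (2 + k)) (lem (length ys) (length ds)))
        (sweep-run ys (y ∷ ds) junk′ (suc m) {t = t} λ junk″ → recast (cong₂ _,_ (cong (λ k → leftOf junk″ (output k)) (sym (ℕₚ.+-suc (length ys) m))) refl) refl refl (r junk″))))
      where
      lem : ∀ a b → a + suc b + t ≡ suc (a + b + t)
      lem a b = cong (_+ t) (ℕₚ.+-suc a b)

    loopTime : ℕ → ℕ
    loopTime zero    = 1
    loopTime (suc j) = suc (n + (2 + (n + 0 + loopTime j)))

    -- Each one left on the second tape still adds `n` ones in front of the output, so `j * n + m`
    -- is invariant.
    loop-run : ∀ j junk m rs → trues (j * n + m) ++ false ∷ x ≡ clockWord (0 ∷ p) x →
               Run P K 3F (leftOf junk (output m) , leftOf (map bit (trues j)) rs , xTape) (x ∷ []) (loopTime j)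
    loop-run zero junk m rs e = one refl (cong (_, _) (leftOf-right junk (output m)))
      (exit (x , refl , trans (tapeWord-at (pad junk) (output m)) (trans (leadingBits-word (trues m ++ false ∷ x) []) e)))
    loop-run (suc j) junk m rs e = one refl refl (goto (sweep-run x [] junk m λ junk′ →
      loop-run j junk′ (n + m) (bit true ∷ rs) (trans (cong (λ k → trues k ++ false ∷ x) (lem (j * n) n m)) e)))
      where
      lem : ∀ a b m → a + (b + m) ≡ b + a + m
      lem = solve-∀

    ticks : ℕ
    ticks = eval p n

    back-run : ∀ ds rs rs′ → map bit ds ʳ++ rs′ ≡ map bit x ++ blank ∷ [] → map bit ds ʳ++ rs ≡ map bit x ++ blank ∷ [] →
               Run P K 2F (leftOf (map bit ds ++ bit false ∷ map bit (trues ticks)) rs , at (map bit (trues ticks)) [] , leftOf (map bit ds) rs′) (x ∷ []) (length ds + suc (loopTime ticks))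
    back-run [] rs rs′ e e′ = one refl
      (cong₂ _,_ (move-left (map bit (trues ticks)) (bit false) rs) (cong₂ _,_ (move-left (map bit (trues ticks)) blank []) (move-right [] blank rs′)))
      (goto (recast (cong₂ _,_ (cong (leftOf (map bit (trues ticks)) ∘ (bit false ∷_)) (sym e′)) (cong₂ _,_ refl (cong (at (blank ∷ [])) (sym e)))) refl refl
        (loop-run ticks (map bit (trues ticks)) 0 (blank ∷ []) (cong (λ k → trues k ++ false ∷ x) (trans (ℕₚ.+-identityʳ (ticks * n)) (ℕₚ.*-comm ticks n))))))
    back-run (d ∷ ds) rs rs′ e e′ = one refl
      (cong₂ (λ u v → u , _ , v) (move-left (map bit ds ++ bit false ∷ map bit (trues ticks)) (bit d) rs) (move-left (map bit ds) (bit d) rs′))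
      (goto (back-run ds (bit d ∷ rs) (bit d ∷ rs′) e e′))

    copyX-run : ∀ ys ds → map (bit {⊥}) ds ʳ++ (map bit ys ++ blank ∷ []) ≡ map bit x ++ blank ∷ [] → length ys + length ds ≡ n →
                Run P K 1F (at (map bit ds ++ bit false ∷ map bit (trues ticks)) (map bit ys) , at (map bit (trues ticks)) [] , at (map bit ds) []) (x ∷ [])
                  (length ys + suc (n + suc (loopTime ticks)))
    copyX-run [] ds e l = one refl (cong₂ (λ u v → u , _ , v) (move-left (map bit ds ++ bit false ∷ map bit (trues ticks)) blank []) (move-left (map bit ds) blank []))
      (goto (recast refl refl (cong (_+ suc (loopTime ticks)) l) (back-run ds (blank ∷ []) (blank ∷ []) e e)))
    copyX-run (y ∷ ys) ds e l = one refl
      (cong₂ _,_ (move-right (map bit ds ++ bit false ∷ map bit (trues ticks)) (bit y) (map bit ys)) refl)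
      (goto (copyX-run ys (y ∷ ds) e (trans (ℕₚ.+-suc (length ys) (length ds)) l)))

    count-run : ∀ m k → m + k ≡ ticks →
                Run P K 0F (at (map bit (trues m)) (map bit (trues k ++ false ∷ x)) , at (map bit (trues m)) [] , blankTape) (x ∷ [])
                  (k + suc (n + suc (n + suc (loopTime ticks))))
    count-run m zero e rewrite trans (sym (ℕₚ.+-identityʳ m)) e =
      one refl (cong₂ _,_ (move-right (map bit (trues ticks)) (bit false) (map bit x)) refl) (goto (copyX-run x [] refl (ℕₚ.+-identityʳ n)))
    count-run m (suc k) e = one refl (cong (_, _) (move-right (map bit (trues m)) (bit true) (map bit (trues k ++ false ∷ x))))
      (goto (count-run (suc m) k (trans (sym (ℕₚ.+-suc m k)) e)))

    loopTime≡ : ∀ j → loopTime j ≡ 1 + j * (3 + 2 * n)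
    loopTime≡ zero    = refl
    loopTime≡ (suc j) rewrite loopTime≡ j = lem n (j * (3 + 2 * n))
      where
      lem : ∀ n z → suc (n + (2 + (n + 0 + (1 + z)))) ≡ 1 + (3 + 2 * n + z)
      lem = solve-∀

    time≤ : ticks + suc (n + suc (n + suc (loopTime ticks))) ≤ eval (copyPoly ⊕ identity ⊙ (constant 3 ⊕ scale 2 identity)) (length (clockWord p x))
    time≤ = begin
      ticks + suc (n + suc (n + suc (loopTime ticks)))        ≡⟨ cong (λ z → ticks + suc (n + suc (n + suc z))) (loopTime≡ ticks) ⟩
      ticks + suc (n + suc (n + suc (1 + ticks * (3 + 2 * n)))) ≤⟨ ℕₚ.m≤m+n _ ticks ⟩
      ticks + suc (n + suc (n + suc (1 + ticks * (3 + 2 * n)))) + ticks ≡⟨ lem ticks n (ticks * (3 + 2 * n)) ⟩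
      2 + 2 * (ticks + suc n) + ticks * (3 + 2 * n)           ≤⟨ ℕₚ.+-monoʳ-≤ (2 + 2 * (ticks + suc n))
                                                           (ℕₚ.*-mono-≤ (ℕₚ.m≤m+n ticks (suc n)) (ℕₚ.+-monoʳ-≤ 3 (ℕₚ.*-monoʳ-≤ 2 (ℕₚ.≤-trans (ℕₚ.n≤1+n n) (ℕₚ.m≤n+m (suc n) ticks))))) ⟩
      2 + 2 * (ticks + suc n) + (ticks + suc n) * (3 + 2 * (ticks + suc n)) ≡⟨ cong (λ N → 2 + 2 * N + N * (3 + 2 * N)) (sym (length-clockWord p x)) ⟩
      2 + 2 * N + N * (3 + 2 * N)                     ≡⟨ sym (eval≡ N) ⟩
      eval (copyPoly ⊕ identity ⊙ (constant 3 ⊕ scale 2 identity)) N ∎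
      where
      open ℕₚ.≤-Reasoning
      N = length (clockWord p x)
      lem : ∀ ticks n z → ticks + suc (n + suc (n + suc (1 + z))) + ticks ≡ 2 + 2 * (ticks + suc n) + z
      lem = solve-∀
      eval≡ : ∀ N → eval (copyPoly ⊕ identity ⊙ (constant 3 ⊕ scale 2 identity)) N ≡ 2 + 2 * N + N * (3 + 2 * N)
      eval≡ N = trans (eval-⊕ copyPoly (identity ⊙ (constant 3 ⊕ scale 2 identity)) N)
        (cong₂ _+_ (eval-copyPoly N) (trans (eval-⊙ identity (constant 3 ⊕ scale 2 identity) N)
          (cong₂ _*_ (eval-identity N) (trans (eval-⊕ (constant 3) (scale 2 identity) N)
            (cong₂ _+_ (eval-constant 3 N) (trans (eval-scale 2 identity N) (cong (2 *_) (eval-identity N))))))))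

prependTrues : ∀ {I} (e : I → Word) a → NT true ⟪ e ⟫ ⟪ (λ i → trues a ++ e i) ⟫ (λ i → i ∷ [])
prependTrues e zero    = identityNT e
  where
  identityNT : ∀ {I} (e : I → Word) → NT true ⟪ e ⟫ ⟪ e ⟫ (λ i → i ∷ [])
  identityNT e = one-tape (single {k = 0} λ _ s → nothing , s , stay) (λ _ _ _ → ℕₚ.≤-refl) (constant 1)
    λ { {i} refl → recast (sym (inputTape≡at (e i))) refl (sym (eval-constant 1 (length (e i))))
          (one refl refl (exit (i , refl , trans (tapeWord-at [] (map bit (e i))) (leadingBits-bits (e i))))) }
prependTrues e (suc a) = compose (prependTrues e a) (prepend (λ i → trues a ++ e i) true)

clock : ∀ p → NT true ⟪ id ⟫ ⟪ clockWord p ⟫ (λ x → x ∷ [])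
clock []      = prepend id false
clock (a ∷ p) = weaken-NT (λ {x} e → trans e (shift x)) (λ _ → refl)
  (compose (compose (clock p) (multiply p)) (prependTrues (clockWord (0 ∷ p)) a))
  where
  shift : ∀ x → trues a ++ clockWord (0 ∷ p) x ≡ clockWord (a ∷ p) x
  shift x = trans (sym (Listₚ.++-assoc (trues a) (trues (eval (0 ∷ p) (length x))) (false ∷ x)))
    (cong (_++ false ∷ x) (sym (replicate-+ a _ true)))

-- Complementary counting

module _ {A σ} {P : Program A σ} {R : Set} {K : Memory A σ → List R → ℕ → Set} where

  Nexts-++ : ∀ {as bs m rs rs′ t} → Nexts P K as m rs t → Nexts P K bs m rs′ t → Nexts P K (as ++ bs) m (rs ++ rs′) t
  Nexts-++ []                                     s = s
  Nexts-++ (_∷_ {rs = rs} {rs′ = rs′} r r′) s = recasts (sym (Listₚ.++-assoc rs rs′ _)) (r ∷ Nexts-++ r′ s)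

  Nexts-replicate : ∀ k {x a m n r t} → Next P K x (act σ a m) (replicate n r) t →
                    Nexts P K (replicate k (x , a)) m (replicate (k * n) r) t
  Nexts-replicate zero            s = []
  Nexts-replicate (suc k) {n = n} s = recasts (sym (replicate-+ n (k * n) _)) (s ∷ Nexts-replicate k s)

skipClockδ : ∀ {A} → Fin 1 → Symbol A → Maybe (Fin 1) × (Symbol A × Move)
skipClockδ _ (bit true) = just 0F , bit true , right
skipClockδ _ s          = nothing , s , right

-- From a clock word 1^T 0 x, P is run on x, one step per tick. With every node of the
-- computation tree filled up to B children, so that the tree has B^T leaves at time T,
-- exactly the accepting paths of P lack a leaf. State 2 counts all leaves below it and
-- state 3 (after P has accepted) all but one.
module Complement {d J} {Out : Encoding J} {F : Word → List J} (M : NT d ⟪ id ⟫ Out F) (extra B : ℕ) (B≥1 : 1 ≤ B)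
                  (branching : ∀ q ss → length (δ (NT.program M) q ss) ≤ B) where

  open NT M

  τ : Shape
  τ = ● ⊗ layout

  tick : Maybe (State program) → Maybe (Fin 4 ⊎ State program)
  tick nothing  = just (inj₁ 3F)
  tick (just q) = just (inj₂ q)

  fill : Bool → Heads Alphabet τ → Action Alphabet (● ⊗ τ)
  fill b ss = (bit b , left) , keep τ ss

  leavesδ : Fin 4 ⊎ State program → Heads Alphabet (● ⊗ τ) → List (Maybe (Fin 4 ⊎ State program) × Action Alphabet (● ⊗ τ))
  leavesδ (inj₁ 0F) (s , ss)     = (just (inj₁ 1F) , (s , left) , keep τ ss) ∷ []
  -- At the root, `extra` full trees are attached beside the tree of `P`; two of them later give the
  -- summand 2W of the comparison.
  leavesδ (inj₁ 1F) (s , ss)     = (just (inj₂ (start program)) , (s , left) , keep τ ss) ∷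
                                   replicate extra (just (inj₁ 2F) , (s , left) , keep τ ss)
  leavesδ (inj₁ 2F) (bit b , ss) = replicate B (just (inj₁ 2F) , fill b ss)
  leavesδ (inj₁ 2F) (s , ss)     = (nothing , (s , stay) , keep τ ss) ∷ []
  leavesδ (inj₁ 3F) (bit b , ss) = (just (inj₁ 3F) , fill b ss) ∷ replicate (B ∸ 1) (just (inj₁ 2F) , fill b ss)
  leavesδ (inj₁ 3F) (s , ss)     = []
  leavesδ (inj₂ q)  (bit b , ss) = map (λ (x , a) → tick x , (bit b , left) , a) (δ program q ss) ++
                                   replicate (B ∸ length (δ program q ss)) (just (inj₁ 2F) , fill b ss)
  -- Not reached as long as the clock outlasts every run of `P`.
  leavesδ (inj₂ q)  (s , ss)     = []

  leaves : Program Alphabet (● ⊗ τ)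
  leaves = record { State = Fin 4 ⊎ State program ; state-finite = finite-⊎ (finite-Fin 4) (state-finite program)
                  ; start = inj₁ 0F ; δ = leavesδ }

  K : Memory Alphabet (● ⊗ τ) → List ⊤ → ℕ → Set
  K = Final anyWord

  clockTape : ℕ → List (Symbol Alphabet) → Tape Alphabet
  clockTape T = leftOf (map bit (trues T))

  Leaves : Fin 4 ⊎ State program → ℕ → Memory Alphabet τ → ℕ → Set
  Leaves q T m n = ∀ rs → Run leaves K q (clockTape T rs , m) (replicate n tt) (suc T)

  fill-next : ∀ {q T m n} → Leaves q T m n → ∀ rs →
              Next leaves K (just q) (act (● ⊗ τ) (fill true (scan τ m)) (clockTape (suc T) rs , m)) (replicate n tt) (suc T)
  fill-next {T = T} {m} r rs =
    goto (recast (cong₂ _,_ (sym (move-left (map bit (trues T)) (bit true) rs)) (sym (act-keep τ m))) refl refl (r (bit true ∷ rs)))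

  all-run : ∀ T m → Leaves (inj₁ 2F) T m (B ^ T)
  all-run zero    m rs = one refl refl (exit (tt , refl , tt))
  all-run (suc T) m rs = step (Nexts-replicate B (fill-next (all-run T m) rs))

  -- The number `B ^ T ∸ 1` in the form in which the program builds it: one child lacks a leaf and
  -- the other `B ∸ 1` are full.
  but-one : ℕ → ℕ
  but-one zero    = 0
  but-one (suc T) = but-one T + (B ∸ 1) * B ^ T

  but-one≡ : ∀ T → but-one T + 1 ≡ B ^ T
  but-one≡ zero    = refl
  but-one≡ (suc T) = begin
    but-one T + (B ∸ 1) * B ^ T + 1 ≡⟨ lem (but-one T) ((B ∸ 1) * B ^ T) ⟩
    (but-one T + 1) + (B ∸ 1) * B ^ T ≡⟨ cong (_+ (B ∸ 1) * B ^ T) (but-one≡ T) ⟩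
    B ^ T + (B ∸ 1) * B ^ T              ≡⟨ cong (_* B ^ T) (ℕₚ.m+[n∸m]≡n B≥1) ⟩
    B * B ^ T                            ∎
    where
    open ≡-Reasoning
    lem : ∀ a b → a + b + 1 ≡ (a + 1) + b
    lem = solve-∀

  but-one-run : ∀ T m → Leaves (inj₁ 3F) T m (but-one T)
  but-one-run zero    m rs = step []
  but-one-run (suc T) m rs = step (recasts (sym (replicate-+ (but-one T) _ tt))
    (fill-next (but-one-run T m) rs ∷ Nexts-replicate (B ∸ 1) (fill-next (all-run T m) rs)))

  -- Leaves and results are added up, not subtracted, so that the equation passes from children to
  -- parents. A node with `l` transitions receives `B ∸ l` full children; thus a rejecting node
  -- keeps all its leaves and each exit costs one.
  complement-run   : ∀ {q m rs t T} → t ≤ T → Run program (Final Out) q m rs t →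
                     ∃[ n ] Leaves (inj₂ q) T m n × n + length rs ≡ B ^ T
  complement-next  : ∀ {x m rs t T} → t ≤ T → Next program (Final Out) x m rs t →
                     ∃[ n ] (∀ cs → Next leaves K (tick x) (clockTape T cs , m) (replicate n tt) (suc T)) × n + length rs ≡ B ^ T
  complement-nexts : ∀ {as m rs t T} → t ≤ T → Nexts program (Final Out) as m rs t →
                     ∃[ n ] (∀ cs → Nexts leaves K (map (λ (x , a) → tick x , (bit true , left) , a) as) (clockTape (suc T) cs , m) (replicate n tt) (suc T)) ×
                            n + length rs ≡ length as * B ^ T

  complement-run {q} {m} {rs} {T = suc T} (s≤s h) (step r) with complement-nexts h r
  ... | n , run , e = n + k * B ^ T ,
      (λ cs → step (recasts (sym (replicate-+ n (k * B ^ T) tt)) (Nexts-++ (run cs) (Nexts-replicate k (fill-next (all-run T m) cs))))) ,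
      (begin
        n + k * B ^ T + length rs       ≡⟨ lem n (k * B ^ T) (length rs) ⟩
        n + length rs + k * B ^ T       ≡⟨ cong (_+ k * B ^ T) e ⟩
        l * B ^ T + k * B ^ T           ≡⟨ sym (ℕₚ.*-distribʳ-+ (B ^ T) l k) ⟩
        (l + k) * B ^ T                 ≡⟨ cong (_* B ^ T) (ℕₚ.m+[n∸m]≡n (branching q (scan τ m))) ⟩
        B * B ^ T                       ∎)
    where
    open ≡-Reasoning
    l = length (δ program q (scan τ m))
    k = B ∸ l
    lem : ∀ a b c → a + b + c ≡ a + c + b
    lem = solve-∀

  complement-next {m = m} {T = T} h (exit (_ , refl , _)) = but-one T , (λ cs → goto (but-one-run T m cs)) , but-one≡ T
  complement-next h (goto r) with complement-run h r
  ... | n , run , e = n , (λ cs → goto (run cs)) , e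

  complement-nexts h [] = 0 , (λ cs → []) , refl
  complement-nexts {T = T} h (_∷_ {a = a} {as = as} {m = m} {rs = rs} {rs′ = rs′} r r′) with complement-next h r | complement-nexts h r′
  ... | n , run , e | n′ , run′ , e′ = n + n′ ,
      (λ cs → recasts (sym (replicate-+ n n′ tt))
        (subst (λ u → Next leaves K _ (u , act τ a m) _ _) (sym (move-left (map bit (trues T)) (bit true) cs)) (run (bit true ∷ cs)) ∷ run′ cs)) ,
      (begin
        n + n′ + length (rs ++ rs′)           ≡⟨ cong (n + n′ +_) (Listₚ.length-++ rs) ⟩
        n + n′ + (length rs + length rs′)     ≡⟨ lem n n′ (length rs) (length rs′) ⟩
        (n + length rs) + (n′ + length rs′)   ≡⟨ cong₂ _+_ e e′ ⟩
        B ^ T + length as * B ^ T             ∎)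
    where
    open ≡-Reasoning
    lem : ∀ a b c d → a + b + (c + d) ≡ (a + c) + (b + d)
    lem = solve-∀

  module _ (p : Polynomial) (time≤p : ∀ n → eval time n ≤ eval p n) where

    total : Word → ℕ
    total x = B ^ eval p (length x)

    initial-run : ∀ x → ∃[ n ] Leaves (inj₂ (start program)) (eval p (length x)) (initialMemory layout x) n × n + length (F x) ≡ total x
    initial-run x = complement-run (time≤p (length x)) (run refl)

    count≤total : ∀ x → length (F x) ≤ total x
    count≤total x with initial-run x
    ... | n , _ , e = ℕₚ.≤-trans (ℕₚ.m≤n+m (length (F x)) n) (ℕₚ.≤-reflexive e)

    move-left-at : ∀ ls (rs : List (Symbol Alphabet)) → ∃[ rs′ ] writeMove (Tape.scanned (at ls rs) , left) (at ls rs) ≡ leftOf ls rs′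
    move-left-at ls []       = blank ∷ [] , move-left ls blank []
    move-left-at ls (s ∷ rs) = s ∷ rs , move-left ls s rs

    result : Word → ℕ
    result x = (total x ∸ length (F x)) + extra * total x

    leaves-run : ∀ x rs {u} → inputTape x ≈ u →
                 Run leaves K (inj₁ 0F) (at (bit false ∷ map bit (trues (eval p (length x)))) rs , (u , pureS layout blankTape))
                   (replicate (result x) tt) (3 + eval p (length x))
    leaves-run x rs {u} u≈ with initial-run x | move-left-at (bit false ∷ map bit (trues (eval p (length x)))) rs
    ... | n , run , e | rs′ , e′ =
      Run-≈ {K = K} {L = K} (λ _ k → proj₁ k , proj₁ (proj₂ k) , tt) (≈-refl _ , (u≈ , Memory≈-refl layout _))
        (one refl (cong₂ _,_ e′ (act-keep τ (initialMemory layout x)))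
          (goto (step (recasts results≡ (at-start (run (bit false ∷ rs′)) ∷ Nexts-replicate extra (at-start (all-run ticks (initialMemory layout x) (bit false ∷ rs′))))))))
      where
      ticks = eval p (length x)
      at-start : ∀ {q k} → Run leaves K q (clockTape ticks (bit false ∷ rs′) , initialMemory layout x) (replicate k tt) (suc ticks) →
                 Next leaves K (just q) (act (● ⊗ τ) ((bit false , left) , keep τ (scan τ (initialMemory layout x))) (tape (map bit (trues ticks)) (bit false) rs′ , initialMemory layout x)) (replicate k tt) (suc ticks)
      at-start r = goto (recast (cong₂ _,_ (sym (move-left (map bit (trues ticks)) (bit false) rs′)) (sym (act-keep τ (initialMemory layout x)))) refl refl r)
      results≡ : replicate n tt ++ replicate (extra * B ^ ticks) tt ≡ replicate (result x) tt
      results≡ = trans (sym (replicate-+ n (extra * B ^ ticks) tt))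
        (cong (λ k → replicate (k + extra * B ^ ticks) tt)
          (trans (sym (ℕₚ.m+n∸n≡m n (length (F x)))) (cong (_∸ length (F x)) e)))

    skip-run : ∀ x m k {j} {R : Set} {L : Tape Alphabet → List R → ℕ → Set} {rs t} → k + m ≡ j →
               L (at (bit false ∷ map bit (trues j)) (map bit x)) rs t →
               Run (single skipClockδ) L 0F (at (map bit (trues m)) (map bit (trues k ++ false ∷ x))) rs (k + suc t)
    skip-run x m zero    refl r = one refl (move-right (map bit (trues m)) (bit false) (map bit x)) (exit r)
    skip-run x m (suc k) e    r = one refl (move-right (map bit (trues m)) (bit true) (map bit (trues k ++ false ∷ x)))
      (goto (skip-run x (suc m) k (trans (ℕₚ.+-suc k m) e) r))

    -- The ones of the clock word stay where they are and are consumed from right to left, while `P`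
    -- works on a copy of `x` on a tape of its own.
    complementary : Program Alphabet (● ⊗ τ)
    complementary = lift fstL (single skipClockδ) ⨾ lift (idL ×L fstL) (copy bit) ⨾ leaves

    complement : NT false ⟪ clockWord p ⟫ anyWord (λ x → replicate (result x) tt)
    complement = record
      { finite-alphabet = finite-alphabet ; program = complementary ; deterministic = λ ()
      ; time = constant 4 ⊕ scale 2 identity
      ; run = λ { {x} refl → recast (cong (_, _) (sym (inputTape≡at (clockWord p x)))) refl (sym (time≡ x)) (run-from x) } }
      where
      run-from : ∀ x → let ticks = eval p (length x) in
        Run complementary K (start complementary) (at [] (map bit (clockWord p x)) , initialMemory layout []) (replicate (result x) tt)
          (ticks + suc (2 + 2 * length x + (3 + ticks)))
      run-from x = Run-⨾ (Run-lift fstL {n = blankTape , initialMemory layout []} (skip-run x 0 (eval p (length x)) (ℕₚ.+-identityʳ (eval p (length x)))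
        (Run-⨾ (Run-lift (idL ×L fstL) {n = blankTape , initialMemory layout []}
          (recast refl refl (cong (λ w → 2 + 2 * length w + (3 + eval p (length x))) (leadingBits-bits x))
            (copy-run bit (map bit x) (leaves-run x (map bit (leadingBits (map bit x)) ++ afterBits (map bit x))
              (subst (λ w → inputTape x ≈ at (blank ∷ []) (map bit w ++ blank ∷ [])) (sym (leadingBits-bits x)) (input≈copied x)))))))))

      time≡ : ∀ x → eval (constant 4 ⊕ scale 2 identity) (length (clockWord p x)) ≡ eval p (length x) + suc (2 + 2 * length x + (3 + eval p (length x)))
      time≡ x = trans (eval-⊕ (constant 4) (scale 2 identity) N)
        (trans (cong₂ _+_ (eval-constant 4 N) (trans (eval-scale 2 identity N) (cong (2 *_) (trans (eval-identity N) (length-clockWord p x)))))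
          (lem (eval p (length x)) (length x)))
        where
        N = length (clockWord p x)
        lem : ∀ T n → 4 + 2 * (T + suc n) ≡ T + suc (2 + 2 * n + (3 + T))
        lem = solve-∀

-- Complementation and output length for arbitrary machines

n≤2^n : ∀ n → n ≤ 2 ^ n
n≤2^n zero    = z≤n
n≤2^n (suc n) = ℕₚ.≤-trans (ℕₚ.+-mono-≤ {1} (ℕₚ.m^n>0 2 n) (n≤2^n n)) (ℕₚ.≤-reflexive (cong (2 ^ n +_) (sym (ℕₚ.+-identityʳ (2 ^ n)))))

bounding-Symbol : ∀ {A} → Finite A → Bounding (Symbol A)
bounding-Symbol fin =
  bounding-surjection {A = Maybe (Bool ⊎ _)}
    (λ { nothing → blank ; (just (inj₁ b)) → bit b ; (just (inj₂ a)) → aux a })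
    (λ { blank → nothing ; (bit b) → just (inj₁ b) ; (aux a) → just (inj₂ a) })
    (λ { blank → refl ; (bit b) → refl ; (aux a) → refl })
    (bounding-finite (finite-Maybe (finite-⊎ finite-Bool fin)))

bounding-Shape : ∀ σ {X} → Bounding X → Bounding (⟦ σ ⟧ X)
bounding-Shape ●       b = b
bounding-Shape (V n)   b = bounding-Vec b n
bounding-Shape (σ ⊗ τ) b = bounding-× (bounding-Shape σ b) (bounding-Shape τ b)

-- With `2 ^ c` children at each node the number of leaves `(2 ^ c) ^ T = 2 ^ (c * T)` is again a
-- power of two, as required for reading off a binary digit.
branching-exponent : ∀ {A σ} → Finite A → (P : Program A σ) → ∃[ c ] 1 ≤ c × (∀ q ss → length (δ P q ss) ≤ 2 ^ c)
branching-exponent {σ = σ} fin P with bounding-× (bounding-finite (state-finite P)) (bounding-Shape σ (bounding-Symbol fin)) (λ (q , ss) → length (δ P q ss))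
... | b , h = suc b , s≤s z≤n , λ q ss → ℕₚ.≤-trans (h (q , ss)) (ℕₚ.≤-trans (ℕₚ.n≤1+n b) (n≤2^n (suc b)))

module _ {d I J} {In : Encoding I} {Out : Encoding J} {F : I → List J} (M : NT d In Out F) where

  open NT M

  module _ (W : ℕ) where

    private
      Short : J → Set
      Short r = ∃[ w ] Out r w × length w ≤ suc W

    short-run   : ∀ {q m rs t} → Run program (Within (Final Out) W) q m rs t → ∀ {r} → r ∈ rs → Short r
    short-next  : ∀ {x m rs t} → Next program (Within (Final Out) W) x m rs t → ∀ {r} → r ∈ rs → Short r
    short-nexts : ∀ {as m rs t} → Nexts program (Within (Final Out) W) as m rs t → ∀ {r} → r ∈ rs → Short r

    short-run (step s) = short-nexts s

    short-next (exit {m = m , _} {t = t} ((r , refl , o) , h)) (here refl) =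
      tapeWord m , o , ℕₚ.≤-trans (length-tapeWord m) (s≤s (ℕₚ.≤-trans (ℕₚ.m≤m+n (width m) t) h))
    short-next (goto s) = short-run s

    short-nexts (_∷_ {rs = rs} s s′) r∈ with ∈-++⁻ rs r∈
    ... | inj₁ r∈ = short-next s r∈
    ... | inj₂ r∈ = short-nexts s′ r∈

  sizeBound : Polynomial
  sizeBound = constant 1 ⊕ (identity ⊕ time)

  -- A time bound limits the values that a machine computes. For `g` in FP it bounds the length of
  -- `binaryℤ (g x)`, which the exponent of the power of two has to exceed.
  output-short : ∀ {i w r} → In i w → r ∈ F i → ∃[ u ] Out r u × length u ≤ eval sizeBound (length w)
  output-short {w = w} h r∈ with short-run _ (Run-width (length w + eval time (length w)) (ℕₚ.+-monoˡ-≤ _ (width-inputTape w)) (run h)) r∈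
  ... | u , o , short = u , o , ℕₚ.≤-trans short (ℕₚ.≤-reflexive (sym (trans (eval-⊕ (constant 1) (identity ⊕ time) n)
      (cong₂ _+_ (eval-constant 1 n) (trans (eval-⊕ identity time n) (cong (_+ eval time n) (eval-identity n)))))))
    where n = length w

-- `size` is a second lower bound on the exponent, so that the power of two can also be made to
-- exceed values that have nothing to do with `M`.
record Complementation {J} {Out : Encoding J} {F : Word → List J} (M : NT false ⟪ id ⟫ Out F) (size : Polynomial) : Set₁ where
  field
    exponent     : Polynomial
    exponent≥    : ∀ n → suc (eval size n) ≤ eval exponent n
    count≤       : ∀ x → length (F x) ≤ 2 ^ eval exponent (length x)
    complemented : ∀ extra → NT false ⟪ id ⟫ anyWord
      (λ x → replicate ((2 ^ eval exponent (length x) ∸ length (F x)) + extra * 2 ^ eval exponent (length x)) tt)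

complementation : ∀ {J} {Out : Encoding J} {F : Word → List J} (M : NT false ⟪ id ⟫ Out F) size → Complementation M size
complementation {F = F} M size with branching-exponent (NT.finite-alphabet M) (NT.program M)
... | c , c≥1 , branching = record
  { exponent = scale c p
  ; exponent≥ = λ n → begin
      suc (eval size n)     ≤⟨ s≤s (ℕₚ.m≤n+m (eval size n) (eval time n)) ⟩
      suc (eval time n + eval size n) ≡⟨ sym (eval-p n) ⟩
      eval p n              ≡⟨ sym (ℕₚ.*-identityˡ _) ⟩
      1 * eval p n          ≤⟨ ℕₚ.*-monoˡ-≤ (eval p n) c≥1 ⟩
      c * eval p n          ≡⟨ sym (eval-scale c p n) ⟩
      eval (scale c p) n    ∎
  ; count≤ = λ x → ℕₚ.≤-trans (C.count≤total 0 p time≤p x) (ℕₚ.≤-reflexive (power x))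
  ; complemented = λ extra → weaken-NT id
      (λ x → trans (Listₚ.++-identityʳ _) (cong (λ w → replicate ((w ∸ length (F x)) + extra * w) tt) (power x)))
      (compose (nondeterministic (clock p)) (C.complement extra p time≤p)) }
  where
  open ℕₚ.≤-Reasoning
  open NT M using (time)
  p : Polynomial
  p = constant 1 ⊕ (time ⊕ size)
  module C extra = Complement M extra (2 ^ c) (ℕₚ.m^n>0 2 c) branching
  eval-p : ∀ n → eval p n ≡ suc (eval time n + eval size n)
  eval-p n = trans (eval-⊕ (constant 1) (time ⊕ size) n) (cong₂ _+_ (eval-constant 1 n) (eval-⊕ time size n))
  time≤p : ∀ n → eval time n ≤ eval p n
  time≤p n = ℕₚ.≤-trans (ℕₚ.m≤n⇒m≤1+n (ℕₚ.m≤m+n (eval time n) (eval size n))) (ℕₚ.≤-reflexive (sym (eval-p n)))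
  power : ∀ x → (2 ^ c) ^ eval p (length x) ≡ 2 ^ eval (scale c p) (length x)
  power x = trans (ℕₚ.^-*-assoc 2 c (eval p (length x))) (cong (2 ^_) (sym (eval-scale c p (length x))))

-- Relations between the classes

dropSign : NT true ⟪ binaryℤ ⟫ ⟪ (λ z → binary ℤ.∣ z ∣) ⟫ (λ z → z ∷ [])
dropSign = reindex id (λ {z} e → trans e (signed z)) (dropFirst sign (λ z → binary ℤ.∣ z ∣))
  where
  sign : ℤ → Bool
  sign (ℤ.+ n)    = false
  sign ℤ.-[1+ n ] = true
  signed : ∀ z → binaryℤ z ≡ sign z ∷ binary ℤ.∣ z ∣
  signed (ℤ.+ n)    = refl
  signed ℤ.-[1+ n ] = refl

UPSV⊆#P : UPSVₜ ⊆ #P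
UPSV⊆#P {f} u = NT⇒#P (compose (UPSV⇒NT {f} u) countBelow)
  (λ x → trans (cong length (Listₚ.++-identityʳ (replicate (f x) tt))) (Listₚ.length-replicate (f x)))

single-valued⇒FP₊∘#P⊆#P : #P ⊆ UPSVₜ → FP₊∘#P ⊆ #P
single-valued⇒FP₊∘#P⊆#P #P⊆UPSV {h} (f , g , (f∈FP , _) , g∈#P , h≡) = UPSV⊆#P (NT⇒UPSV
  -- The value of `f` here is `+ h x`, so passing to the absolute value loses nothing.
  (weaken-NT id (λ x → cong (_∷ []) (cong ℤ.∣_∣ (sym (h≡ x))))
    (map-results ℤ.∣_∣ id
      (compose (UPSV⇒NT {g} (#P⊆UPSV g∈#P))
        (compose (reindex binary id (nondeterministic (FP⇒NT {f} f∈FP))) (nondeterministic dropSign))))))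

-- The threshold 0 suffices; the machine for it is `inspectSecond` with a test that always fails.
UP⊆PP : UP ⊆ PP
UP⊆PP {L} (f , f∈#P , cases) = f , const (ℤ.+ 0) , f∈#P , NT⇒FP (inspectSecond (const false)) , λ x → positive x (cases x)
  where
  positive : ∀ x → (L x × f x ≡ 1) ⊎ (¬ L x × f x ≡ 0) → L x ⇔ ((ℤ.+ f x) ℤ.> (ℤ.+ 0))
  positive x (inj₁ (l , e))  rewrite e = mk⇔ (λ _ → ℤ.+<+ (s≤s z≤n)) (λ _ → l)
  positive x (inj₂ (¬l , e)) rewrite e = mk⇔ (λ l → ⊥-elim (¬l l)) (λ { (ℤ.+<+ ()) })

-- Comparison by a binary digit

word-of : ∀ k n → n < 2 ^ k → ∃[ w ] length w ≡ k × value w ≡ n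
word-of zero    zero h = [] , refl , refl
word-of zero    (suc n) (s≤s ())
word-of (suc k) n h with n ℕₚ.<? 2 ^ k
... | yes n< with word-of k n n<
...   | w , refl , e = false ∷ w , refl , e
word-of (suc k) n h | no n≮ with word-of k (n ∸ 2 ^ k) (ℕₚ.+-cancelˡ-< (2 ^ k) _ _
    (subst₂ _<_ (sym (ℕₚ.m+[n∸m]≡n (ℕₚ.≮⇒≥ n≮))) (cong (2 ^ k +_) (ℕₚ.+-identityʳ (2 ^ k))) h))
... | w , refl , e = true ∷ w , refl ,
  trans (value-∷ true w) (trans (cong₂ _+_ (ℕₚ.*-identityˡ _) e) (ℕₚ.m+[n∸m]≡n (ℕₚ.≮⇒≥ n≮)))

-- As `v < 2 ^ k`, it is the value of a word `w` of length `k`. Then `valueFrom 2 w` has the numeral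
-- `10` followed by `w`, and in the companion lemma `valueFrom 3 w` has `11` followed by `w`.
second-bit-low : ∀ k v → v < 2 ^ k → secondSymbol (binary (2 * 2 ^ k + v)) ≡ bit false
second-bit-low k v h with word-of k v h
... | w , refl , refl = cong secondSymbol (trans (cong binary (sym (valueFrom-shift 2 w))) (binary-valueFrom 1 w))

second-bit-high : ∀ k v → v < 2 ^ k → secondSymbol (binary (3 * 2 ^ k + v)) ≡ bit true
second-bit-high k v h with word-of k v h
... | w , refl , refl = cong secondSymbol (trans (cong binary (sym (valueFrom-shift 3 w))) (binary-valueFrom 2 w))

successor⁺≤ : ∀ z m → successor⁺ z ≤ m ⇔ (ℤ.+ m) ℤ.> z
successor⁺≤ (ℤ.+ n)    m = mk⇔ ℤ.+<+ (λ { (ℤ.+<+ h) → h })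
successor⁺≤ ℤ.-[1+ n ] m = mk⇔ (λ _ → ℤ.-<+) (λ _ → z≤n)

successor⁺≤2^length : ∀ z k → length (binaryℤ z) ≤ k → successor⁺ z ≤ 2 ^ k
successor⁺≤2^length ℤ.-[1+ n ] k h = z≤n
successor⁺≤2^length (ℤ.+ n)    k h = begin
  suc n                     ≡⟨ cong suc (sym (value-binary n)) ⟩
  suc (value (binary n))    ≤⟨ value<2^length (binary n) ⟩
  2 ^ length (binary n)     ≤⟨ ℕₚ.^-monoʳ-≤ 2 (ℕₚ.≤-trans (ℕₚ.n≤1+n _) h) ⟩
  2 ^ k                     ∎
  where open ℕₚ.≤-Reasoning

isZeroBit : Symbol ⊥ → Bool
isZeroBit (bit false) = true
isZeroBit _           = false

-- With W = 2^Q > f x, g x, the number z = 2W + (W - (f x + 1)) + max (g x + 1) 0 lies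
-- between 2W and 4W, and its second bit is 0 if and only if f x > g x.
module Comparison {f : Word → ℕ} {g : Word → ℤ} {F : Word → List ⊤} (length₁ : ∀ x → length (F x) ≡ suc (f x))
                  (M : NT false ⟪ id ⟫ anyWord F) (G : NT true ⟪ id ⟫ ⟪ binaryℤ ⟫ (λ x → g x ∷ []))
                  (C : Complementation M (sizeBound G)) where

  open Complementation C

  W : Word → ℕ
  W x = 2 ^ eval exponent (length x)

  v z h : Word → ℕ
  v x = (W x ∸ suc (f x)) + successor⁺ (g x)
  z x = 2 * W x + v x
  h x = bitValue (isZeroBit (secondSymbol (binary (z x))))

  φ : Word → ℤ
  φ w = ℤ.+ bitValue (isZeroBit (secondSymbol w))

  z∈#P : #P z
  z∈#P = NT⇒#P (sum (complemented 2) (compose (nondeterministic G) countBelowℤ)) λ x → begin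
    length (replicate ((W x ∸ length (F x)) + 2 * W x) tt ++ replicate (successor⁺ (g x)) tt ++ [])
      ≡⟨ Listₚ.length-++ (replicate ((W x ∸ length (F x)) + 2 * W x) tt) ⟩
    length (replicate ((W x ∸ length (F x)) + 2 * W x) tt) + length (replicate (successor⁺ (g x)) tt ++ [])
      ≡⟨ cong₂ _+_ (Listₚ.length-replicate _) (trans (cong length (Listₚ.++-identityʳ (replicate (successor⁺ (g x)) tt))) (Listₚ.length-replicate (successor⁺ (g x)))) ⟩
    (W x ∸ length (F x)) + 2 * W x + successor⁺ (g x)
      ≡⟨ cong (λ l → (W x ∸ l) + 2 * W x + successor⁺ (g x)) (length₁ x) ⟩
    (W x ∸ suc (f x)) + 2 * W x + successor⁺ (g x)
      ≡⟨ lem (W x ∸ suc (f x)) (2 * W x) (successor⁺ (g x)) ⟩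
    z x ∎
    where
    open ≡-Reasoning
    lem : ∀ a b c → a + b + c ≡ b + (a + c)
    lem = solve-∀

  f<W : ∀ x → suc (f x) ≤ W x
  f<W x = subst (_≤ W x) (length₁ x) (count≤ x)

  g<W : ∀ x → successor⁺ (g x) ≤ W x
  g<W x with output-short G {x} {x} refl (here refl)
  ... | _ , refl , short = successor⁺≤2^length (g x) _ (ℕₚ.≤-trans short (ℕₚ.≤-trans (ℕₚ.n≤1+n _) (exponent≥ (length x))))

  -- The comparison takes place in ℕ, where it is decidable; this supplies the case distinction that
  -- is part of the definition of UP.
  decide : ∀ x → ((ℤ.+ f x) ℤ.> g x × h x ≡ 1) ⊎ (¬ (ℤ.+ f x) ℤ.> g x × h x ≡ 0)
  decide x with successor⁺ (g x) ℕₚ.≤? f x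
  ... | yes s≤f = inj₁ (Equivalence.to (successor⁺≤ (g x) (f x)) s≤f ,
                        cong (bitValue ∘ isZeroBit) (second-bit-low (eval exponent (length x)) (v x) small))
    where
    -- What is added, at most `f x`, is less than the `suc (f x)` that was subtracted, so there is
    -- no carry into the second digit.
    small : v x < W x
    small = begin-strict
      (W x ∸ suc (f x)) + successor⁺ (g x) <⟨ ℕₚ.+-monoʳ-< (W x ∸ suc (f x)) (s≤s s≤f) ⟩
      (W x ∸ suc (f x)) + suc (f x)        ≡⟨ ℕₚ.m∸n+n≡m (f<W x) ⟩
      W x                                  ∎
      where open ℕₚ.≤-Reasoning
  ... | no s≰f = inj₂ ((λ f>g → s≰f (Equivalence.from (successor⁺≤ (g x) (f x)) f>g)) ,
      cong (bitValue ∘ isZeroBit) (trans (cong (secondSymbol ∘ binary) split) (second-bit-high (eval exponent (length x)) (successor⁺ (g x) ∸ suc (f x)) small)))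
    where
    f<s : suc (f x) ≤ successor⁺ (g x)
    f<s = ℕₚ.≰⇒> s≰f
    -- Only `successor⁺ (g x) ≤ W x` is known; subtracting the positive number `suc (f x)` makes the
    -- bound strict.
    small : successor⁺ (g x) ∸ suc (f x) < W x
    small = ℕₚ.<-≤-trans (ℕₚ.∸-monoʳ-< {successor⁺ (g x)} (s≤s z≤n) f<s) (g<W x)
    split : z x ≡ 3 * W x + (successor⁺ (g x) ∸ suc (f x))
    split = begin
      2 * W x + ((W x ∸ suc (f x)) + successor⁺ (g x))
        ≡⟨ cong (λ s → 2 * W x + ((W x ∸ suc (f x)) + s)) (sym (ℕₚ.m+[n∸m]≡n f<s)) ⟩
      2 * W x + ((W x ∸ suc (f x)) + (suc (f x) + (successor⁺ (g x) ∸ suc (f x))))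
        ≡⟨ lem (2 * W x) (W x ∸ suc (f x)) (suc (f x)) (successor⁺ (g x) ∸ suc (f x)) ⟩
      2 * W x + ((W x ∸ suc (f x)) + suc (f x)) + (successor⁺ (g x) ∸ suc (f x))
        ≡⟨ cong (λ s → 2 * W x + s + (successor⁺ (g x) ∸ suc (f x))) (ℕₚ.m∸n+n≡m (f<W x)) ⟩
      2 * W x + W x + (successor⁺ (g x) ∸ suc (f x))
        ≡⟨ cong (_+ (successor⁺ (g x) ∸ suc (f x))) (ℕₚ.+-comm (2 * W x) (W x)) ⟩
      3 * W x + (successor⁺ (g x) ∸ suc (f x)) ∎
      where
      open ≡-Reasoning
      lem : ∀ a b c d → a + (b + (c + d)) ≡ a + (b + c) + d
      lem = solve-∀

FP₊∘#P⊆#P⇒PP⊆UP : FP₊∘#P ⊆ #P → PP ⊆ UP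
FP₊∘#P⊆#P⇒PP⊆UP closed {L} (f , g , f∈#P , g∈FP , L⇔) =
  h , closed (φ , z , (NT⇒FP (inspectSecond isZeroBit) , λ _ → ℤ.+≤+ z≤n) , z∈#P , λ _ → refl) , λ x → membership x (decide x)
  where
  G : NT true ⟪ id ⟫ ⟪ binaryℤ ⟫ (λ x → g x ∷ [])
  G = FP⇒NT g∈FP

  -- One additional accepting path, so that the complement counts `W - (f x + 1)` and the comparison
  -- comes out strict.
  M : NT false ⟪ id ⟫ anyWord (λ x → replicate (f x) tt ++ tt ∷ [])
  M = sum (#P⇒NT f∈#P) unit

  length₁ : ∀ x → length (replicate (f x) tt ++ tt ∷ []) ≡ suc (f x)
  length₁ x = trans (Listₚ.length-++ (replicate (f x) tt)) (trans (ℕₚ.+-comm _ 1) (cong suc (Listₚ.length-replicate (f x))))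

  open Comparison length₁ M G (complementation M (sizeBound G)) using (φ; z; h; z∈#P; decide)

  membership : ∀ x → ((ℤ.+ f x) ℤ.> g x × h x ≡ 1) ⊎ (¬ (ℤ.+ f x) ℤ.> g x × h x ≡ 0) → (L x × h x ≡ 1) ⊎ (¬ L x × h x ≡ 0)
  membership x (inj₁ (f>g , e)) = inj₁ (Equivalence.from (L⇔ x) f>g , e)
  membership x (inj₂ (f≯g , e)) = inj₂ (f≯g ∘ Equivalence.to (L⇔ x) , e)

-- Guessing a value bit by bit

onlyEqual : ℕ → ℕ → List ℕ
onlyEqual n m with n ℕₚ.≟ m
... | yes _ = m ∷ []
... | no _  = []

-- The contribution of a guess `w` once it is checked against `m`. The value `v` of the bits guessed
-- so far is a parameter to allow induction on the length of `w`.
pick : ℕ → ℕ → Word → List ℕ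
pick v m w = onlyEqual (valueFrom v w) m

pick-false : ∀ v m w → pick v m (false ∷ w) ≡ pick (v + v) m w
pick-false v m w = cong (λ a → pick a m w) (ℕₚ.+-identityʳ (v + v))

pick-true : ∀ v m w → pick v m (true ∷ w) ≡ pick (suc (v + v)) m w
pick-true v m w = cong (λ a → pick a m w) (ℕₚ.+-comm (v + v) 1)

picks-suc : ∀ k v m → concatMap (pick v m) (words (suc k)) ≡ concatMap (pick (v + v) m) (words k) ++ concatMap (pick (suc (v + v)) m) (words k)
picks-suc k v m = trans (Listₚ.concatMap-++ (pick v m) (map (false ∷_) (words k)) (map (true ∷_) (words k)))
  (cong₂ _++_ (trans (Listₚ.concatMap-map (pick v m) (false ∷_) (words k)) (Listₚ.concatMap-cong (pick-false v m) (words k)))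
              (trans (Listₚ.concatMap-map (pick v m) (true ∷_) (words k)) (Listₚ.concatMap-cong (pick-true v m) (words k))))

double-* : ∀ v e → (v + v) * e ≡ v * (2 * e)
double-* = solve-∀

suc-double-* : ∀ v e → suc (suc (v + v)) * e ≡ suc v * (2 * e)
suc-double-* = solve-∀

-- After a prefix of value `v`, words of length `k` take the values from `v * 2 ^ k` up to but
-- excluding `suc v * 2 ^ k`. The next bit halves this interval, and a number outside the whole is
-- outside both halves.
picks-outside : ∀ k v m → m < v * 2 ^ k ⊎ suc v * 2 ^ k ≤ m → concatMap (pick v m) (words k) ≡ []
picks-outside zero v m h with v ℕₚ.≟ m
... | no _     = refl
... | yes refl = ⊥-elim (impossible h)
  where
  impossible : ¬ (v < v * 1 ⊎ suc v * 1 ≤ v)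
  impossible (inj₁ h) = ℕₚ.<-irrefl (sym (ℕₚ.*-identityʳ v)) h
  impossible (inj₂ h) = ℕₚ.<-irrefl refl (subst (_≤ v) (ℕₚ.*-identityʳ (suc v)) h)
picks-outside (suc k) v m h = trans (picks-suc k v m) (cong₂ _++_ (picks-outside k (v + v) m (low h)) (picks-outside k (suc (v + v)) m (high h)))
  where
  open ℕₚ.≤-Reasoning
  low : m < v * 2 ^ suc k ⊎ suc v * 2 ^ suc k ≤ m → m < (v + v) * 2 ^ k ⊎ suc (v + v) * 2 ^ k ≤ m
  low (inj₁ h) = inj₁ (subst (m <_) (sym (double-* v (2 ^ k))) h)
  low (inj₂ h) = inj₂ (begin
    suc (v + v) * 2 ^ k       ≤⟨ ℕₚ.*-monoˡ-≤ (2 ^ k) (ℕₚ.n≤1+n (suc (v + v))) ⟩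
    suc (suc (v + v)) * 2 ^ k ≡⟨ suc-double-* v (2 ^ k) ⟩
    suc v * 2 ^ suc k         ≤⟨ h ⟩
    m                         ∎)
  high : m < v * 2 ^ suc k ⊎ suc v * 2 ^ suc k ≤ m → m < suc (v + v) * 2 ^ k ⊎ suc (suc (v + v)) * 2 ^ k ≤ m
  high (inj₁ h) = inj₁ (begin-strict
    m                   <⟨ h ⟩
    v * 2 ^ suc k       ≡⟨ sym (double-* v (2 ^ k)) ⟩
    (v + v) * 2 ^ k     ≤⟨ ℕₚ.*-monoˡ-≤ (2 ^ k) (ℕₚ.n≤1+n (v + v)) ⟩
    suc (v + v) * 2 ^ k ∎)
  high (inj₂ h) = inj₂ (subst (_≤ m) (sym (suc-double-* v (2 ^ k))) h)

-- Bisection: `m` lies in one half only, and `picks-outside` shows that the other half contributes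
-- nothing.
picks-inside : ∀ k v m → v * 2 ^ k ≤ m → m < suc v * 2 ^ k → concatMap (pick v m) (words k) ≡ m ∷ []
picks-inside zero v m h h′ with v ℕₚ.≟ m
... | yes _  = refl
... | no v≢m = ⊥-elim (v≢m (ℕₚ.≤-antisym (subst (_≤ m) (ℕₚ.*-identityʳ v) h) (s≤s⁻¹ (subst (m <_) (ℕₚ.*-identityʳ (suc v)) h′))))
picks-inside (suc k) v m h h′ with m ℕₚ.<? suc (v + v) * 2 ^ k
... | yes m< = trans (picks-suc k v m) (cong₂ _++_
  (picks-inside k (v + v) m (subst (_≤ m) (sym (double-* v (2 ^ k))) h) m<)
  (picks-outside k (suc (v + v)) m (inj₁ m<)))
... | no m≮ = trans (picks-suc k v m) (cong₂ _++_
  (picks-outside k (v + v) m (inj₂ (ℕₚ.≮⇒≥ m≮)))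
  (picks-inside k (suc (v + v)) m (ℕₚ.≮⇒≥ m≮) (subst (m <_) (sym (suc-double-* v (2 ^ k))) h′)))

-- Being above `value (trues n)` thus means being at least `2 ^ n`; the numeral of this threshold
-- already stands on the tape, as the ones of a clock word.
value-trues : ∀ n → suc (value (trues n)) ≡ 2 ^ n
value-trues zero    = refl
value-trues (suc n) = begin
  suc (value (true ∷ trues n))                    ≡⟨ cong suc (value-∷ true (trues n)) ⟩
  suc (1 * 2 ^ length (trues n) + value (trues n)) ≡⟨ sym (ℕₚ.+-suc _ (value (trues n))) ⟩
  1 * 2 ^ length (trues n) + suc (value (trues n)) ≡⟨ cong₂ (λ k e → 1 * 2 ^ k + e) (Listₚ.length-replicate n) (value-trues n) ⟩
  1 * 2 ^ n + 2 ^ n                               ≡⟨ lem (2 ^ n) ⟩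
  2 ^ suc n                                       ∎
  where
  open ≡-Reasoning
  lem : ∀ e → 1 * e + e ≡ 2 * e
  lem = solve-∀

-- g(x) = v is the conjunction of g(x) + 1 > v and (2^Q - g(x)) + v > 2^Q - 1, two PP
-- conditions on the pair (v, x); if these are in UP, the unique v can be guessed and verified.
module Verification (PP⊆UP : PP ⊆ UP) {g : Word → ℕ} (M : NT false ⟪ id ⟫ anyWord (λ x → replicate (g x) tt))
                    (C : Complementation M []) where

  open Complementation C

  W : Word → ℕ
  W x = 2 ^ eval exponent (length x)

  g≤W : ∀ x → g x ≤ W x
  g≤W x = subst (_≤ W x) (Listₚ.length-replicate (g x)) (count≤ x)

  v : Word → ℕ
  v y = value (unpair₁ y)

  firstValueℕ : NT true ⟪ id ⟫ ⟪ binary ⟫ (λ y → v y ∷ [])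
  firstValueℕ = map-results ℤ.∣_∣ id (compose firstValue dropSign)

  atLeast atMost : Language
  atLeast y = (ℤ.+ suc (g (unpair₂ y))) ℤ.> (ℤ.+ v y)
  atMost y  = (ℤ.+ ((W (unpair₂ y) ∸ g (unpair₂ y)) + v y)) ℤ.> (ℤ.+ value (trues (eval exponent (length (unpair₂ y)))))

  atLeast∈PP : PP atLeast
  atLeast∈PP = _ , _ , NT⇒#P (compose (nondeterministic secondWord) (sum M unit)) count , NT⇒FP firstValue , λ y → mk⇔ id id
    where
    count : ∀ y → length ((replicate (g (unpair₂ y)) tt ++ tt ∷ []) ++ []) ≡ suc (g (unpair₂ y))
    count y = trans (cong length (Listₚ.++-identityʳ (replicate (g (unpair₂ y)) tt ++ tt ∷ [])))
      (trans (Listₚ.length-++ (replicate (g (unpair₂ y)) tt)) (trans (ℕₚ.+-comm _ 1) (cong suc (Listₚ.length-replicate (g (unpair₂ y))))))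

  atMost∈PP : PP atMost
  atMost∈PP = _ , _ ,
    NT⇒#P (sum (compose (nondeterministic secondWord) (complemented 0)) (compose (nondeterministic firstValueℕ) countBelow)) count ,
    NT⇒FP (compose secondWord (compose (clock exponent) (clockValue exponent (λ n → ℕₚ.≤-trans (s≤s z≤n) (exponent≥ n))))) ,
    λ y → mk⇔ id id
    where
    count : ∀ y → length ((replicate ((W (unpair₂ y) ∸ length (replicate (g (unpair₂ y)) tt)) + 0) tt ++ []) ++ (replicate (v y) tt ++ [])) ≡
                  (W (unpair₂ y) ∸ g (unpair₂ y)) + v y
    count y rewrite Listₚ.length-replicate (g (unpair₂ y)) {tt} | ℕₚ.+-identityʳ (W (unpair₂ y) ∸ g (unpair₂ y))
                  | Listₚ.++-identityʳ (replicate (W (unpair₂ y) ∸ g (unpair₂ y)) tt) | Listₚ.++-identityʳ (replicate (v y) tt)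
                  | Listₚ.length-++ (replicate (W (unpair₂ y) ∸ g (unpair₂ y)) tt) {replicate (v y) tt}
                  | Listₚ.length-replicate (W (unpair₂ y) ∸ g (unpair₂ y)) {tt} | Listₚ.length-replicate (v y) {tt} = refl

  atLeast⇔ : ∀ u x → atLeast (pair (u , x)) ⇔ value u ≤ g x
  atLeast⇔ u x rewrite unpair₁-pair u x | unpair₂-pair u x = mk⇔ (λ { (ℤ.+<+ h) → s≤s⁻¹ h }) (λ h → ℤ.+<+ (s≤s h))

  atMost⇔ : ∀ u x → atMost (pair (u , x)) ⇔ g x ≤ value u
  atMost⇔ u x rewrite unpair₁-pair u x | unpair₂-pair u x = mk⇔ (λ { (ℤ.+<+ h) → to h }) (λ h → ℤ.+<+ (from h))
    where
    open ℕₚ.≤-Reasoning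
    W≡ : suc (value (trues (eval exponent (length x)))) ≡ W x
    W≡ = value-trues (eval exponent (length x))

    to : value (trues (eval exponent (length x))) < (W x ∸ g x) + value u → g x ≤ value u
    to h = ℕₚ.+-cancelˡ-≤ (W x ∸ g x) _ _ (begin
      (W x ∸ g x) + g x     ≡⟨ ℕₚ.m∸n+n≡m (g≤W x) ⟩
      W x                   ≡⟨ sym W≡ ⟩
      suc (value (trues (eval exponent (length x)))) ≤⟨ h ⟩
      (W x ∸ g x) + value u ∎)

    from : g x ≤ value u → value (trues (eval exponent (length x))) < (W x ∸ g x) + value u
    from h = begin
      suc (value (trues (eval exponent (length x)))) ≡⟨ W≡ ⟩
      W x                   ≡⟨ sym (ℕₚ.m∸n+n≡m (g≤W x)) ⟩
      (W x ∸ g x) + g x     ≤⟨ ℕₚ.+-monoʳ-≤ (W x ∸ g x) h ⟩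
      (W x ∸ g x) + value u ∎

  Verified : Word × Word → List ℕ
  Verified (u , x) = pick 0 (g x) u

  -- Membership in UP makes each test have one accepting path or none, so a guess survives both in
  -- exactly one way or not at all. `Verified` decides the equality directly, and the case
  -- distinctions from UP are reconciled with that decision.
  verified : UP atLeast → UP atMost → NT false ⟪ pair ⟫ ⟪ binary ⟫ Verified
  verified (e , e∈#P , e-cases) (e′ , e′∈#P , e′-cases) = weaken-NT id results
    (compose (guard (reindex pair id (#P⇒NT e∈#P))) (compose (guard (reindex pair id (#P⇒NT e′∈#P))) (nondeterministic (reindex pair id firstValueℕ))))
    where
    results : ∀ r → concatMap (λ r → concatMap (λ r → v (pair r) ∷ []) (map (const r) (replicate (e′ (pair r)) tt)))
                              (map (const r) (replicate (e (pair r)) tt)) ≡ Verified r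
    results (u , x) with value u ℕₚ.≟ g x | e-cases (pair (u , x)) | e′-cases (pair (u , x))
    ... | yes u≡g | inj₁ (_ , one₁) | inj₁ (_ , one₂) rewrite one₁ | one₂ = cong (_∷ []) (trans (cong value (unpair₁-pair u x)) u≡g)
    ... | yes u≡g | inj₂ (¬l , _)   | _               = ⊥-elim (¬l (Equivalence.from (atLeast⇔ u x) (ℕₚ.≤-reflexive u≡g)))
    ... | yes u≡g | inj₁ _          | inj₂ (¬l , _)   = ⊥-elim (¬l (Equivalence.from (atMost⇔ u x) (ℕₚ.≤-reflexive (sym u≡g))))
    ... | no u≢g  | inj₁ (l , _)    | inj₁ (l′ , _)   = ⊥-elim (u≢g (ℕₚ.≤-antisym (Equivalence.to (atLeast⇔ u x) l) (Equivalence.to (atMost⇔ u x) l′)))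
    ... | no u≢g  | inj₂ (_ , none) | _               rewrite none = refl
    ... | no u≢g  | inj₁ (_ , one₁) | inj₂ (_ , none) rewrite one₁ | none = refl

  -- The value `g x` may be equal to `W x`, a power of two with the given exponent, and then needs
  -- one more bit than the exponent.
  guessLength : Polynomial
  guessLength = constant 1 ⊕ exponent

  g<2^guessLength : ∀ x → g x < 2 ^ eval guessLength (length x)
  g<2^guessLength x = begin-strict
    g x                            ≤⟨ g≤W x ⟩
    W x                            <⟨ ℕₚ.^-monoʳ-< 2 (s≤s (s≤s z≤n)) (ℕₚ.n<1+n (eval exponent (length x))) ⟩
    2 ^ suc (eval exponent (length x)) ≡⟨ cong (2 ^_) (sym (trans (eval-⊕ (constant 1) exponent (length x)) (cong (_+ eval exponent (length x)) (eval-constant 1 (length x))))) ⟩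
    2 ^ eval guessLength (length x) ∎
    where open ℕₚ.≤-Reasoning

  -- A number below `2 ^ k` is the value of exactly one word of length `k`, leading zeros included,
  -- so one guess survives; `firstValue` strips the zeros before the output.
  unique-value : UPSVₜ g
  unique-value = NT⇒UPSV (weaken-NT id results
    (compose (nondeterministic (clock (scale 2 guessLength)))
      (compose (guessWord guessLength) (verified (PP⊆UP atLeast∈PP) (PP⊆UP atMost∈PP)))))
    where
    results : ∀ x → concatMap Verified (map (_, x) (words (eval guessLength (length x)))) ++ [] ≡ g x ∷ []
    results x = trans (Listₚ.++-identityʳ _) (trans (Listₚ.concatMap-map Verified (_, x) (words (eval guessLength (length x))))
      (picks-inside (eval guessLength (length x)) 0 (g x) z≤n (subst (g x <_) (sym (ℕₚ.*-identityˡ _)) (g<2^guessLength x))))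

PP⊆UP⇒#P⊆UPSV : PP ⊆ UP → #P ⊆ UPSVₜ
PP⊆UP⇒#P⊆UPSV PP⊆UP {g} g∈#P = Verification.unique-value PP⊆UP M (complementation M [])
  where
  M : NT false ⟪ id ⟫ anyWord (λ x → replicate (g x) tt)
  M = #P⇒NT g∈#P

theorem5p1 : ((FP₊∘#P ⊆ #P) ⇔ (#P ≐ UPSVₜ)) × ((#P ≐ UPSVₜ) ⇔ (PP ≐ UP))
theorem5p1 = mk⇔ (three⇒two ∘ one⇒three) two⇒one , mk⇔ (one⇒three ∘ two⇒one) three⇒two
  where
  two⇒one : #P ≐ UPSVₜ → FP₊∘#P ⊆ #P
  two⇒one (#P⊆UPSV , _) {h} = single-valued⇒FP₊∘#P⊆#P #P⊆UPSV {h}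

  one⇒three : FP₊∘#P ⊆ #P → PP ≐ UP
  one⇒three closed = FP₊∘#P⊆#P⇒PP⊆UP closed , UP⊆PP

  three⇒two : PP ≐ UP → #P ≐ UPSVₜ
  three⇒two (PP⊆UP , _) = PP⊆UP⇒#P⊆UPSV PP⊆UP , UPSV⊆#P
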